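{- Let $X$ be an unweighted bipartite graph on an odd number of vertices. If $X$ has a pendent vertex $u$, then local $\epsilon$-uniform mixing relative to the adjacency matrix $A(X)$ does not occur at $u$. In particular, if $X$ (on an odd number of vertices) is a tree or a bipartite unicyclic graph that is not a cycle, then local $\epsilon$-uniform mixing relative to $A(X)$ does not occur at a pendent vertex of $X$.
   Context: Graphs are finite, simple, undirected and connected; unweighted means all edges have weight $1$. A pendent vertex is a vertex of degree $1$. A connected graph on $n$ vertices is unicyclic if it has $n$ edges. Put $U(t)=e^{\mathrm{i}tA(X)}$. $\mathbf{e}_u$ is the characteristic vector of $u$, $\mathbf{1}$ the all-ones vector, $\circ$ the entrywise product. Local $\epsilon$-uniform mixing occurs at $u$ in a graph on $n$ vertices if for each $\epsilon>0$ there is a time $\tau\in\mathbb{R}$ such that $\big\|(U(\tau)\mathbf{e}_u)\circ(\overline{U(\tau)}\mathbf{e}_u)-\tfrac1n\mathbf{1}\big\|<\epsilon$. -}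

module Defs where

open import Data.Bool.Base as Bool using (Bool; if_then_else_)
open import Data.Fin.Base as Fin using (Fin; zero; suc; toℕ)
open import Data.Fin.Properties as Fin using (nonZeroIndex)
open import Data.Integer.Base as ℤ using (+_)
import Data.Integer.Properties as ℤ
open import Data.List.Base using (List; length; filter; allFin; cartesianProduct)
open import Data.Nat.Base as ℕ using (ℕ; zero; suc; _!)
import Data.Nat.Properties as ℕ
open import Data.Product.Base using (∃; _×_; _,_; proj₁; proj₂)
open import Data.Rational.Base as ℚ using (ℚ; mkℚ; 0ℚ; 1ℚ; ½; _+_; _*_; _-_; -_; _/_; _≤_; _<_; ∣_∣; ↥_; toℚᵘ; nonNegative; positive)
open import Data.Rational.Properties as ℚ using (_≤?_)
open import Data.Rational.Solver using (module +-*-Solver)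
import Data.Rational.Unnormalised.Base as ℚᵘ
import Data.Rational.Unnormalised.Properties as ℚᵘ
open import Data.Sum.Base as Sum using (_⊎_; inj₁; inj₂)
open import Data.Vec.Functional using (Vector; foldr; zipWith; map)
open import Function.Base using (_∘_)
open import Function.Bundles using (_↔_; _⇔_; Inverse)
open import Function.Definitions using (Injective)
open import Level using (0ℓ)
open import Relation.Binary.Core using (Rel)
open import Relation.Binary.Definitions using (Symmetric; Decidable)
open import Relation.Binary.Construct.Closure.ReflexiveTransitive using (Star)
open import Relation.Binary.PropositionalEquality using (_≡_; _≢_; refl; sym; trans; cong; cong₂; subst; subst₂)
open import Relation.Nullary using (¬_; Dec; yes; no; does; contradiction)
open import Relation.Nullary.Decidable using (_×-dec_; _⊎-dec_)

open +-*-Solver using (solve; _:+_; _:*_; _:-_; :-_; _:=_; con)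

∣p-r∣≤∣p-q∣+∣q-r∣ : ∀ p q r → ∣ p - r ∣ ≤ ∣ p - q ∣ + ∣ q - r ∣
∣p-r∣≤∣p-q∣+∣q-r∣ p q r = subst (λ x → ∣ x ∣ ≤ ∣ p - q ∣ + ∣ q - r ∣)
  (solve 3 (λ p q r → (p :- q) :+ (q :- r) := p :- r) refl p q r)
  (ℚ.∣p+q∣≤∣p∣+∣q∣ (p - q) (q - r))

∣p-q∣≡∣q-p∣ : ∀ p q → ∣ p - q ∣ ≡ ∣ q - p ∣
∣p-q∣≡∣q-p∣ p q = trans (sym (ℚ.∣-p∣≡∣p∣ (p - q)))
  (cong ∣_∣ (solve 2 (λ p q → :- (p :- q) := q :- p) refl p q))

p≤∣p∣ : ∀ p → p ≤ ∣ p ∣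
p≤∣p∣ p with ℚ.≤-total 0ℚ p
... | inj₁ 0≤p = ℚ.≤-reflexive (sym (ℚ.0≤p⇒∣p∣≡p 0≤p))
... | inj₂ p≤0 = ℚ.≤-trans p≤0 (ℚ.0≤∣p∣ p)

∣p-q∣≤r⇒p≤q+r : ∀ {p q r} → ∣ p - q ∣ ≤ r → p ≤ q + r
∣p-q∣≤r⇒p≤q+r {p} {q} {r} h = subst (_≤ q + r)
  (solve 2 (λ p q → q :+ (p :- q) := p) refl p q)
  (ℚ.+-monoʳ-≤ q (ℚ.≤-trans (p≤∣p∣ (p - q)) h))

p≤q+r⇒p-q≤r : ∀ {p q r} → p ≤ q + r → p - q ≤ r
p≤q+r⇒p-q≤r {p} {q} {r} h = subst (p - q ≤_)
  (solve 2 (λ q r → (q :+ r) :- q := r) refl q r) (ℚ.+-monoˡ-≤ (- q) h)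

∣p-q∣≤r : ∀ {p q r} → p ≤ q + r → q ≤ p + r → ∣ p - q ∣ ≤ r
∣p-q∣≤r {p} {q} {r} h k with ℚ.∣p∣≡p∨∣p∣≡-p (p - q)
... | inj₁ eq = subst (_≤ r) (sym eq) (p≤q+r⇒p-q≤r h)
... | inj₂ eq = subst (_≤ r)
  (trans (solve 2 (λ p q → q :- p := :- (p :- q)) refl p q) (sym eq)) (p≤q+r⇒p-q≤r k)

½p+½p≡p : ∀ p → ½ * p + ½ * p ≡ p
½p+½p≡p p = trans (sym (ℚ.*-distribʳ-+ p ½ ½)) (ℚ.*-identityˡ p)

*-pos : ∀ {p q} → 0ℚ < p → 0ℚ < q → 0ℚ < p * q
*-pos {p} {q} 0<p 0<q = ℚ.positive⁻¹ (p * q)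
  {{ℚ.pos*pos⇒pos p {{positive 0<p}} q {{positive 0<q}}}}

½-pos : ∀ {p} → 0ℚ < p → 0ℚ < ½ * p
½-pos = *-pos (ℚ.positive⁻¹ ½)

+-nonNeg : ∀ {p q} → 0ℚ ≤ p → 0ℚ ≤ q → 0ℚ ≤ p + q
+-nonNeg = ℚ.+-mono-≤

*-nonNeg : ∀ {p q} → 0ℚ ≤ p → 0ℚ ≤ q → 0ℚ ≤ p * q
*-nonNeg {p} {q} 0≤p 0≤q = ℚ.nonNegative⁻¹ (p * q)
  {{ℚ.nonNeg*nonNeg⇒nonNeg p {{nonNegative 0≤p}} q {{nonNegative 0≤q}}}}

*-mono : ∀ {p q r s} → 0ℚ ≤ r → 0ℚ ≤ q → p ≤ q → r ≤ s → p * r ≤ q * s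
*-mono {p} {q} {r} {s} 0≤r 0≤q p≤q r≤s = ℚ.≤-trans
  (ℚ.*-monoʳ-≤-nonNeg r {{nonNegative 0≤r}} p≤q)
  (ℚ.*-monoˡ-≤-nonNeg q {{nonNegative 0≤q}} r≤s)

p≤p+q : ∀ {p q} → 0ℚ ≤ q → p ≤ p + q
p≤p+q {p} {q} 0≤q = subst (_≤ p + q) (ℚ.+-identityʳ p) (ℚ.+-monoʳ-≤ p 0≤q)

sq-cancel-≤ : ∀ {p q} → 0ℚ ≤ q → p * p ≤ q * q → p ≤ q
sq-cancel-≤ {p} {q} 0≤q h with p ≤? q
... | yes p≤q = p≤q
... | no p≰q = contradiction (ℚ.<-≤-trans q²<p² h) (ℚ.<-irrefl refl)
  where
  q<p : q < p
  q<p = ℚ.≰⇒> p≰q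
  q²<p² : q * q < p * p
  q²<p² = ℚ.≤-<-trans (ℚ.*-monoˡ-≤-nonNeg q {{nonNegative 0≤q}} (ℚ.<⇒≤ q<p))
    (ℚ.*-monoˡ-<-pos p {{positive (ℚ.≤-<-trans 0≤q q<p)}} q<p)

toℚᵘ-/ : ∀ a n → toℚᵘ (a / suc n) ℚᵘ.≃ ℚᵘ.mkℚᵘ a n
toℚᵘ-/ a n = ℚ.toℚᵘ-fromℚᵘ (ℚᵘ.mkℚᵘ a n)

ι : ℕ → ℚ
ι n = + n / 1

1/1+_ : ℕ → ℚ
1/1+ n = + 1 / suc n

/-*-/ : ∀ a b m n → (a / suc m) * (b / suc n) ≡ (a ℤ.* b) / (suc m ℕ.* suc n)
/-*-/ a b m n = ℚ.toℚᵘ-injective (begin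
  toℚᵘ ((a / suc m) * (b / suc n))             ≈⟨ ℚ.toℚᵘ-homo-* (a / suc m) (b / suc n) ⟩
  toℚᵘ (a / suc m) ℚᵘ.* toℚᵘ (b / suc n)       ≈⟨ ℚᵘ.*-cong (toℚᵘ-/ a m) (toℚᵘ-/ b n) ⟩
  ℚᵘ.mkℚᵘ a m ℚᵘ.* ℚᵘ.mkℚᵘ b n                 ≈⟨ toℚᵘ-/ (a ℤ.* b) _ ⟨
  toℚᵘ ((a ℤ.* b) / (suc m ℕ.* suc n))         ∎)
  where open ℚᵘ.≃-Reasoning

ι-+ : ∀ m n → ι (m ℕ.+ n) ≡ ι m + ι n
ι-+ m n = ℚ.toℚᵘ-injective (begin
  toℚᵘ (ι (m ℕ.+ n))              ≈⟨ toℚᵘ-/ (+ (m ℕ.+ n)) 0 ⟩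
  ℚᵘ.mkℚᵘ (+ (m ℕ.+ n)) 0         ≡⟨ cong (λ z → ℚᵘ.mkℚᵘ z 0)
                                       (cong₂ ℤ._+_ (sym (ℤ.*-identityʳ (+ m))) (sym (ℤ.*-identityʳ (+ n)))) ⟩
  ℚᵘ.mkℚᵘ (+ m) 0 ℚᵘ.+ ℚᵘ.mkℚᵘ (+ n) 0  ≈⟨ ℚᵘ.+-cong (toℚᵘ-/ (+ m) 0) (toℚᵘ-/ (+ n) 0) ⟨
  toℚᵘ (ι m) ℚᵘ.+ toℚᵘ (ι n)      ≈⟨ ℚ.toℚᵘ-homo-+ (ι m) (ι n) ⟨
  toℚᵘ (ι m + ι n)                ∎)
  where open ℚᵘ.≃-Reasoning

ι-* : ∀ m n → ι (m ℕ.* n) ≡ ι m * ι n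
ι-* m n = sym (trans (/-*-/ (+ m) (+ n) 0 0) (cong (_/ 1) (sym (ℤ.pos-* m n))))

/-mono-≤ : ∀ {a b m n} → a ℤ.* + suc n ℤ.≤ b ℤ.* + suc m → a / suc m ≤ b / suc n
/-mono-≤ {a} {b} {m} {n} h = ℚ.toℚᵘ-cancel-≤
  (ℚᵘ.≤-respˡ-≃ (ℚᵘ.≃-sym (toℚᵘ-/ a m)) (ℚᵘ.≤-respʳ-≃ (ℚᵘ.≃-sym (toℚᵘ-/ b n)) (ℚᵘ.*≤* h)))

ι-mono : ∀ {m n} → m ℕ.≤ n → ι m ≤ ι n
ι-mono {m} {n} m≤n = /-mono-≤ {+ m} {+ n} {0} {0} (ℤ.*-monoʳ-≤-nonNeg (+ 1) (ℤ.+≤+ m≤n))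

0≤ι : ∀ n → 0ℚ ≤ ι n
0≤ι n = ι-mono {0} {n} ℕ.z≤n

0<1/1+ : ∀ n → 0ℚ < 1/1+ n
0<1/1+ n = ℚ.positive⁻¹ (1/1+ n) {{ℚ.normalize-pos 1 (suc n)}}

ι*1/1+ : ∀ n → ι (suc n) * 1/1+ n ≡ 1ℚ
ι*1/1+ n = trans (/-*-/ (+ suc n) (+ 1) 0 n)
  (ℚ.fromℚᵘ-cong {ℚᵘ.mkℚᵘ (+ suc n ℤ.* + 1) _} {ℚᵘ.mkℚᵘ (+ 1) 0}
    (ℚᵘ.*≡* (trans (ℤ.*-identityʳ _) (trans (ℤ.*-comm (+ suc n) (+ 1))
      (cong (λ k → + 1 ℤ.* + k) (sym (ℕ.*-identityˡ (suc n))))))))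

p≤ι : ∀ p → p ≤ ι ℤ.∣ ↥ p ∣
p≤ι p@(mkℚ a d _) = ℚ.toℚᵘ-cancel-≤ (ℚᵘ.≤-respʳ-≃ (ℚᵘ.≃-sym (toℚᵘ-/ (+ ℤ.∣ a ∣) 0))
  (ℚᵘ.*≤* (ℤ.≤-trans (ℤ.≤-reflexive (ℤ.*-identityʳ a)) (lemma a))))
  where
  lemma : ∀ a → a ℤ.≤ + ℤ.∣ a ∣ ℤ.* + suc d
  lemma (+ n) = subst (+ n ℤ.≤_) (ℤ.pos-* n (suc d)) (ℤ.+≤+ (ℕ.m≤m*n n (suc d)))
  lemma ℤ.-[1+ n ] = ℤ.≤-trans ℤ.-≤+ (ℤ.≤-reflexive (ℤ.pos-* (suc n) (suc d)))

1/1+-small : ∀ ε → 0ℚ < ε → ∃ λ N → ∀ i → N ℕ.≤ i → 1/1+ i ≤ ε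
1/1+-small ε@(mkℚ a d _) 0<ε = d , λ i d≤i → ℚ.toℚᵘ-cancel-≤
  (ℚᵘ.≤-respˡ-≃ (ℚᵘ.≃-sym (toℚᵘ-/ (+ 1) i)) (ℚᵘ.*≤* (lemma a (positive 0<ε) d≤i)))
  where
  lemma : ∀ a → ℤ.Positive a → ∀ {i} → d ℕ.≤ i → + 1 ℤ.* + suc d ℤ.≤ a ℤ.* + suc i
  lemma ℤ.+[1+ n ] _ {i} d≤i = ℤ.≤-trans (ℤ.≤-reflexive (ℤ.*-identityˡ (+ suc d)))
    (ℤ.≤-trans (ℤ.+≤+ (ℕ.≤-trans (ℕ.s≤s d≤i) (ℕ.m≤n*m (suc i) (suc n))))
      (ℤ.≤-reflexive (ℤ.pos-* (suc n) (suc i))))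

shrink : ∀ B ε → 0ℚ < ε → ∃ λ δ → 0ℚ < δ × ι B * δ ≤ ε
shrink B ε 0<ε = 1/1+ B * ε , *-pos (0<1/1+ B) 0<ε , (begin
  ι B * (1/1+ B * ε)        ≤⟨ ℚ.*-monoʳ-≤-nonNeg (1/1+ B * ε)
                                 {{nonNegative (ℚ.<⇒≤ (*-pos (0<1/1+ B) 0<ε))}} (ι-mono {B} {suc B} (ℕ.n≤1+n B)) ⟩
  ι (suc B) * (1/1+ B * ε)  ≡⟨ ℚ.*-assoc (ι (suc B)) (1/1+ B) ε ⟨
  ι (suc B) * 1/1+ B * ε    ≡⟨ cong (_* ε) (ι*1/1+ B) ⟩
  1ℚ * ε                    ≡⟨ ℚ.*-identityˡ ε ⟩
  ε                         ∎)
  where open ℚ.≤-Reasoning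

1/_! : ℕ → ℚ
1/ k ! = (+ 1 / (k !)) {{k ℕ.!≢0}}

/-*-unit : ∀ m n .{{_ : ℕ.NonZero m}} .{{_ : ℕ.NonZero n}} .{{_ : ℕ.NonZero (m ℕ.* n)}} →
           + 1 / (m ℕ.* n) ≡ (+ 1 / m) * (+ 1 / n)
/-*-unit (suc m) (suc n) = sym (/-*-/ (+ 1) (+ 1) m n)

1/suc! : ∀ k → 1/ suc k ! ≡ 1/1+ k * 1/ k !
1/suc! k = /-*-unit (suc k) (k !) {{_}} {{k ℕ.!≢0}} {{suc k ℕ.!≢0}}

0≤1/! : ∀ k → 0ℚ ≤ 1/ k !
0≤1/! k = ℚ.nonNegative⁻¹ (1/ k !) {{ℚ.normalize-nonNeg 1 (k !) {{k ℕ.!≢0}}}}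

-- Real numbers are represented by Cauchy sequences of rationals, without
-- taking a quotient; the order below respects the usual identification of
-- sequences whose difference tends to 0.

∀∞ : (ℕ → Set) → Set
∀∞ P = ∃ λ N → ∀ i → N ℕ.≤ i → P i

∀∞-zip : ∀ {P Q R : ℕ → Set} → (∀ i → P i → Q i → R i) → ∀∞ P → ∀∞ Q → ∀∞ R
∀∞-zip f (M , p) (N , q) = M ℕ.⊔ N , λ i h →
  f i (p i (ℕ.≤-trans (ℕ.m≤m⊔n M N) h)) (q i (ℕ.≤-trans (ℕ.m≤n⊔m M N) h))

Cauchy : (ℕ → ℚ) → Set
Cauchy s = ∀ ε → 0ℚ < ε → ∃ λ N → ∀ i j → N ℕ.≤ i → N ℕ.≤ j → ∣ s i - s j ∣ ≤ ε

record ℝ : Set where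
  constructor mkℝ
  field
    seq    : ℕ → ℚ
    cauchy : Cauchy seq

open ℝ public

infix  4 _<ʳ_
infixl 6 _+ʳ_ _-ʳ_
infixl 7 _*ʳ_
infix  8 -ʳ_

_<ʳ_ : ℝ → ℝ → Set
x <ʳ y = ∃ λ δ → 0ℚ < δ × ∀∞ λ i → seq x i + δ ≤ seq y i

fromℚ : ℚ → ℝ
fromℚ q = mkℝ (λ _ → q) λ ε 0<ε → 0 , λ _ _ _ _ →
  subst (λ x → ∣ x ∣ ≤ ε) (sym (ℚ.+-inverseʳ q)) (ℚ.<⇒≤ 0<ε)

0ʳ 1ʳ : ℝ
0ʳ = fromℚ 0ℚ
1ʳ = fromℚ 1ℚ

+-cauchy : ∀ s t → Cauchy s → Cauchy t → Cauchy (λ i → s i + t i)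
+-cauchy s t cs ct ε 0<ε with cs (½ * ε) (½-pos 0<ε) | ct (½ * ε) (½-pos 0<ε)
... | M , p | N , q = M ℕ.⊔ N , λ i j hi hj → begin
  ∣ s i + t i - (s j + t j) ∣     ≡⟨ cong ∣_∣ (solve 4 (λ a b c d → a :+ b :- (c :+ d) := (a :- c) :+ (b :- d))
                                                  refl (s i) (t i) (s j) (t j)) ⟩
  ∣ (s i - s j) + (t i - t j) ∣   ≤⟨ ℚ.∣p+q∣≤∣p∣+∣q∣ (s i - s j) (t i - t j) ⟩
  ∣ s i - s j ∣ + ∣ t i - t j ∣   ≤⟨ ℚ.+-mono-≤
                                       (p i j (ℕ.≤-trans (ℕ.m≤m⊔n M N) hi) (ℕ.≤-trans (ℕ.m≤m⊔n M N) hj))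
                                       (q i j (ℕ.≤-trans (ℕ.m≤n⊔m M N) hi) (ℕ.≤-trans (ℕ.m≤n⊔m M N) hj)) ⟩
  ½ * ε + ½ * ε                   ≡⟨ ½p+½p≡p ε ⟩
  ε                               ∎
  where open ℚ.≤-Reasoning

neg-cauchy : ∀ s → Cauchy s → Cauchy (λ i → - s i)
neg-cauchy s cs ε 0<ε with cs ε 0<ε
... | N , p = N , λ i j hi hj → subst (_≤ ε)
  (trans (sym (ℚ.∣-p∣≡∣p∣ (s i - s j))) (cong ∣_∣ (ℚ.neg-distrib-+ (s i) (- s j)))) (p i j hi hj)

cauchy⇒bounded : ∀ s → Cauchy s → ∃ λ B → ∀∞ λ i → ∣ s i ∣ ≤ ι B
cauchy⇒bounded s cs with cs 1ℚ (ℚ.positive⁻¹ 1ℚ)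
... | N , p = ℤ.∣ ↥ b ∣ , N , λ i hi → begin
  ∣ s i ∣                   ≡⟨ cong ∣_∣ (solve 2 (λ a c → a := (a :- c) :+ c) refl (s i) (s N)) ⟩
  ∣ (s i - s N) + s N ∣     ≤⟨ ℚ.∣p+q∣≤∣p∣+∣q∣ (s i - s N) (s N) ⟩
  ∣ s i - s N ∣ + ∣ s N ∣   ≤⟨ ℚ.+-monoˡ-≤ ∣ s N ∣ (p i N hi ℕ.≤-refl) ⟩
  b                         ≤⟨ p≤ι b ⟩
  ι ℤ.∣ ↥ b ∣               ∎
  where
  open ℚ.≤-Reasoning
  b : ℚ
  b = 1ℚ + ∣ s N ∣

∣pq-rs∣≤ : ∀ p q r s → ∣ p * q - r * s ∣ ≤ ∣ p ∣ * ∣ q - s ∣ + ∣ s ∣ * ∣ p - r ∣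
∣pq-rs∣≤ p q r s = begin
  ∣ p * q - r * s ∣                       ≡⟨ cong ∣_∣ (solve 4 (λ p q r s →
                                               p :* q :- r :* s := p :* (q :- s) :+ s :* (p :- r)) refl p q r s) ⟩
  ∣ p * (q - s) + s * (p - r) ∣           ≤⟨ ℚ.∣p+q∣≤∣p∣+∣q∣ (p * (q - s)) (s * (p - r)) ⟩
  ∣ p * (q - s) ∣ + ∣ s * (p - r) ∣       ≡⟨ cong₂ _+_ (ℚ.∣p*q∣≡∣p∣*∣q∣ p (q - s)) (ℚ.∣p*q∣≡∣p∣*∣q∣ s (p - r)) ⟩
  ∣ p ∣ * ∣ q - s ∣ + ∣ s ∣ * ∣ p - r ∣   ∎
  where open ℚ.≤-Reasoning

*-cauchy : ∀ s t → Cauchy s → Cauchy t → Cauchy (λ i → s i * t i)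
*-cauchy s t cs ct ε 0<ε =
  let B , K , bs = cauchy⇒bounded s cs
      C , L , bt = cauchy⇒bounded t ct
      δ , 0<δ , Bδ≤ = shrink B (½ * ε) (½-pos 0<ε)
      η , 0<η , Cη≤ = shrink C (½ * ε) (½-pos 0<ε)
      M , q = ct δ 0<δ
      N , p = cs η 0<η
      toKL : ∀ {i} → (K ℕ.⊔ L) ℕ.⊔ (M ℕ.⊔ N) ℕ.≤ i → K ℕ.⊔ L ℕ.≤ i
      toKL = ℕ.m⊔n≤o⇒m≤o (K ℕ.⊔ L) (M ℕ.⊔ N)
      toMN : ∀ {i} → (K ℕ.⊔ L) ℕ.⊔ (M ℕ.⊔ N) ℕ.≤ i → M ℕ.⊔ N ℕ.≤ i
      toMN = ℕ.m⊔n≤o⇒n≤o (K ℕ.⊔ L) (M ℕ.⊔ N)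
  in (K ℕ.⊔ L) ℕ.⊔ (M ℕ.⊔ N) , λ i j hi hj → begin
    ∣ s i * t i - s j * t j ∣                           ≤⟨ ∣pq-rs∣≤ (s i) (t i) (s j) (t j) ⟩
    ∣ s i ∣ * ∣ t i - t j ∣ + ∣ t j ∣ * ∣ s i - s j ∣   ≤⟨ ℚ.+-mono-≤
      (*-mono (ℚ.0≤∣p∣ (t i - t j)) (0≤ι B) (bs i (ℕ.m⊔n≤o⇒m≤o K L (toKL hi)))
        (q i j (ℕ.m⊔n≤o⇒m≤o M N (toMN hi)) (ℕ.m⊔n≤o⇒m≤o M N (toMN hj))))
      (*-mono (ℚ.0≤∣p∣ (s i - s j)) (0≤ι C) (bt j (ℕ.m⊔n≤o⇒n≤o K L (toKL hj)))
        (p i j (ℕ.m⊔n≤o⇒n≤o M N (toMN hi)) (ℕ.m⊔n≤o⇒n≤o M N (toMN hj)))) ⟩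
    ι B * δ + ι C * η                                   ≤⟨ ℚ.+-mono-≤ Bδ≤ Cη≤ ⟩
    ½ * ε + ½ * ε                                       ≡⟨ ½p+½p≡p ε ⟩
    ε                                                   ∎
  where open ℚ.≤-Reasoning

_+ʳ_ : ℝ → ℝ → ℝ
x +ʳ y = mkℝ (λ i → seq x i + seq y i) (+-cauchy (seq x) (seq y) (cauchy x) (cauchy y))

-ʳ_ : ℝ → ℝ
-ʳ x = mkℝ (λ i → - seq x i) (neg-cauchy (seq x) (cauchy x))

_-ʳ_ : ℝ → ℝ → ℝ
x -ʳ y = x +ʳ (-ʳ y)

_*ʳ_ : ℝ → ℝ → ℝ
x *ʳ y = mkℝ (λ i → seq x i * seq y i) (*-cauchy (seq x) (seq y) (cauchy x) (cauchy y))

Cauchyʳ : (ℕ → ℝ) → Set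
Cauchyʳ f = ∀ ε → 0ℚ < ε → ∃ λ N → ∀ m n → N ℕ.≤ m → N ℕ.≤ n →
            ∀∞ λ i → ∣ seq (f m) i - seq (f n) i ∣ ≤ ε

∣p-s∣≤ : ∀ p q r s {ε} → ∣ p - q ∣ ≤ ½ * (½ * ε) → ∣ q - r ∣ ≤ ½ * ε → ∣ s - r ∣ ≤ ½ * (½ * ε) → ∣ p - s ∣ ≤ ε
∣p-s∣≤ p q r s {ε} pq qr sr = begin
  ∣ p - s ∣                                 ≤⟨ ∣p-r∣≤∣p-q∣+∣q-r∣ p q s ⟩
  ∣ p - q ∣ + ∣ q - s ∣                     ≤⟨ ℚ.+-monoʳ-≤ ∣ p - q ∣ (∣p-r∣≤∣p-q∣+∣q-r∣ q r s) ⟩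
  ∣ p - q ∣ + (∣ q - r ∣ + ∣ r - s ∣)       ≡⟨ cong (λ x → ∣ p - q ∣ + (∣ q - r ∣ + x)) (∣p-q∣≡∣q-p∣ r s) ⟩
  ∣ p - q ∣ + (∣ q - r ∣ + ∣ s - r ∣)       ≤⟨ ℚ.+-mono-≤ pq (ℚ.+-mono-≤ qr sr) ⟩
  ½ * (½ * ε) + (½ * ε + ½ * (½ * ε))       ≡⟨ solve 2 (λ a b → a :+ (b :+ a) := (a :+ a) :+ b) refl (½ * (½ * ε)) (½ * ε) ⟩
  (½ * (½ * ε) + ½ * (½ * ε)) + ½ * ε       ≡⟨ cong (_+ ½ * ε) (½p+½p≡p (½ * ε)) ⟩
  ½ * ε + ½ * ε                             ≡⟨ ½p+½p≡p ε ⟩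
  ε                                         ∎
  where open ℚ.≤-Reasoning

-- The m-th term of the limit is a rational approximation of f m to within 1/(1+m).
module _ (f : ℕ → ℝ) where

  stage : ℕ → ℕ
  stage m = proj₁ (cauchy (f m) (1/1+ m) (0<1/1+ m))

  limSeq : ℕ → ℚ
  limSeq m = seq (f m) (stage m)

  limSeq-close : ∀ m → ∀∞ λ i → ∣ limSeq m - seq (f m) i ∣ ≤ 1/1+ m
  limSeq-close m = stage m , λ i → proj₂ (cauchy (f m) (1/1+ m) (0<1/1+ m)) (stage m) i ℕ.≤-refl

  limSeq-cauchy : Cauchyʳ f → Cauchy limSeq
  limSeq-cauchy cf ε 0<ε =
    let M , small = 1/1+-small (½ * (½ * ε)) (½-pos (½-pos 0<ε))
        N , close = cf (½ * ε) (½-pos 0<ε)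
    in M ℕ.⊔ N , λ m n hm hn →
      let i , h = ∀∞-zip (λ _ → _,_) (close m n (ℕ.m⊔n≤o⇒n≤o M N hm) (ℕ.m⊔n≤o⇒n≤o M N hn))
                    (∀∞-zip (λ _ → _,_) (limSeq-close m) (limSeq-close n))
          mn , lm , ln = h i ℕ.≤-refl
      in ∣p-s∣≤ (limSeq m) (seq (f m) i) (seq (f n) i) (limSeq n)
           (ℚ.≤-trans lm (small m (ℕ.m⊔n≤o⇒m≤o M N hm))) mn
           (ℚ.≤-trans ln (small n (ℕ.m⊔n≤o⇒m≤o M N hn)))

  lim : Cauchyʳ f → ℝ
  lim cf = mkℝ limSeq (limSeq-cauchy cf)

root-step : ℚ → ℚ → ℚ → ℚ
root-step a δ r = if does ((r + δ) * (r + δ) ≤? a) then r + δ else r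

climb : ℚ → ℚ → ℕ → ℚ
climb a δ zero    = 0ℚ
climb a δ (suc k) = root-step a δ (climb a δ k)

-- The largest multiple r of 1/(1+m) with r² ≤ a, or 0 if a < 0.
approxRoot : ℚ → ℕ → ℚ
approxRoot a m = climb a (1/1+ m) (suc ℤ.∣ ↥ a ∣ ℕ.* suc m)

IsRoot : ℚ → ℚ → ℚ → Set
IsRoot a δ r = 0ℚ ≤ r × (r ≡ 0ℚ ⊎ r * r ≤ a) × a < (r + δ) * (r + δ)

root-step-cases : ∀ a δ r → ((r + δ) * (r + δ) ≤ a × root-step a δ r ≡ r + δ) ⊎
                            (a < (r + δ) * (r + δ) × root-step a δ r ≡ r)
root-step-cases a δ r = cases ((r + δ) * (r + δ) ≤? a)
  where
  cases : (d : Dec ((r + δ) * (r + δ) ≤ a)) →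
          ((r + δ) * (r + δ) ≤ a × (if does d then r + δ else r) ≡ r + δ) ⊎
          (a < (r + δ) * (r + δ) × (if does d then r + δ else r) ≡ r)
  cases (yes h) = inj₁ (h , refl)
  cases (no h)  = inj₂ (ℚ.≰⇒> h , refl)

Lower : ℚ → ℚ → Set
Lower a r = 0ℚ ≤ r × (r ≡ 0ℚ ⊎ r * r ≤ a)

climb-lower : ∀ a δ → 0ℚ ≤ δ → ∀ k → Lower a (climb a δ k)
climb-lower a δ 0≤δ zero = ℚ.≤-refl , inj₁ refl
climb-lower a δ 0≤δ (suc k) = step (climb a δ k) (climb-lower a δ 0≤δ k)
  where
  step : ∀ r → Lower a r → Lower a (root-step a δ r)
  step r (0≤r , low) with root-step-cases a δ r
  ... | inj₁ (h , eq) = subst (Lower a) (sym eq) (+-nonNeg {r} {δ} 0≤r 0≤δ , inj₂ h)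
  ... | inj₂ (_ , eq) = subst (Lower a) (sym eq) (0≤r , low)

Upper : ℚ → ℚ → ℕ → ℚ → Set
Upper a δ k r = r ≡ ι k * δ ⊎ a < (r + δ) * (r + δ)

climb-upper : ∀ a δ k → Upper a δ k (climb a δ k)
climb-upper a δ zero = inj₁ (sym (ℚ.*-zeroˡ δ))
climb-upper a δ (suc k) = step (climb a δ k) (climb-upper a δ k)
  where
  step : ∀ r → Upper a δ k r → Upper a δ (suc k) (root-step a δ r)
  step r up with root-step-cases a δ r
  step r up         | inj₂ (h , eq) = subst (Upper a δ (suc k)) (sym eq) (inj₂ h)
  step r (inj₂ h′)  | inj₁ (h , _)  = contradiction (ℚ.<-≤-trans h′ h) (ℚ.<-irrefl refl)
  step r (inj₁ eq′) | inj₁ (_ , eq) = inj₁ (trans eq (trans (cong (_+ δ) eq′)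
    (sym (trans (cong (_* δ) (ι-+ 1 k))
      (trans (ℚ.*-distribʳ-+ δ 1ℚ (ι k)) (trans (cong (_+ ι k * δ) (ℚ.*-identityˡ δ))
        (ℚ.+-comm δ (ι k * δ))))))))

ι<ι-suc : ∀ n → ι n < ι (suc n)
ι<ι-suc n = subst₂ _<_ (ℚ.+-identityˡ (ι n)) (sym (ι-+ 1 n)) (ℚ.+-monoˡ-< (ι n) (ℚ.positive⁻¹ 1ℚ))

isRoot-of-bounds : ∀ a m b r → a ≤ ι b → Lower a r → Upper a (1/1+ m) (suc b ℕ.* suc m) r → IsRoot a (1/1+ m) r
isRoot-of-bounds a m b r _ (0≤r , low) (inj₂ up) = 0≤r , low , up
isRoot-of-bounds a m b r a≤b (0≤r , low) (inj₁ eq) = 0≤r , low , (begin-strict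
  a                                  ≤⟨ a≤b ⟩
  ι b                                <⟨ ι<ι-suc b ⟩
  ι (suc b)                          ≡⟨ ℚ.*-identityʳ (ι (suc b)) ⟨
  ι (suc b) * 1ℚ                     ≤⟨ ℚ.*-monoˡ-≤-nonNeg (ι (suc b)) {{nonNegative (0≤ι (suc b))}}
                                          (ι-mono {1} {suc b} (ℕ.s≤s ℕ.z≤n)) ⟩
  ι (suc b) * ι (suc b)              ≤⟨ *-mono (0≤ι (suc b)) (ℚ.≤-trans (0≤ι (suc b)) b≤) b≤ b≤ ⟩
  (r + 1/1+ m) * (r + 1/1+ m)        ∎)
  where
  open ℚ.≤-Reasoning
  r≡b : r ≡ ι (suc b)
  r≡b = trans eq (trans (cong (_* 1/1+ m) (ι-* (suc b) (suc m)))
    (trans (ℚ.*-assoc (ι (suc b)) (ι (suc m)) (1/1+ m))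
      (trans (cong (ι (suc b) *_) (ι*1/1+ m)) (ℚ.*-identityʳ (ι (suc b))))))
  b≤ : ι (suc b) ≤ r + 1/1+ m
  b≤ = subst (λ x → ι (suc b) ≤ x + 1/1+ m) (sym r≡b) (p≤p+q (ℚ.<⇒≤ (0<1/1+ m)))

approxRoot-isRoot : ∀ a m → IsRoot a (1/1+ m) (approxRoot a m)
approxRoot-isRoot a m = isRoot-of-bounds a m ℤ.∣ ↥ a ∣ (approxRoot a m) (p≤ι a)
  (climb-lower a (1/1+ m) (ℚ.<⇒≤ (0<1/1+ m)) (suc ℤ.∣ ↥ a ∣ ℕ.* suc m))
  (climb-upper a (1/1+ m) (suc ℤ.∣ ↥ a ∣ ℕ.* suc m))

isRoot-close : ∀ {a b δ η r s e} → IsRoot a δ r → IsRoot b η s → 0ℚ < e → 0ℚ < η → η ≤ e →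
               ∣ a - b ∣ ≤ e * e → r ≤ s + (e + e)
isRoot-close {s = s} {e} (_ , inj₁ refl , _) (0≤s , _) 0<e _ _ _ =
  +-nonNeg 0≤s (+-nonNeg (ℚ.<⇒≤ 0<e) (ℚ.<⇒≤ 0<e))
isRoot-close {a} {b} {δ} {η} {r} {s} {e} (_ , inj₂ r²≤a , _) (0≤s , _ , b<) 0<e 0<η η≤e h =
  sq-cancel-≤ (+-nonNeg 0≤s (+-nonNeg 0≤e 0≤e)) (begin
    r * r                                  ≤⟨ r²≤a ⟩
    a                                      ≤⟨ ∣p-q∣≤r⇒p≤q+r h ⟩
    b + e * e                              ≤⟨ ℚ.+-monoˡ-≤ (e * e) (ℚ.<⇒≤ b<) ⟩
    (s + η) * (s + η) + e * e              ≤⟨ ℚ.+-monoˡ-≤ (e * e) (*-mono (+-nonNeg 0≤s (ℚ.<⇒≤ 0<η))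
                                                (+-nonNeg 0≤s 0≤e) sη≤se sη≤se) ⟩
    (s + e) * (s + e) + e * e              ≤⟨ p≤p+q (+-nonNeg (*-nonNeg (+-nonNeg 0≤s 0≤e) 0≤e)
                                                              (*-nonNeg (+-nonNeg 0≤s 0≤e) 0≤e)) ⟩
    (s + e) * (s + e) + e * e + ((s + e) * e + (s + e) * e)
                                           ≡⟨ solve 2 (λ s e →
                                                (s :+ e) :* (s :+ e) :+ e :* e :+ ((s :+ e) :* e :+ (s :+ e) :* e) :=
                                                (s :+ (e :+ e)) :* (s :+ (e :+ e))) refl s e ⟩
    (s + (e + e)) * (s + (e + e))          ∎)
  where
  open ℚ.≤-Reasoning
  0≤e : 0ℚ ≤ e
  0≤e = ℚ.<⇒≤ 0<e
  sη≤se : s + η ≤ s + e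
  sη≤se = ℚ.+-monoʳ-≤ s η≤e

approxRoot-close : ∀ a b i j ε → 0ℚ < ε → ∣ a - b ∣ ≤ ½ * ε * (½ * ε) → 1/1+ j ≤ ½ * ε →
                   approxRoot a i ≤ approxRoot b j + ε
approxRoot-close a b i j ε 0<ε h k = subst (λ x → approxRoot a i ≤ approxRoot b j + x) (½p+½p≡p ε)
  (isRoot-close (approxRoot-isRoot a i) (approxRoot-isRoot b j) (½-pos 0<ε) (0<1/1+ j) k h)

approxRoot-cauchy : ∀ s → Cauchy s → Cauchy (λ i → approxRoot (s i) i)
approxRoot-cauchy s cs ε 0<ε =
  let M , p = cs (½ * ε * (½ * ε)) (*-pos (½-pos 0<ε) (½-pos 0<ε))
      N , q = 1/1+-small (½ * ε) (½-pos 0<ε)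
  in M ℕ.⊔ N , λ i j hi hj → ∣p-q∣≤r {approxRoot (s i) i} {approxRoot (s j) j}
    (approxRoot-close (s i) (s j) i j ε 0<ε
      (p i j (ℕ.m⊔n≤o⇒m≤o M N hi) (ℕ.m⊔n≤o⇒m≤o M N hj)) (q j (ℕ.m⊔n≤o⇒n≤o M N hj)))
    (approxRoot-close (s j) (s i) j i ε 0<ε
      (p j i (ℕ.m⊔n≤o⇒m≤o M N hj) (ℕ.m⊔n≤o⇒m≤o M N hi)) (q i (ℕ.m⊔n≤o⇒n≤o M N hi)))

√ : ℝ → ℝ
√ x = mkℝ (λ i → approxRoot (seq x i) i) (approxRoot-cauchy (seq x) (cauchy x))

record ℂ : Set where
  constructor _+i_
  field
    re im : ℝ

open ℂ public

infixl 6 _+ᶜ_ _-ᶜ_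
infixl 7 _*ᶜ_

_+ᶜ_ _-ᶜ_ _*ᶜ_ : ℂ → ℂ → ℂ
z +ᶜ w = (re z +ʳ re w) +i (im z +ʳ im w)
z -ᶜ w = (re z -ʳ re w) +i (im z -ʳ im w)
z *ᶜ w = (re z *ʳ re w -ʳ im z *ʳ im w) +i (re z *ʳ im w +ʳ im z *ʳ re w)

fromℝ : ℝ → ℂ
fromℝ x = x +i 0ʳ

0ᶜ 1ᶜ iᶜ : ℂ
0ᶜ = fromℝ 0ʳ
1ᶜ = fromℝ 1ʳ
iᶜ = 0ʳ +i 1ʳ

conj : ℂ → ℂ
conj z = re z +i (-ʳ im z)

∣_∣² : ℂ → ℝ
∣ z ∣² = re z *ʳ re z +ʳ im z *ʳ im z

∑ : ∀ {n} → Vector ℂ n → ℂ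
∑ = foldr _+ᶜ_ 0ᶜ

∑ʳ : ∀ {n} → Vector ℝ n → ℝ
∑ʳ = foldr _+ʳ_ 0ʳ

Matrix : ℕ → Set
Matrix n = Fin n → Fin n → ℂ

infixl 6 _⊞_ _⊟_
infixl 7 _⊠_ _⊠ᵛ_ _⊙_ _•_ _•ᵛ_
infixr 8 _^^_

_⊞_ _⊠_ : ∀ {n} → Matrix n → Matrix n → Matrix n
(M ⊞ N) a b = M a b +ᶜ N a b
(M ⊠ N) a b = ∑ λ c → M a c *ᶜ N c b

_•_ : ∀ {n} → ℂ → Matrix n → Matrix n
(z • M) a b = z *ᶜ M a b

𝟎 𝐈 : ∀ {n} → Matrix n
𝟎 a b = 0ᶜ
𝐈 a b = if does (a Fin.≟ b) then 1ᶜ else 0ᶜ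

_^^_ : ∀ {n} → Matrix n → ℕ → Matrix n
M ^^ zero  = 𝐈
M ^^ suc k = M ⊠ M ^^ k

conjᴹ : ∀ {n} → Matrix n → Matrix n
conjᴹ M a b = conj (M a b)

_⊠ᵛ_ : ∀ {n} → Matrix n → Vector ℂ n → Vector ℂ n
(M ⊠ᵛ v) a = ∑ λ b → M a b *ᶜ v b

_⊙_ _⊟_ : ∀ {n} → Vector ℂ n → Vector ℂ n → Vector ℂ n
_⊙_ = zipWith _*ᶜ_
_⊟_ = zipWith _-ᶜ_

_•ᵛ_ : ∀ {n} → ℂ → Vector ℂ n → Vector ℂ n
z •ᵛ v = map (z *ᶜ_) v

𝐞 : ∀ {n} → Fin n → Vector ℂ n
𝐞 u v = if does (u Fin.≟ v) then 1ᶜ else 0ᶜ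

𝟏 : ∀ {n} → Vector ℂ n
𝟏 _ = 1ᶜ

∥_∥ : ∀ {n} → Vector ℂ n → ℝ
∥ v ∥ = √ (∑ʳ λ a → ∣ v a ∣²)

expTerm : ∀ {n} → Matrix n → ℕ → Matrix n
expTerm M k = fromℝ (fromℚ (1/ k !)) • M ^^ k

expSum : ∀ {n} → Matrix n → ℕ → Matrix n
expSum M zero    = 𝟎
expSum M (suc m) = expSum M m ⊞ expTerm M m

-- Convergence is shown on each term of the underlying rational sequences,
-- measuring a complex number by ∣re∣ + ∣im∣.

size : ℂ → ℕ → ℚ
size z i = ∣ seq (re z) i ∣ + ∣ seq (im z) i ∣

0≤size : ∀ z i → 0ℚ ≤ size z i
0≤size z i = +-nonNeg (ℚ.0≤∣p∣ (seq (re z) i)) (ℚ.0≤∣p∣ (seq (im z) i))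

size-+ : ∀ z w i → size (z +ᶜ w) i ≤ size z i + size w i
size-+ z w i = lemma (seq (re z) i) (seq (im z) i) (seq (re w) i) (seq (im w) i)
  where
  open ℚ.≤-Reasoning
  lemma : ∀ a b c d → ∣ a + c ∣ + ∣ b + d ∣ ≤ (∣ a ∣ + ∣ b ∣) + (∣ c ∣ + ∣ d ∣)
  lemma a b c d = begin
    ∣ a + c ∣ + ∣ b + d ∣               ≤⟨ ℚ.+-mono-≤ (ℚ.∣p+q∣≤∣p∣+∣q∣ a c) (ℚ.∣p+q∣≤∣p∣+∣q∣ b d) ⟩
    (∣ a ∣ + ∣ c ∣) + (∣ b ∣ + ∣ d ∣)   ≡⟨ solve 4 (λ a b c d → (a :+ c) :+ (b :+ d) := (a :+ b) :+ (c :+ d))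
                                             refl (∣ a ∣) (∣ b ∣) (∣ c ∣) (∣ d ∣) ⟩
    (∣ a ∣ + ∣ b ∣) + (∣ c ∣ + ∣ d ∣)   ∎

size-* : ∀ z w i → size (z *ᶜ w) i ≤ size z i * size w i
size-* z w i = lemma (seq (re z) i) (seq (im z) i) (seq (re w) i) (seq (im w) i)
  where
  open ℚ.≤-Reasoning
  lemma : ∀ a b c d → ∣ a * c - b * d ∣ + ∣ a * d + b * c ∣ ≤ (∣ a ∣ + ∣ b ∣) * (∣ c ∣ + ∣ d ∣)
  lemma a b c d = begin
    ∣ a * c - b * d ∣ + ∣ a * d + b * c ∣
      ≤⟨ ℚ.+-mono-≤ (ℚ.∣p-q∣≤∣p∣+∣q∣ (a * c) (b * d)) (ℚ.∣p+q∣≤∣p∣+∣q∣ (a * d) (b * c)) ⟩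
    (∣ a * c ∣ + ∣ b * d ∣) + (∣ a * d ∣ + ∣ b * c ∣)
      ≡⟨ cong₂ _+_ (cong₂ _+_ (ℚ.∣p*q∣≡∣p∣*∣q∣ a c) (ℚ.∣p*q∣≡∣p∣*∣q∣ b d))
                   (cong₂ _+_ (ℚ.∣p*q∣≡∣p∣*∣q∣ a d) (ℚ.∣p*q∣≡∣p∣*∣q∣ b c)) ⟩
    (∣ a ∣ * ∣ c ∣ + ∣ b ∣ * ∣ d ∣) + (∣ a ∣ * ∣ d ∣ + ∣ b ∣ * ∣ c ∣)
      ≡⟨ solve 4 (λ a b c d → (a :* c :+ b :* d) :+ (a :* d :+ b :* c) := (a :+ b) :* (c :+ d))
           refl (∣ a ∣) (∣ b ∣) (∣ c ∣) (∣ d ∣) ⟩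
    (∣ a ∣ + ∣ b ∣) * (∣ c ∣ + ∣ d ∣)   ∎

size-∑ : ∀ {n} (v : Vector ℂ n) i b → (∀ a → size (v a) i ≤ b) → size (∑ v) i ≤ ι n * b
size-∑ {zero}  v i b h = ℚ.≤-reflexive (sym (ℚ.*-zeroˡ b))
size-∑ {suc n} v i b h = begin
  size (v zero +ᶜ ∑ (v ∘ suc)) i         ≤⟨ size-+ (v zero) (∑ (v ∘ suc)) i ⟩
  size (v zero) i + size (∑ (v ∘ suc)) i ≤⟨ ℚ.+-mono-≤ (h zero) (size-∑ (v ∘ suc) i b (h ∘ suc)) ⟩
  b + ι n * b                            ≡⟨ cong (_+ ι n * b) (ℚ.*-identityˡ b) ⟨
  1ℚ * b + ι n * b                       ≡⟨ ℚ.*-distribʳ-+ b 1ℚ (ι n) ⟨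
  (1ℚ + ι n) * b                         ≡⟨ cong (_* b) (ι-+ 1 n) ⟨
  ι (suc n) * b                          ∎
  where open ℚ.≤-Reasoning

size-bounded : ∀ z → ∃ λ B → ∀∞ λ i → size z i ≤ ι B
size-bounded z =
  let B , p = cauchy⇒bounded (seq (re z)) (cauchy (re z))
      C , q = cauchy⇒bounded (seq (im z)) (cauchy (im z))
  in B ℕ.+ C , ∀∞-zip (λ i h k → ℚ.≤-trans (ℚ.+-mono-≤ h k) (ℚ.≤-reflexive (sym (ι-+ B C)))) p q

uniform : ∀ {n} (P : Fin n → ℕ → ℕ → Set) → (∀ a {B C i} → B ℕ.≤ C → P a B i → P a C i) →
          (∀ a → ∃ λ B → ∀∞ (P a B)) → ∃ λ B → ∀∞ λ i → ∀ a → P a B i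
uniform {zero}  P mono h = 0 , 0 , λ _ _ ()
uniform {suc n} P mono h =
  let B , p = h zero
      C , q = uniform (P ∘ suc) (mono ∘ suc) (h ∘ suc)
  in B ℕ.⊔ C , ∀∞-zip (λ i x y → λ where
       zero    → mono zero (ℕ.m≤m⊔n B C) x
       (suc a) → mono (suc a) (ℕ.m≤n⊔m B C) (y a)) p q

Bounded : ∀ {n} → Matrix n → ℕ → ℕ → Set
Bounded M B i = ∀ a b → size (M a b) i ≤ ι B

bounded : ∀ {n} (M : Matrix n) → ∃ λ B → ∀∞ (Bounded M B)
bounded M = uniform (λ a B i → ∀ b → size (M a b) i ≤ ι B)
  (λ a {B} {C} B≤C h b → ℚ.≤-trans (h b) (ι-mono {B} {C} B≤C))
  (λ a → uniform (λ b B i → size (M a b) i ≤ ι B)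
    (λ b {B} {C} B≤C h → ℚ.≤-trans h (ι-mono {B} {C} B≤C)) (λ b → size-bounded (M a b)))

𝐈-bounded : ∀ {n} i → Bounded (𝐈 {n}) 1 i
𝐈-bounded i a b with does (a Fin.≟ b)
... | Bool.true  = ℚ.≤-refl
... | Bool.false = ι-mono {0} {1} ℕ.z≤n

^^-bounded : ∀ {n} (M : Matrix n) B i → Bounded M B i → ∀ k → Bounded (M ^^ k) ((n ℕ.* B) ℕ.^ k) i
^^-bounded M B i h zero = 𝐈-bounded i
^^-bounded {n} M B i h (suc k) a b = begin
  size (∑ λ c → M a c *ᶜ (M ^^ k) c b) i  ≤⟨ size-∑ (λ c → M a c *ᶜ (M ^^ k) c b) i (ι B * ι P) (λ c →
    ℚ.≤-trans (size-* (M a c) ((M ^^ k) c b) i)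
      (*-mono (0≤size ((M ^^ k) c b) i) (0≤ι B) (h a c) (^^-bounded M B i h k c b))) ⟩
  ι n * (ι B * ι P)                       ≡⟨ ℚ.*-assoc (ι n) (ι B) (ι P) ⟨
  ι n * ι B * ι P                         ≡⟨ cong (_* ι P) (ι-* n B) ⟨
  ι (n ℕ.* B) * ι P                       ≡⟨ ι-* (n ℕ.* B) P ⟨
  ι (n ℕ.* B ℕ.* P)                       ∎
  where
  open ℚ.≤-Reasoning
  P : ℕ
  P = (n ℕ.* B) ℕ.^ k

pow/! : ℕ → ℕ → ℚ
pow/! C k = 1/ k ! * ι (C ℕ.^ k)

0≤pow/! : ∀ C k → 0ℚ ≤ pow/! C k
0≤pow/! C k = *-nonNeg (0≤1/! k) (0≤ι (C ℕ.^ k))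

pow/!-suc : ∀ C k → pow/! C (suc k) ≡ ι C * 1/1+ k * pow/! C k
pow/!-suc C k = trans (cong₂ _*_ (1/suc! k) (ι-* C (C ℕ.^ k)))
  (solve 4 (λ a b c d → (a :* b) :* (c :* d) := c :* a :* (b :* d)) refl (1/1+ k) (1/ k !) (ι C) (ι (C ℕ.^ k)))

pow/!-halves : ∀ C k → C ℕ.+ C ℕ.≤ suc k → pow/! C (suc k) + pow/! C (suc k) ≤ pow/! C k
pow/!-halves C k h = begin
  pow/! C (suc k) + pow/! C (suc k)                       ≡⟨ cong₂ _+_ (pow/!-suc C k) (pow/!-suc C k) ⟩
  ι C * 1/1+ k * pow/! C k + ι C * 1/1+ k * pow/! C k     ≡⟨ solve 3 (λ c r t → c :* r :* t :+ c :* r :* t := (c :+ c) :* r :* t)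
                                                       refl (ι C) (1/1+ k) (pow/! C k) ⟩
  (ι C + ι C) * 1/1+ k * pow/! C k                    ≡⟨ cong (λ x → x * 1/1+ k * pow/! C k) (ι-+ C C) ⟨
  ι (C ℕ.+ C) * 1/1+ k * pow/! C k                    ≤⟨ ℚ.*-monoʳ-≤-nonNeg (pow/! C k) {{nonNegative (0≤pow/! C k)}}
                                                       (ℚ.*-monoʳ-≤-nonNeg (1/1+ k) {{nonNegative (ℚ.<⇒≤ (0<1/1+ k))}}
                                                         (ι-mono {C ℕ.+ C} {suc k} h)) ⟩
  ι (suc k) * 1/1+ k * pow/! C k                      ≡⟨ cong (_* pow/! C k) (ι*1/1+ k) ⟩
  1ℚ * pow/! C k                                      ≡⟨ ℚ.*-identityˡ (pow/! C k) ⟩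
  pow/! C k                                           ∎
  where open ℚ.≤-Reasoning

pow/!-decreasing : ∀ C d → pow/! C (d ℕ.+ (C ℕ.+ C)) ≤ pow/! C (C ℕ.+ C)
pow/!-decreasing C zero = ℚ.≤-refl
pow/!-decreasing C (suc d) = ℚ.≤-trans
  (ℚ.≤-trans (p≤p+q (0≤pow/! C (suc (d ℕ.+ (C ℕ.+ C)))))
    (pow/!-halves C (d ℕ.+ (C ℕ.+ C)) (ℕ.m≤n⇒m≤1+n (ℕ.m≤n+m (C ℕ.+ C) d))))
  (pow/!-decreasing C d)

pow/!-small : ∀ C ε → 0ℚ < ε → ∀∞ λ k → pow/! C k ≤ ε
pow/!-small C ε 0<ε =
  let D = ℤ.∣ ↥ pow/! C (C ℕ.+ C) ∣
      δ , 0<δ , Dδ≤ = shrink (C ℕ.* D) ε 0<ε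
      N , small = 1/1+-small δ 0<δ
  in suc (N ℕ.⊔ (C ℕ.+ C)) , λ where
    (suc k) (ℕ.s≤s h) → ℚ.≤-trans (bound C k D δ
      (ℚ.≤-trans (subst (λ j → pow/! C j ≤ pow/! C (C ℕ.+ C)) (ℕ.m∸n+n≡m (ℕ.m⊔n≤o⇒n≤o N (C ℕ.+ C) h))
                   (pow/!-decreasing C (k ℕ.∸ (C ℕ.+ C))))
        (p≤ι (pow/! C (C ℕ.+ C))))
      (small k (ℕ.m⊔n≤o⇒m≤o N (C ℕ.+ C) h))) Dδ≤
  where
  open ℚ.≤-Reasoning
  bound : ∀ C k D δ → pow/! C k ≤ ι D → 1/1+ k ≤ δ → pow/! C (suc k) ≤ ι (C ℕ.* D) * δ
  bound C k D δ t≤ r≤ = begin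
    pow/! C (suc k)              ≡⟨ pow/!-suc C k ⟩
    ι C * 1/1+ k * pow/! C k     ≤⟨ ℚ.*-monoˡ-≤-nonNeg (ι C * 1/1+ k)
                                  {{nonNegative (*-nonNeg (0≤ι C) (ℚ.<⇒≤ (0<1/1+ k)))}} t≤ ⟩
    ι C * 1/1+ k * ι D       ≡⟨ solve 3 (λ c r d → c :* r :* d := c :* d :* r) refl (ι C) (1/1+ k) (ι D) ⟩
    ι C * ι D * 1/1+ k       ≡⟨ cong (_* 1/1+ k) (ι-* C D) ⟨
    ι (C ℕ.* D) * 1/1+ k     ≤⟨ ℚ.*-monoˡ-≤-nonNeg (ι (C ℕ.* D)) {{nonNegative (0≤ι (C ℕ.* D))}} r≤ ⟩
    ι (C ℕ.* D) * δ          ∎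

size-expTerm : ∀ {n} (M : Matrix n) B i → Bounded M B i → ∀ k a b → size (expTerm M k a b) i ≤ pow/! (n ℕ.* B) k
size-expTerm M B i h k a b = ℚ.≤-trans (size-* (fromℝ (fromℚ (1/ k !))) ((M ^^ k) a b) i)
  (*-mono (0≤size ((M ^^ k) a b) i) (0≤1/! k)
    (ℚ.≤-reflexive (trans (ℚ.+-identityʳ (∣ 1/ k ! ∣)) (ℚ.0≤p⇒∣p∣≡p (0≤1/! k))))
    (^^-bounded M B i h k a b))

-- A sequence with increments bounded by C^k/k! varies by at most 2C^n/n! beyond index n ≥ 2C.
module _ (C : ℕ) (s : ℕ → ℚ) (t : ℕ → ℚ) (step : ∀ m → s (suc m) ≡ s m + t m) (t≤ : ∀ m → ∣ t m ∣ ≤ pow/! C m) where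

  tail-≤ : ∀ n → C ℕ.+ C ℕ.≤ n → ∀ d → ∣ s (d ℕ.+ n) - s n ∣ + (pow/! C (d ℕ.+ n) + pow/! C (d ℕ.+ n)) ≤ pow/! C n + pow/! C n
  tail-≤ n 2C≤n zero = ℚ.≤-reflexive (trans (cong (λ x → ∣ x ∣ + (pow/! C n + pow/! C n)) (ℚ.+-inverseʳ (s n)))
    (ℚ.+-identityˡ (pow/! C n + pow/! C n)))
  tail-≤ n 2C≤n (suc d) = begin
    ∣ s (suc m) - s n ∣ + (pow/! C (suc m) + pow/! C (suc m))   ≤⟨ ℚ.+-mono-≤ increment (pow/!-halves C m (ℕ.≤-trans 2C≤n (ℕ.m≤n⇒m≤1+n (ℕ.m≤n+m n d)))) ⟩
    (∣ s m - s n ∣ + pow/! C m) + pow/! C m                     ≡⟨ ℚ.+-assoc (∣ s m - s n ∣) (pow/! C m) (pow/! C m) ⟩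
    ∣ s m - s n ∣ + (pow/! C m + pow/! C m)                     ≤⟨ tail-≤ n 2C≤n d ⟩
    pow/! C n + pow/! C n                                       ∎
    where
    open ℚ.≤-Reasoning
    m : ℕ
    m = d ℕ.+ n
    increment : ∣ s (suc m) - s n ∣ ≤ ∣ s m - s n ∣ + pow/! C m
    increment = begin
      ∣ s (suc m) - s n ∣        ≡⟨ cong (λ x → ∣ x - s n ∣) (step m) ⟩
      ∣ s m + t m - s n ∣        ≡⟨ cong ∣_∣ (solve 3 (λ a b c → a :+ b :- c := (a :- c) :+ b) refl (s m) (t m) (s n)) ⟩
      ∣ (s m - s n) + t m ∣      ≤⟨ ℚ.∣p+q∣≤∣p∣+∣q∣ (s m - s n) (t m) ⟩
      ∣ s m - s n ∣ + ∣ t m ∣    ≤⟨ ℚ.+-monoʳ-≤ (∣ s m - s n ∣) (t≤ m) ⟩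
      ∣ s m - s n ∣ + pow/! C m      ∎

  tail-close : ∀ ε m n → C ℕ.+ C ℕ.≤ n → pow/! C n ≤ ½ * ε → n ℕ.≤ m → ∣ s m - s n ∣ ≤ ε
  tail-close ε m n 2C≤n small n≤m = begin
    ∣ s m - s n ∣                                   ≤⟨ p≤p+q (+-nonNeg (0≤pow/! C m) (0≤pow/! C m)) ⟩
    ∣ s m - s n ∣ + (pow/! C m + pow/! C m)                 ≤⟨ subst (λ k → ∣ s k - s n ∣ + (pow/! C k + pow/! C k) ≤ pow/! C n + pow/! C n)
                                                         (ℕ.m∸n+n≡m n≤m) (tail-≤ n 2C≤n (m ℕ.∸ n)) ⟩
    pow/! C n + pow/! C n                                   ≤⟨ ℚ.+-mono-≤ small small ⟩
    ½ * ε + ½ * ε                                   ≡⟨ ½p+½p≡p ε ⟩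
    ε                                               ∎
    where open ℚ.≤-Reasoning

  close : ∀ ε m n → C ℕ.+ C ℕ.≤ m → C ℕ.+ C ℕ.≤ n → pow/! C m ≤ ½ * ε → pow/! C n ≤ ½ * ε → ∣ s m - s n ∣ ≤ ε
  close ε m n 2C≤m 2C≤n hm hn with ℕ.≤-total n m
  ... | inj₁ n≤m = tail-close ε m n 2C≤n hn n≤m
  ... | inj₂ m≤n = ℚ.≤-trans (ℚ.≤-reflexive (∣p-q∣≡∣q-p∣ (s m) (s n))) (tail-close ε n m 2C≤m hm m≤n)

series-cauchy : ∀ C (f g : ℕ → ℝ) → (∀ m i → seq (f (suc m)) i ≡ seq (f m) i + seq (g m) i) →
                ∀∞ (λ i → ∀ k → ∣ seq (g k) i ∣ ≤ pow/! C k) → Cauchyʳ f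
series-cauchy C f g step (K , g≤) ε 0<ε =
  let N , small = pow/!-small C (½ * ε) (½-pos 0<ε)
  in N ℕ.⊔ (C ℕ.+ C) , λ m n hm hn → K , λ i hi →
    close C (λ k → seq (f k) i) (λ k → seq (g k) i) (λ k → step k i) (g≤ i hi) ε m n
      (ℕ.m⊔n≤o⇒n≤o N (C ℕ.+ C) hm) (ℕ.m⊔n≤o⇒n≤o N (C ℕ.+ C) hn)
      (small m (ℕ.m⊔n≤o⇒m≤o N (C ℕ.+ C) hm)) (small n (ℕ.m⊔n≤o⇒m≤o N (C ℕ.+ C) hn))

q≤p+q : ∀ {p q} → 0ℚ ≤ p → q ≤ p + q
q≤p+q {p} {q} 0≤p = ℚ.≤-trans (p≤p+q {q} {p} 0≤p) (ℚ.≤-reflexive (ℚ.+-comm q p))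

module _ {n} (M : Matrix n) (a b : Fin n) where

  re-expSum-cauchy : Cauchyʳ (λ m → re (expSum M m a b))
  re-expSum-cauchy =
    let B , K , h = bounded M
    in series-cauchy (n ℕ.* B) (λ m → re (expSum M m a b)) (λ m → re (expTerm M m a b)) (λ _ _ → refl)
         (K , λ i hi k → ℚ.≤-trans (p≤p+q (ℚ.0≤∣p∣ (seq (im (expTerm M k a b)) i))) (size-expTerm M B i (h i hi) k a b))

  im-expSum-cauchy : Cauchyʳ (λ m → im (expSum M m a b))
  im-expSum-cauchy =
    let B , K , h = bounded M
    in series-cauchy (n ℕ.* B) (λ m → im (expSum M m a b)) (λ m → im (expTerm M m a b)) (λ _ _ → refl)
         (K , λ i hi k → ℚ.≤-trans (q≤p+q (ℚ.0≤∣p∣ (seq (re (expTerm M k a b)) i))) (size-expTerm M B i (h i hi) k a b))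

exp : ∀ {n} → Matrix n → Matrix n
exp M a b = lim (λ m → re (expSum M m a b)) (re-expSum-cauchy M a b)
         +i lim (λ m → im (expSum M m a b)) (im-expSum-cauchy M a b)

record Graph (n : ℕ) : Set₁ where
  field
    _∼_      : Rel (Fin n) 0ℓ
    _∼?_     : Decidable _∼_
    ∼-sym    : Symmetric _∼_
    ∼-irrefl : ∀ {u} → ¬ u ∼ u

module _ {n} (X : Graph n) where

  open Graph X

  Connected : Set
  Connected = ∀ u v → Star _∼_ u v

  Bipartite : Set
  Bipartite = ∃ λ (side : Fin n → Bool) → ∀ {u v} → u ∼ v → side u ≢ side v

  degree : Fin n → ℕ
  degree u = length (filter (u ∼?_) (allFin n))

  Pendent : Fin n → Set
  Pendent u = degree u ≡ 1

  edges : List (Fin n × Fin n)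
  edges = filter (λ (u , v) → (u Fin.<? v) ×-dec (u ∼? v)) (cartesianProduct (allFin n) (allFin n))

  Unicyclic : Set
  Unicyclic = Connected × length edges ≡ n

  adjacency : Matrix n
  adjacency u v = if does (u ∼? v) then 1ᶜ else 0ᶜ

module _ (k : ℕ) where

  Next : Rel (Fin (3 ℕ.+ k)) 0ℓ
  Next i j = toℕ j ≡ suc (toℕ i) ⊎ (toℕ i ≡ 2 ℕ.+ k × toℕ j ≡ 0)

  Next? : Decidable Next
  Next? i j = (toℕ j ℕ.≟ suc (toℕ i)) ⊎-dec ((toℕ i ℕ.≟ 2 ℕ.+ k) ×-dec (toℕ j ℕ.≟ 0))

  Next-irrefl : ∀ {i} → ¬ Next i i
  Next-irrefl (inj₁ eq)         = ℕ.1+n≢n (sym eq)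
  Next-irrefl (inj₂ (eq , eq′)) = ℕ.1+n≢0 (trans (sym eq) eq′)

  cycle : Graph (3 ℕ.+ k)
  cycle = record
    { _∼_      = λ i j → Next i j ⊎ Next j i
    ; _∼?_     = λ i j → Next? i j ⊎-dec Next? j i
    ; ∼-sym    = Sum.swap
    ; ∼-irrefl = Sum.[ Next-irrefl , Next-irrefl ]
    }

_≅_ : ∀ {m n} → Graph m → Graph n → Set
_≅_ {m} {n} X Y = ∃ λ (f : Fin m ↔ Fin n) →
  ∀ u v → Graph._∼_ X u v ⇔ Graph._∼_ Y (Inverse.to f u) (Inverse.to f v)

-- Y contains X as a (not necessarily induced) subgraph.
_⊆ᴳ_ : ∀ {m n} → Graph m → Graph n → Set
_⊆ᴳ_ {m} {n} X Y = ∃ λ (f : Fin m → Fin n) →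
  Injective _≡_ _≡_ f × (∀ {u v} → Graph._∼_ X u v → Graph._∼_ Y (f u) (f v))

IsCycle : ∀ {n} → Graph n → Set
IsCycle X = ∃ λ k → cycle k ≅ X

Acyclic : ∀ {n} → Graph n → Set
Acyclic X = ¬ ∃ λ k → cycle k ⊆ᴳ X

Tree : ∀ {n} → Graph n → Set
Tree X = Connected X × Acyclic X

U : ∀ {n} → Graph n → ℝ → Matrix n
U X t = exp ((iᶜ *ᶜ fromℝ t) • adjacency X)

LocalεUniformMixing : ∀ {n} → Graph n → Fin n → Set
LocalεUniformMixing {n} X u = ∀ ε → 0ʳ <ʳ ε → ∃ λ τ →
  ∥ (U X τ ⊠ᵛ 𝐞 u) ⊙ (conjᴹ (U X τ) ⊠ᵛ 𝐞 u) ⊟ fromℝ (fromℚ 1/n) •ᵛ 𝟏 ∥ <ʳ ε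
  where
  1/n : ℚ
  1/n = (+ 1 / n) {{nonZeroIndex u}}

{-# OPTIONS --safe #-}
module Submission where

open import Algebra.Bundles using (CommutativeRing)
import Algebra.Properties.Semiring.Sum as Sum
open import Data.Bool.Base using (Bool; true; false; not; if_then_else_; _xor_)
import Data.Bool.Properties as Bool
open import Data.Empty using (⊥)
open import Data.Fin.Base as Fin using (Fin; zero; suc; toℕ)
import Data.Fin.Properties as Fin
open import Data.Integer.Base as ℤ using (ℤ; -[1+_])
import Data.Integer.Properties as ℤ
import Data.Integer.Solver as ℤ
open import Data.List.Base using (length; filter; tabulate)
open import Data.Nat.Base as ℕ using (ℕ; zero; suc)
open import Data.Nat.Divisibility using (_∤_; divides)
open import Data.Nat.Induction using (<-rec)
import Data.Nat.Properties as ℕ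
open import Data.Product.Base using (∃; _×_; _,_; proj₁; proj₂)
open import Data.Rational.Base as ℚ using (ℚ; 0ℚ; 1ℚ; ½; _+_; _*_; _-_; -_; _/_; _≤_; _<_; ∣_∣; toℚᵘ; nonNegative)
import Data.Rational.Properties as ℚ
open import Data.Rational.Solver using (module +-*-Solver)
import Data.Rational.Unnormalised.Base as ℚᵘ
import Data.Rational.Unnormalised.Properties as ℚᵘ
open import Data.Sum.Base using (_⊎_; inj₁; inj₂)
open import Data.Vec.Functional using (Vector)
open import Function.Base using (_∘_)
open import Level using (0ℓ)
open import Relation.Binary.Construct.Closure.ReflexiveTransitive using (Star; _◅_; _◅◅_; revApp)
open import Relation.Binary.Definitions using (tri<; tri≈; tri>)
open import Relation.Binary.PropositionalEquality using (_≡_; _≢_; refl; sym; trans; cong; cong₂; subst; subst₂; module ≡-Reasoning)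
open import Relation.Nullary using (¬_; Dec; yes; no; does; contradiction)
open import Relation.Nullary.Decidable using (_×-dec_; dec-true; dec-false)
open import Relation.Unary using (Pred; Decidable)
open import Defs

open import Algebra.Properties.CommutativeSemigroup ℕ.+-commutativeSemigroup using (x∙yz≈y∙xz)
open +-*-Solver using (solve; _:+_; _:*_; _:-_; :-_; _:=_; con)
open ℤ.+-*-Solver using () renaming (solve to solveᶻ; con to conᶻ; _:+_ to _⊕_; _:*_ to _⊗_; _:-_ to _⊖_; _:=_ to _≜_)
open Sum (CommutativeRing.semiring ℚ.+-*-commutativeRing) using (sum; sum-cong-≗; ∑-distrib-+; ∑-comm; *-distribˡ-sum; *-distribʳ-sum; sum-replicate-zero)
module Σᶻ = Sum (CommutativeRing.semiring ℤ.+-*-commutativeRing)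

-- For a bipartite graph, conjugating iA by the diagonal matrix D with entries
-- 1 on the side of u and i on the other side gives a real skew-symmetric K, so
-- U(τ)e_u = D y with y = exp(τK)e_u real and ∥Ay∥² = ∥Ky∥² = ∥Ke_u∥² = deg u,
-- because exp(τK) is orthogonal and commutes with K. If the squares of all
-- entries of y are close to 1/n, then n y_a y_b is close to σ_a σ_b for the
-- signs σ of y, hence n deg u is close, and so equal, to the integer ∥Aσ∥².
-- Modulo 2 this integer is the sum of the degrees, which is even; but n deg u is
-- odd for n odd and u pendent. Everything is carried out on the rational
-- sequences that define τ, exp and the norm. Trees are bipartite because an odd
-- closed walk that repeats a vertex splits into two, one of them odd and shorter,
-- and one without repetitions is a cycle.

-- Finite sums of rationals

-- The m-th term of an entry of `U X τ` is the m-th partial sum of the exponential series, sampled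
-- at an index that depends on the entry and on the real or imaginary part. So no algebraic identity
-- holds between these terms. The remedy is an order of choices: fix m, then move to one late index
-- i common to all entries. There τ is a rational q, and each partial sum is exact rational algebra
-- with `q K`. A truncated exponential is not orthogonal. The squared norm of a truncated sum is a
-- double sum over a square of indices; its triangular part telescopes exactly to the initial term,
-- and the rest decays geometrically. This decay has to be uniform in i, hence the bounds that
-- depend on eventual sizes only. Only products y_a y_b are rounded: y_a itself is near plus or
-- minus 1/√n, in general irrational, while n y_a y_b is near an integer. The quadratic form ∥Ay∥²
-- involves nothing but these products.

0≤p*p : ∀ p → 0ℚ ≤ p * p
0≤p*p p with ℚ.≤-total 0ℚ p
... | inj₁ 0≤p = *-nonNeg 0≤p 0≤p
... | inj₂ p≤0 = subst (0ℚ ≤_) (solve 1 (λ p → (:- p) :* (:- p) := p :* p) refl p)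
  (*-nonNeg (ℚ.neg-antimono-≤ p≤0) (ℚ.neg-antimono-≤ p≤0))

sum-zero : ∀ {n} (f : Vector ℚ n) → (∀ a → f a ≡ 0ℚ) → sum f ≡ 0ℚ
sum-zero {n} f f≡0 = trans (sum-cong-≗ f≡0) (sum-replicate-zero n)

sum-neg : ∀ {n} (f : Vector ℚ n) → sum (λ a → - f a) ≡ - sum f
sum-neg {zero}  f = refl
sum-neg {suc n} f = trans (cong ((- f zero) +_) (sum-neg (f ∘ suc))) (sym (ℚ.neg-distrib-+ (f zero) _))

0≤sum : ∀ {n} (f : Vector ℚ n) → (∀ a → 0ℚ ≤ f a) → 0ℚ ≤ sum f
0≤sum {zero}  f 0≤f = ℚ.≤-refl
0≤sum {suc n} f 0≤f = +-nonNeg (0≤f zero) (0≤sum (f ∘ suc) (0≤f ∘ suc))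

≤sum : ∀ {n} (f : Vector ℚ n) → (∀ a → 0ℚ ≤ f a) → ∀ a → f a ≤ sum f
≤sum f 0≤f zero    = p≤p+q (0≤sum (f ∘ suc) (0≤f ∘ suc))
≤sum f 0≤f (suc a) = ℚ.≤-trans (≤sum (f ∘ suc) (0≤f ∘ suc) a) (q≤p+q (0≤f zero))

ι-suc-* : ∀ n p → ι (suc n) * p ≡ p + ι n * p
ι-suc-* n p = trans (cong (_* p) (ι-+ 1 n))
  (trans (ℚ.*-distribʳ-+ p 1ℚ (ι n)) (cong (_+ ι n * p) (ℚ.*-identityˡ p)))

∣sum∣≤ : ∀ {n} (f : Vector ℚ n) b → (∀ a → ∣ f a ∣ ≤ b) → ∣ sum f ∣ ≤ ι n * b
∣sum∣≤ {zero}  f b h = ℚ.≤-reflexive (sym (ℚ.*-zeroˡ b))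
∣sum∣≤ {suc n} f b h = begin
  ∣ f zero + sum (f ∘ suc) ∣        ≤⟨ ℚ.∣p+q∣≤∣p∣+∣q∣ (f zero) (sum (f ∘ suc)) ⟩
  ∣ f zero ∣ + ∣ sum (f ∘ suc) ∣    ≤⟨ ℚ.+-mono-≤ (h zero) (∣sum∣≤ (f ∘ suc) b (h ∘ suc)) ⟩
  b + ι n * b                       ≡⟨ ι-suc-* n b ⟨
  ι (suc n) * b                     ∎
  where open ℚ.≤-Reasoning

∣sum-sum∣≤ : ∀ {n} (f g : Vector ℚ n) b → (∀ a → ∣ f a - g a ∣ ≤ b) → ∣ sum f - sum g ∣ ≤ ι n * b
∣sum-sum∣≤ {n} f g b h = subst (λ x → ∣ x ∣ ≤ ι n * b)
  (trans (∑-distrib-+ f (λ a → - g a)) (cong (sum f +_) (sum-neg g)))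
  (∣sum∣≤ (λ a → f a - g a) b h)

sum*sum : ∀ {m n} (f : Vector ℚ m) (g : Vector ℚ n) → sum f * sum g ≡ sum (λ a → sum (λ b → f a * g b))
sum*sum f g = trans (*-distribʳ-sum (sum g) f) (sum-cong-≗ (λ a → *-distribˡ-sum (f a) g))

-- Integers modulo 2

infix 4 _≡₂_

-- The difference is kept as an explicit `half + half`, so that the closure laws below are ring
-- identities for the solver.
record _≡₂_ (x y : ℤ) : Set where
  constructor _,_
  field
    half  : ℤ
    equal : x ≡ y ℤ.+ (half ℤ.+ half)

≡₂-refl : ∀ {x} → x ≡₂ x
≡₂-refl {x} = ℤ.+ 0 , sym (ℤ.+-identityʳ x)

≡₂-trans : ∀ {x y z} → x ≡₂ y → y ≡₂ z → x ≡₂ z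
≡₂-trans {z = z} (k , refl) (l , refl) = l ℤ.+ k ,
  solveᶻ 3 (λ z k l → (z ⊕ (l ⊕ l)) ⊕ (k ⊕ k) ≜ z ⊕ ((l ⊕ k) ⊕ (l ⊕ k))) refl z k l

≡₂-+ : ∀ {x y x′ y′} → x ≡₂ x′ → y ≡₂ y′ → x ℤ.+ y ≡₂ x′ ℤ.+ y′
≡₂-+ {x′ = x} {y} (k , refl) (l , refl) = k ℤ.+ l ,
  solveᶻ 4 (λ x y k l → (x ⊕ (k ⊕ k)) ⊕ (y ⊕ (l ⊕ l)) ≜ (x ⊕ y) ⊕ ((k ⊕ l) ⊕ (k ⊕ l))) refl x y k l

≡₂-sum : ∀ {n} (f g : Vector ℤ n) → (∀ a → f a ≡₂ g a) → Σᶻ.sum f ≡₂ Σᶻ.sum g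
≡₂-sum {zero}  f g h = ≡₂-refl
≡₂-sum {suc n} f g h = ≡₂-+ (h zero) (≡₂-sum (f ∘ suc) (g ∘ suc) (h ∘ suc))

-- The cross terms come in equal pairs: with the first entry `x` split off, they contribute `x s`
-- twice.
sum²≡₂sum-of-squares : ∀ {n} (f : Vector ℤ n) → Σᶻ.sum f ℤ.* Σᶻ.sum f ≡₂ Σᶻ.sum (λ a → f a ℤ.* f a)
sum²≡₂sum-of-squares {zero}  f = ≡₂-refl
sum²≡₂sum-of-squares {suc n} f = ≡₂-trans
  (x ℤ.* s , solveᶻ 2 (λ x s → (x ⊕ s) ⊗ (x ⊕ s) ≜ (x ⊗ x ⊕ s ⊗ s) ⊕ (x ⊗ s ⊕ x ⊗ s)) refl x s)
  (≡₂-+ (≡₂-refl {x ℤ.* x}) (sum²≡₂sum-of-squares (f ∘ suc)))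
  where
  x s : ℤ
  x = f zero
  s = Σᶻ.sum (f ∘ suc)

-- Entries off the diagonal pair up with their transposes. One step removes the first row and
-- column, whose parts off the diagonal have the same sum `r`.
symmetric-sum≡₂trace : ∀ {n} (f : Fin n → Fin n → ℤ) → (∀ a b → f a b ≡ f b a) →
                       Σᶻ.sum (λ a → Σᶻ.sum (f a)) ≡₂ Σᶻ.sum (λ a → f a a)
symmetric-sum≡₂trace {zero}  f f-sym = ≡₂-refl
symmetric-sum≡₂trace {suc n} f f-sym = ≡₂-trans
  (r , (begin
    (x ℤ.+ r) ℤ.+ Σᶻ.sum (λ a → f (suc a) zero ℤ.+ Σᶻ.sum (f (suc a) ∘ suc))
      ≡⟨ cong (λ c → (x ℤ.+ r) ℤ.+ c) (Σᶻ.∑-distrib-+ (λ a → f (suc a) zero) (λ a → Σᶻ.sum (f (suc a) ∘ suc))) ⟩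
    (x ℤ.+ r) ℤ.+ (Σᶻ.sum (λ a → f (suc a) zero) ℤ.+ s)
      ≡⟨ cong (λ c → (x ℤ.+ r) ℤ.+ (c ℤ.+ s)) (Σᶻ.sum-cong-≗ (λ a → f-sym (suc a) zero)) ⟩
    (x ℤ.+ r) ℤ.+ (r ℤ.+ s)
      ≡⟨ solveᶻ 3 (λ x r s → (x ⊕ r) ⊕ (r ⊕ s) ≜ (x ⊕ s) ⊕ (r ⊕ r)) refl x r s ⟩
    (x ℤ.+ s) ℤ.+ (r ℤ.+ r) ∎))
  (≡₂-+ (≡₂-refl {x}) (symmetric-sum≡₂trace (λ a b → f (suc a) (suc b)) (λ a b → f-sym (suc a) (suc b))))
  where
  open ≡-Reasoning
  x r s : ℤ
  x = f zero zero
  r = Σᶻ.sum (f zero ∘ suc)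
  s = Σᶻ.sum (λ a → Σᶻ.sum (f (suc a) ∘ suc))

-- The embedding of ℤ in ℚ

fromℤ : ℤ → ℚ
fromℤ z = z / 1

fromℤ-+ : ∀ x y → fromℤ (x ℤ.+ y) ≡ fromℤ x + fromℤ y
fromℤ-+ x y = ℚ.toℚᵘ-injective (begin
  toℚᵘ (fromℤ (x ℤ.+ y))                 ≈⟨ toℚᵘ-/ (x ℤ.+ y) 0 ⟩
  ℚᵘ.mkℚᵘ (x ℤ.+ y) 0                    ≡⟨ cong (λ z → ℚᵘ.mkℚᵘ z 0)
                                              (cong₂ ℤ._+_ (sym (ℤ.*-identityʳ x)) (sym (ℤ.*-identityʳ y))) ⟩
  ℚᵘ.mkℚᵘ x 0 ℚᵘ.+ ℚᵘ.mkℚᵘ y 0           ≈⟨ ℚᵘ.+-cong (toℚᵘ-/ x 0) (toℚᵘ-/ y 0) ⟨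
  toℚᵘ (fromℤ x) ℚᵘ.+ toℚᵘ (fromℤ y)     ≈⟨ ℚ.toℚᵘ-homo-+ (fromℤ x) (fromℤ y) ⟨
  toℚᵘ (fromℤ x + fromℤ y)               ∎)
  where open ℚᵘ.≃-Reasoning

fromℤ-* : ∀ x y → fromℤ (x ℤ.* y) ≡ fromℤ x * fromℤ y
fromℤ-* x y = sym (/-*-/ x y 0 0)

fromℤ-sum : ∀ {n} (f : Vector ℤ n) → fromℤ (Σᶻ.sum f) ≡ sum (λ a → fromℤ (f a))
fromℤ-sum {zero}  f = refl
fromℤ-sum {suc n} f = trans (fromℤ-+ (f zero) (Σᶻ.sum (f ∘ suc))) (cong (fromℤ (f zero) +_) (fromℤ-sum (f ∘ suc)))

∣fromℤ∣<1⇒≡0 : ∀ z → ∣ fromℤ z ∣ < 1ℚ → z ≡ ℤ.+ 0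
∣fromℤ∣<1⇒≡0 (ℤ.+ zero) _ = refl
∣fromℤ∣<1⇒≡0 (ℤ.+ suc n) h = contradiction (ℚ.<-≤-trans h
  (subst (1ℚ ≤_) (sym (ℚ.0≤p⇒∣p∣≡p (0≤ι (suc n)))) (ι-mono {1} {suc n} (ℕ.s≤s ℕ.z≤n)))) (ℚ.<-irrefl refl)
∣fromℤ∣<1⇒≡0 -[1+ n ] h = contradiction (ℚ.<-≤-trans h
  (subst (1ℚ ≤_) (sym (trans (ℚ.∣-p∣≡∣p∣ (ι (suc n))) (ℚ.0≤p⇒∣p∣≡p (0≤ι (suc n)))))
    (ι-mono {1} {suc n} (ℕ.s≤s ℕ.z≤n)))) (ℚ.<-irrefl refl)

fromℤ-discrete : ∀ x y → ∣ fromℤ x - fromℤ y ∣ < 1ℚ → x ≡ y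
fromℤ-discrete x y h = ℤ.i-j≡0⇒i≡j x y (∣fromℤ∣<1⇒≡0 (x ℤ.- y) (subst (λ p → ∣ p ∣ < 1ℚ) (sym eq) h))
  where
  cancel : ∀ p q r → p + q ≡ r → p ≡ r - q
  cancel p q r refl = solve 2 (λ p q → p := (p :+ q) :- q) refl p q
  eq : fromℤ (x ℤ.- y) ≡ fromℤ x - fromℤ y
  eq = cancel (fromℤ (x ℤ.- y)) (fromℤ y) (fromℤ x) (trans (sym (fromℤ-+ (x ℤ.- y) y))
    (cong fromℤ (solveᶻ 2 (λ x y → x ⊖ y ⊕ y ≜ x) refl x y)))

-- Sums over intervals of naturals

range : (ℕ → ℚ) → ℕ → ℕ → ℚ
range f j zero    = 0ℚ
range f j (suc d) = f j + range f (suc j) d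

range-snoc : ∀ f j d → range f j (suc d) ≡ range f j d + f (j ℕ.+ d)
range-snoc f j zero = trans (ℚ.+-comm (f j) 0ℚ) (cong (λ i → 0ℚ + f i) (sym (ℕ.+-identityʳ j)))
range-snoc f j (suc d) = trans (cong (f j +_) (range-snoc f (suc j) d))
  (trans (sym (ℚ.+-assoc (f j) (range f (suc j) d) (f (suc j ℕ.+ d))))
    (cong (λ i → range f j (suc d) + f i) (sym (ℕ.+-suc j d))))

range-close : ∀ f d β → (∀ k → d ℕ.≤ k → ∣ f k ∣ ≤ β) → ∀ e → ∣ range f 0 (e ℕ.+ d) - range f 0 d ∣ ≤ ι e * β
range-close f d β h zero = ℚ.≤-reflexive (trans (cong ∣_∣ (ℚ.+-inverseʳ (range f 0 d))) (sym (ℚ.*-zeroˡ β)))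
range-close f d β h (suc e) = begin
  ∣ range f 0 (suc (e ℕ.+ d)) - range f 0 d ∣                 ≡⟨ cong (λ x → ∣ x - range f 0 d ∣) (range-snoc f 0 (e ℕ.+ d)) ⟩
  ∣ range f 0 (e ℕ.+ d) + f (e ℕ.+ d) - range f 0 d ∣         ≡⟨ cong ∣_∣ (solve 3 (λ a b c → a :+ b :- c := b :+ (a :- c)) refl
                                                                   (range f 0 (e ℕ.+ d)) (f (e ℕ.+ d)) (range f 0 d)) ⟩
  ∣ f (e ℕ.+ d) + (range f 0 (e ℕ.+ d) - range f 0 d) ∣       ≤⟨ ℚ.∣p+q∣≤∣p∣+∣q∣ (f (e ℕ.+ d)) _ ⟩
  ∣ f (e ℕ.+ d) ∣ + ∣ range f 0 (e ℕ.+ d) - range f 0 d ∣     ≤⟨ ℚ.+-mono-≤ (h (e ℕ.+ d) (ℕ.m≤n+m d e)) (range-close f d β h e) ⟩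
  β + ι e * β                                                 ≡⟨ ι-suc-* e β ⟨
  ι (suc e) * β                                               ∎
  where open ℚ.≤-Reasoning

module _ (g : ℕ → ℕ → ℚ) where

  antidiagonal : ℕ → ℕ → ℚ
  antidiagonal j zero    = g j 0
  antidiagonal j (suc k) = g j (suc k) + antidiagonal (suc j) k

  -- The sum of g i k over i ≥ j and i + k < j + d.
  triangle : ℕ → ℕ → ℚ
  triangle j zero    = 0ℚ
  triangle j (suc d) = range (g j) 0 (suc d) + triangle (suc j) d

  triangle-suc : ∀ j d → triangle j (suc d) ≡ triangle j d + antidiagonal j d
  triangle-suc j zero = solve 1 (λ a → (a :+ con 0ℚ) :+ con 0ℚ := con 0ℚ :+ a) refl (g j 0)
  triangle-suc j (suc d) = trans
    (cong₂ _+_ (range-snoc (g j) 0 (suc d)) (triangle-suc (suc j) d))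
    (solve 4 (λ a b c e → (a :+ b) :+ (c :+ e) := (a :+ c) :+ (b :+ e)) refl
      (range (g j) 0 (suc d)) (g j (suc d)) (triangle (suc j) d) (antidiagonal (suc j) d))

  -- Because `j + d ≡ M`, row i of the square leaves the triangle only at columns k with
  -- `i + k ≥ M`. There are i of these, at most `M`, each bounded by `β`.
  square-close : ∀ M β → 0ℚ ≤ β → (∀ j k → M ℕ.≤ j ℕ.+ k → ∣ g j k ∣ ≤ β) → ∀ j d → j ℕ.+ d ≡ M →
                 ∣ range (λ i → range (g i) 0 M) j d - triangle j d ∣ ≤ ι d * (ι M * β)
  square-close M β 0≤β h j zero _ = ℚ.≤-reflexive (sym (ℚ.*-zeroˡ (ι M * β)))
  square-close M β 0≤β h j (suc d) refl = begin
    ∣ (a + b) - (c + e) ∣             ≡⟨ cong ∣_∣ (solve 4 (λ a b c e → (a :+ b) :- (c :+ e) := (a :- c) :+ (b :- e)) refl a b c e) ⟩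
    ∣ (a - c) + (b - e) ∣             ≤⟨ ℚ.∣p+q∣≤∣p∣+∣q∣ (a - c) (b - e) ⟩
    ∣ a - c ∣ + ∣ b - e ∣             ≤⟨ ℚ.+-mono-≤ row (square-close M β 0≤β h (suc j) d (sym (ℕ.+-suc j d))) ⟩
    ι M * β + ι d * (ι M * β)         ≡⟨ ι-suc-* d (ι M * β) ⟨
    ι (suc d) * (ι M * β)             ∎
    where
    open ℚ.≤-Reasoning
    a b c e : ℚ
    a = range (g j) 0 M
    b = range (λ i → range (g i) 0 M) (suc j) d
    c = range (g j) 0 (suc d)
    e = triangle (suc j) d
    row : ∣ a - c ∣ ≤ ι M * β
    row = ℚ.≤-trans
      (range-close (g j) (suc d) β (λ k d<k → h j k (ℕ.+-monoʳ-≤ j d<k)) j)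
      (ℚ.*-monoʳ-≤-nonNeg β {{nonNegative 0≤β}} (ι-mono {j} {M} (ℕ.m≤m+n j (suc d))))

  module _ (shift : ∀ j k → ι (suc j) * g (suc j) k + ι (suc k) * g j (suc k) ≡ 0ℚ) where

    -- The factor `j + k` is row plus column for every term of the antidiagonal. By `shift`, the
    -- column part of each term cancels the row part of the next, which leaves the row part of the
    -- first term.
    antidiagonal-telescopes : ∀ j k → ι (j ℕ.+ k) * antidiagonal j k ≡ ι j * g j k
    antidiagonal-telescopes j zero = cong (λ i → ι i * g j 0) (ℕ.+-identityʳ j)
    antidiagonal-telescopes j (suc k) = begin
      ι (j ℕ.+ suc k) * (x + r)
        ≡⟨ ℚ.*-distribˡ-+ (ι (j ℕ.+ suc k)) x r ⟩
      ι (j ℕ.+ suc k) * x + ι (j ℕ.+ suc k) * r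
        ≡⟨ cong₂ _+_ (cong (_* x) (ι-+ j (suc k))) (trans (cong (λ i → ι i * r) (ℕ.+-suc j k)) (antidiagonal-telescopes (suc j) k)) ⟩
      (ι j + ι (suc k)) * x + ι (suc j) * g (suc j) k
        ≡⟨ solve 4 (λ a b x y → (a :+ b) :* x :+ y := a :* x :+ (y :+ b :* x)) refl (ι j) (ι (suc k)) x (ι (suc j) * g (suc j) k) ⟩
      ι j * x + (ι (suc j) * g (suc j) k + ι (suc k) * x)
        ≡⟨ cong (ι j * x +_) (shift j k) ⟩
      ι j * x + 0ℚ
        ≡⟨ ℚ.+-identityʳ (ι j * x) ⟩
      ι j * x ∎
      where
      open ≡-Reasoning
      x r : ℚ
      x = g j (suc k)
      r = antidiagonal (suc j) k

    antidiagonal≡0 : ∀ k → antidiagonal 0 (suc k) ≡ 0ℚ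
    antidiagonal≡0 k = begin
      r                                ≡⟨ ℚ.*-identityˡ r ⟨
      1ℚ * r                           ≡⟨ cong (_* r) (trans (ℚ.*-comm (1/1+ k) (ι (suc k))) (ι*1/1+ k)) ⟨
      (1/1+ k * ι (suc k)) * r         ≡⟨ ℚ.*-assoc (1/1+ k) (ι (suc k)) r ⟩
      1/1+ k * (ι (suc k) * r)         ≡⟨ cong (1/1+ k *_) (trans (antidiagonal-telescopes 0 (suc k)) (ℚ.*-zeroˡ (g 0 (suc k)))) ⟩
      1/1+ k * 0ℚ                      ≡⟨ ℚ.*-zeroʳ (1/1+ k) ⟩
      0ℚ                               ∎
      where
      open ≡-Reasoning
      r : ℚ
      r = antidiagonal 0 (suc k)

    -- With row 0 as the first row, the telescoped value is zero, so every antidiagonal but that of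
    -- `g 0 0` vanishes. For `g j k = ⟨ z j , z k ⟩` this says coefficient by coefficient that the
    -- squared norm of exp(tL)x has derivative zero.
    triangle≡corner : ∀ d → triangle 0 (suc d) ≡ g 0 0
    triangle≡corner zero = trans (triangle-suc 0 0) (ℚ.+-identityˡ (g 0 0))
    triangle≡corner (suc d) = trans (triangle-suc 0 (suc d))
      (trans (cong₂ _+_ (triangle≡corner d) (antidiagonal≡0 d)) (ℚ.+-identityʳ (g 0 0)))

-- The exponential of a skew-symmetric matrix

⟨_,_⟩ : ∀ {n} → Vector ℚ n → Vector ℚ n → ℚ
⟨ x , y ⟩ = sum λ a → x a * y a

infixl 7 _·_

_·_ : ∀ {n} → (Fin n → Fin n → ℚ) → Vector ℚ n → Vector ℚ n
(L · x) a = sum λ c → L a c * x c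

Skew : ∀ {n} → (Fin n → Fin n → ℚ) → Set
Skew L = ∀ a b → L a b ≡ - L b a

-- The sequences z k = Lᵏ x / k!.
ExpTerms : ∀ {n} → (Fin n → Fin n → ℚ) → (ℕ → Vector ℚ n) → Set
ExpTerms L z = ∀ k a → ι (suc k) * z (suc k) a ≡ (L · z k) a

partialSum : ∀ {n} → (ℕ → Vector ℚ n) → ℕ → Vector ℚ n
partialSum z zero    a = 0ℚ
partialSum z (suc m) a = partialSum z m a + z m a

⟨⟩-comm : ∀ {n} (x y : Vector ℚ n) → ⟨ x , y ⟩ ≡ ⟨ y , x ⟩
⟨⟩-comm x y = sum-cong-≗ λ a → ℚ.*-comm (x a) (y a)

⟨⟩-partialSumʳ : ∀ {n} (x : Vector ℚ n) z m → ⟨ x , partialSum z m ⟩ ≡ range (λ k → ⟨ x , z k ⟩) 0 m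
⟨⟩-partialSumʳ x z zero = sum-zero _ λ a → ℚ.*-zeroʳ (x a)
⟨⟩-partialSumʳ x z (suc m) = begin
  sum (λ a → x a * (partialSum z m a + z m a))           ≡⟨ sum-cong-≗ (λ a → ℚ.*-distribˡ-+ (x a) (partialSum z m a) (z m a)) ⟩
  sum (λ a → x a * partialSum z m a + x a * z m a)       ≡⟨ ∑-distrib-+ (λ a → x a * partialSum z m a) (λ a → x a * z m a) ⟩
  ⟨ x , partialSum z m ⟩ + ⟨ x , z m ⟩                   ≡⟨ cong (_+ ⟨ x , z m ⟩) (⟨⟩-partialSumʳ x z m) ⟩
  range (λ k → ⟨ x , z k ⟩) 0 m + ⟨ x , z m ⟩            ≡⟨ range-snoc (λ k → ⟨ x , z k ⟩) 0 m ⟨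
  range (λ k → ⟨ x , z k ⟩) 0 (suc m)                    ∎
  where open ≡-Reasoning

range-cong : ∀ {f g} → (∀ k → f k ≡ g k) → ∀ j d → range f j d ≡ range g j d
range-cong h j zero    = refl
range-cong h j (suc d) = cong₂ _+_ (h j) (range-cong h (suc j) d)

⟨partialSum,partialSum⟩ : ∀ {n} (z : ℕ → Vector ℚ n) m →
  ⟨ partialSum z m , partialSum z m ⟩ ≡ range (λ j → range (λ k → ⟨ z j , z k ⟩) 0 m) 0 m
⟨partialSum,partialSum⟩ z m = trans (⟨⟩-partialSumʳ (partialSum z m) z m)
  (range-cong (λ j → trans (⟨⟩-comm (partialSum z m) (z j)) (⟨⟩-partialSumʳ (z j) z m)) 0 m)

·-skew : ∀ {n} {L : Fin n → Fin n → ℚ} → Skew L → ∀ x y → ⟨ x , L · y ⟩ ≡ - ⟨ L · x , y ⟩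
·-skew {L = L} skew x y = begin
  sum (λ a → x a * sum (λ c → L a c * y c))       ≡⟨ sum-cong-≗ (λ a → *-distribˡ-sum (x a) (λ c → L a c * y c)) ⟩
  sum (λ a → sum (λ c → x a * (L a c * y c)))     ≡⟨ sum-cong-≗ (λ a → sum-cong-≗ (λ c → rearrange a c)) ⟩
  sum (λ a → sum (λ c → - (L c a * x a * y c)))   ≡⟨ ∑-comm (λ a c → - (L c a * x a * y c)) ⟩
  sum (λ c → sum (λ a → - (L c a * x a * y c)))   ≡⟨ sum-cong-≗ (λ c → trans (sum-neg (λ a → L c a * x a * y c))
                                                       (cong -_ (sym (*-distribʳ-sum (y c) (λ a → L c a * x a))))) ⟩
  sum (λ c → - ((L · x) c * y c))                 ≡⟨ sum-neg (λ c → (L · x) c * y c) ⟩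
  - ⟨ L · x , y ⟩                                 ∎
  where
  open ≡-Reasoning
  rearrange : ∀ a c → x a * (L a c * y c) ≡ - (L c a * x a * y c)
  rearrange a c = trans (cong (λ l → x a * (l * y c)) (skew a c))
    (solve 3 (λ x l y → x :* ((:- l) :* y) := :- (l :* x :* y)) refl (x a) (L c a) (y c))

-- Each factor moves into its inner product and turns a term into `L` of its predecessor; skew
-- symmetry makes the two results opposite.
expTerms-shift : ∀ {n} {L : Fin n → Fin n → ℚ} → Skew L → ∀ {z} → ExpTerms L z →
                 ∀ j k → ι (suc j) * ⟨ z (suc j) , z k ⟩ + ι (suc k) * ⟨ z j , z (suc k) ⟩ ≡ 0ℚ
expTerms-shift {L = L} skew {z} step j k = begin
  ι (suc j) * ⟨ z (suc j) , z k ⟩ + ι (suc k) * ⟨ z j , z (suc k) ⟩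
    ≡⟨ cong₂ _+_
         (trans (*-distribˡ-sum (ι (suc j)) (λ a → z (suc j) a * z k a))
           (sum-cong-≗ λ a → trans (sym (ℚ.*-assoc (ι (suc j)) (z (suc j) a) (z k a))) (cong (_* z k a) (step j a))))
         (trans (*-distribˡ-sum (ι (suc k)) (λ a → z j a * z (suc k) a))
           (sum-cong-≗ λ a → trans (solve 3 (λ i x y → i :* (x :* y) := x :* (i :* y)) refl (ι (suc k)) (z j a) (z (suc k) a))
             (cong (z j a *_) (step k a)))) ⟩
  ⟨ L · z j , z k ⟩ + ⟨ z j , L · z k ⟩       ≡⟨ cong (⟨ L · z j , z k ⟩ +_) (·-skew skew (z j) (z k)) ⟩
  ⟨ L · z j , z k ⟩ - ⟨ L · z j , z k ⟩       ≡⟨ ℚ.+-inverseʳ ⟨ L · z j , z k ⟩ ⟩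
  0ℚ                                          ∎
  where open ≡-Reasoning

∣⟨⟩∣≤ : ∀ {n} (x y : Vector ℚ n) p q → 0ℚ ≤ p → (∀ a → ∣ x a ∣ ≤ p) → (∀ a → ∣ y a ∣ ≤ q) → ∣ ⟨ x , y ⟩ ∣ ≤ ι n * (p * q)
∣⟨⟩∣≤ x y p q 0≤p x≤ y≤ = ∣sum∣≤ (λ a → x a * y a) (p * q) λ a → ℚ.≤-trans
  (ℚ.≤-reflexive (ℚ.∣p*q∣≡∣p∣*∣q∣ (x a) (y a))) (*-mono (ℚ.0≤∣p∣ (y a)) 0≤p (x≤ a) (y≤ a))

-- Geometric decay of the exponential series

½^ : ℕ → ℚ
½^ zero    = 1ℚ
½^ (suc k) = ½ * ½^ k

0≤½ : 0ℚ ≤ ½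
0≤½ = ℚ.<⇒≤ (ℚ.positive⁻¹ ½)

0≤½^ : ∀ k → 0ℚ ≤ ½^ k
0≤½^ zero    = ℚ.<⇒≤ (ℚ.positive⁻¹ 1ℚ)
0≤½^ (suc k) = *-nonNeg 0≤½ (0≤½^ k)

½^-+ : ∀ j k → ½^ (j ℕ.+ k) ≡ ½^ j * ½^ k
½^-+ zero    k = sym (ℚ.*-identityˡ (½^ k))
½^-+ (suc j) k = trans (cong (½ *_) (½^-+ j k)) (sym (ℚ.*-assoc ½ (½^ j) (½^ k)))

½p≤p : ∀ {p} → 0ℚ ≤ p → ½ * p ≤ p
½p≤p {p} 0≤p = ℚ.≤-trans (p≤p+q (*-nonNeg 0≤½ 0≤p)) (ℚ.≤-reflexive (½p+½p≡p p))

½^-≤1 : ∀ k → ½^ k ≤ 1ℚ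
½^-≤1 zero    = ℚ.≤-refl
½^-≤1 (suc k) = ℚ.≤-trans (½p≤p (0≤½^ k)) (½^-≤1 k)

½^-antitone : ∀ {j k} → j ℕ.≤ k → ½^ k ≤ ½^ j
½^-antitone {k = k} ℕ.z≤n = ½^-≤1 k
½^-antitone (ℕ.s≤s j≤k) = ℚ.*-monoˡ-≤-nonNeg ½ (½^-antitone j≤k)

ι*½^≤1 : ∀ k → ι k * ½^ k ≤ 1ℚ
ι*½^≤1 zero = ℚ.<⇒≤ (ℚ.positive⁻¹ 1ℚ)
ι*½^≤1 (suc k) = begin
  ι (suc k) * (½ * ½^ k)           ≡⟨ ι-suc-* k (½ * ½^ k) ⟩
  ½ * ½^ k + ι k * (½ * ½^ k)      ≡⟨ solve 3 (λ h x i → h :* x :+ i :* (h :* x) := h :* x :+ h :* (i :* x)) refl ½ (½^ k) (ι k) ⟩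
  ½ * ½^ k + ½ * (ι k * ½^ k)      ≤⟨ ℚ.+-mono-≤ (ℚ.*-monoˡ-≤-nonNeg ½ (½^-≤1 k)) (ℚ.*-monoˡ-≤-nonNeg ½ (ι*½^≤1 k)) ⟩
  ½ * 1ℚ + ½ * 1ℚ                  ≡⟨ ½p+½p≡p 1ℚ ⟩
  1ℚ                               ∎
  where open ℚ.≤-Reasoning

-- Three factors `½^ k` serve one purpose each: two absorb the M² that counts entries of an M by M
-- square, through `ι M * ½^ M ≤ 1`, and the third leaves a bound that tends to 0.
⅛^ : ℕ → ℚ
⅛^ k = ½^ k * ½^ k * ½^ k

0≤⅛^ : ∀ k → 0ℚ ≤ ⅛^ k
0≤⅛^ k = *-nonNeg (*-nonNeg (0≤½^ k) (0≤½^ k)) (0≤½^ k)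

⅛^-+ : ∀ j k → ⅛^ (j ℕ.+ k) ≡ ⅛^ j * ⅛^ k
⅛^-+ j k rewrite ½^-+ j k = solve 2 (λ a b → a :* b :* (a :* b) :* (a :* b) := a :* a :* a :* (b :* b :* b)) refl (½^ j) (½^ k)

⅛^-antitone : ∀ {j k} → j ℕ.≤ k → ⅛^ k ≤ ⅛^ j
⅛^-antitone {j} {k} j≤k = *-mono (0≤½^ k) (*-nonNeg (0≤½^ j) (0≤½^ j))
  (*-mono (0≤½^ k) (0≤½^ j) (½^-antitone j≤k) (½^-antitone j≤k)) (½^-antitone j≤k)

⅛^-8^ : ∀ k → ι (8 ℕ.^ k) * ⅛^ k ≡ 1ℚ
⅛^-8^ zero = refl
⅛^-8^ (suc k) = trans (cong (_* ⅛^ (suc k)) (ι-* 8 (8 ℕ.^ k)))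
  (trans (solve 2 (λ e h → con (ι 8) :* e :* ((con ½ :* h) :* (con ½ :* h) :* (con ½ :* h)) := e :* (h :* h :* h)) refl (ι (8 ℕ.^ k)) (½^ k))
    (⅛^-8^ k))

eventually-bounded⇒bounded : ∀ (f : ℕ → ℚ) N → (∀ k → N ℕ.≤ k → f k ≤ 1ℚ) → ∃ λ D → ∀ k → f k ≤ ι D
eventually-bounded⇒bounded f zero h = 1 , λ k → h k ℕ.z≤n
eventually-bounded⇒bounded f (suc N) h =
  let D , p = eventually-bounded⇒bounded (f ∘ suc) N (λ k N≤k → h (suc k) (ℕ.s≤s N≤k))
      E = ℤ.∣ ℚ.↥ f 0 ∣
  in E ℕ.⊔ D , λ where
    zero    → ℚ.≤-trans (p≤ι (f 0)) (ι-mono {E} {E ℕ.⊔ D} (ℕ.m≤m⊔n E D))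
    (suc k) → ℚ.≤-trans (p k) (ι-mono {D} {E ℕ.⊔ D} (ℕ.m≤n⊔m E D))

^-distribʳ-* : ∀ a b k → (a ℕ.* b) ℕ.^ k ≡ a ℕ.^ k ℕ.* b ℕ.^ k
^-distribʳ-* a b zero    = refl
^-distribʳ-* a b (suc k) = trans (cong (a ℕ.* b ℕ.*_) (^-distribʳ-* a b k)) (ℕ.[m*n]*[o*p]≡[m*o]*[n*p] a b (a ℕ.^ k) (b ℕ.^ k))

-- Splitting off `⅛^ k` replaces C by 8C, and (8C)^k/k! is bounded since it is eventually at most 1.
pow/!-geometric : ∀ C → ∃ λ D → ∀ k → pow/! C k ≤ ι D * ⅛^ k
pow/!-geometric C =
  let N , small = pow/!-small (8 ℕ.* C) 1ℚ (ℚ.positive⁻¹ 1ℚ)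
      D , p = eventually-bounded⇒bounded (pow/! (8 ℕ.* C)) N small
  in D , λ k → begin
    pow/! C k                            ≡⟨ ℚ.*-identityʳ (pow/! C k) ⟨
    pow/! C k * 1ℚ                       ≡⟨ cong (pow/! C k *_) (⅛^-8^ k) ⟨
    1/ k ! * ι (C ℕ.^ k) * (ι (8 ℕ.^ k) * ⅛^ k)
      ≡⟨ solve 4 (λ a b c d → a :* b :* (c :* d) := a :* (c :* b) :* d) refl (1/ k !) (ι (C ℕ.^ k)) (ι (8 ℕ.^ k)) (⅛^ k) ⟩
    1/ k ! * (ι (8 ℕ.^ k) * ι (C ℕ.^ k)) * ⅛^ k
      ≡⟨ cong (λ x → 1/ k ! * x * ⅛^ k) (trans (cong ι (^-distribʳ-* 8 C k)) (ι-* (8 ℕ.^ k) (C ℕ.^ k))) ⟨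
    pow/! (8 ℕ.* C) k * ⅛^ k             ≤⟨ ℚ.*-monoʳ-≤-nonNeg (⅛^ k) {{nonNegative (0≤⅛^ k)}} (p k) ⟩
    ι D * ⅛^ k                           ∎
  where open ℚ.≤-Reasoning

-- The double sum over the square differs from the triangle, which equals `⟨ z 0 , z 0 ⟩`, by
-- entries with `j + k ≥ M`. A bound geometric in each index depends on `j + k` alone after
-- multiplication, so all these entries are at most `κ ⅛^M`.
energy-error : ∀ {n} {L : Fin n → Fin n → ℚ} → Skew L → ∀ {z} → ExpTerms L z →
               ∀ E → (∀ k a → ∣ z k a ∣ ≤ ι E * ⅛^ k) → ∀ m →
               ∣ ⟨ partialSum z (suc m) , partialSum z (suc m) ⟩ - ⟨ z 0 , z 0 ⟩ ∣ ≤ ι (n ℕ.* (E ℕ.* E)) * 1/1+ m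
energy-error {n} skew {z} step E z≤ m = begin
  ∣ ⟨ partialSum z M , partialSum z M ⟩ - ⟨ z 0 , z 0 ⟩ ∣
    ≡⟨ cong₂ (λ p q → ∣ p - q ∣) (⟨partialSum,partialSum⟩ z M) (sym (triangle≡corner g (expTerms-shift skew step) m)) ⟩
  ∣ range (λ j → range (g j) 0 M) 0 M - triangle g 0 M ∣
    ≤⟨ square-close g M β (*-nonNeg (0≤ι κ) (0≤⅛^ M)) g≤ 0 M refl ⟩
  ι M * (ι M * (ι κ * ⅛^ M))
    ≡⟨ solve 3 (λ i k h → i :* (i :* (k :* (h :* h :* h))) := k :* ((i :* h) :* (i :* h) :* h)) refl (ι M) (ι κ) (½^ M) ⟩
  ι κ * ((ι M * ½^ M) * (ι M * ½^ M) * ½^ M)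
    ≤⟨ ℚ.*-monoˡ-≤-nonNeg (ι κ) {{nonNegative (0≤ι κ)}} (*-mono (0≤½^ M) (ℚ.<⇒≤ (ℚ.positive⁻¹ 1ℚ))
         (*-mono {s = 1ℚ} (*-nonNeg (0≤ι M) (0≤½^ M)) (ℚ.<⇒≤ (ℚ.positive⁻¹ 1ℚ)) (ι*½^≤1 M) (ι*½^≤1 M)) ½^≤) ⟩
  ι κ * (1ℚ * 1/1+ m)
    ≡⟨ cong (ι κ *_) (ℚ.*-identityˡ (1/1+ m)) ⟩
  ι κ * 1/1+ m ∎
  where
  open ℚ.≤-Reasoning
  M κ : ℕ
  M = suc m
  κ = n ℕ.* (E ℕ.* E)
  β : ℚ
  β = ι κ * ⅛^ M
  g : ℕ → ℕ → ℚ
  g j k = ⟨ z j , z k ⟩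
  g≤ : ∀ j k → M ℕ.≤ j ℕ.+ k → ∣ g j k ∣ ≤ β
  g≤ j k M≤ = begin
    ∣ g j k ∣                                   ≤⟨ ∣⟨⟩∣≤ (z j) (z k) _ _ (*-nonNeg (0≤ι E) (0≤⅛^ j)) (z≤ j) (z≤ k) ⟩
    ι n * ((ι E * ⅛^ j) * (ι E * ⅛^ k))         ≡⟨ solve 4 (λ n e a b → n :* ((e :* a) :* (e :* b)) := n :* (e :* e) :* (a :* b)) refl
                                                     (ι n) (ι E) (⅛^ j) (⅛^ k) ⟩
    ι n * (ι E * ι E) * (⅛^ j * ⅛^ k)           ≡⟨ cong₂ _*_ (trans (ι-* n (E ℕ.* E)) (cong (ι n *_) (ι-* E E))) (⅛^-+ j k) ⟨
    ι κ * ⅛^ (j ℕ.+ k)                          ≤⟨ ℚ.*-monoˡ-≤-nonNeg (ι κ) {{nonNegative (0≤ι κ)}} (⅛^-antitone M≤) ⟩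
    ι κ * ⅛^ M                                  ∎
  ½^≤ : ½^ M ≤ 1/1+ m
  ½^≤ = begin
    ½^ M                            ≡⟨ ℚ.*-identityʳ (½^ M) ⟨
    ½^ M * 1ℚ                       ≡⟨ cong (½^ M *_) (ι*1/1+ m) ⟨
    ½^ M * (ι M * 1/1+ m)           ≡⟨ solve 3 (λ h i r → h :* (i :* r) := (i :* h) :* r) refl (½^ M) (ι M) (1/1+ m) ⟩
    (ι M * ½^ M) * 1/1+ m           ≤⟨ ℚ.*-monoʳ-≤-nonNeg (1/1+ m) {{nonNegative (ℚ.<⇒≤ (0<1/1+ m))}} (ι*½^≤1 M) ⟩
    1ℚ * 1/1+ m                     ≡⟨ ℚ.*-identityˡ (1/1+ m) ⟩
    1/1+ m                          ∎

-- `N` is chosen before `L` and `z`, because both change with the index at which τ is sampled while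
-- the size bound stays the same.
energy-conserved : ∀ n C B ε → 0ℚ < ε → ∃ λ N → ∀ m → N ℕ.≤ m →
  ∀ {L : Fin n → Fin n → ℚ} → Skew L → ∀ {z} → ExpTerms L z → (∀ k a → ∣ z k a ∣ ≤ ι B * pow/! C k) →
  ∣ ⟨ partialSum z (suc m) , partialSum z (suc m) ⟩ - ⟨ z 0 , z 0 ⟩ ∣ ≤ ε
energy-conserved n C B ε 0<ε =
  let D , pow≤ = pow/!-geometric C
      E = B ℕ.* D
      κ = n ℕ.* (E ℕ.* E)
      δ , 0<δ , κδ≤ε = shrink κ ε 0<ε
      N , small = 1/1+-small δ 0<δ
  in N , λ m N≤m {L} skew {z} step z≤ → ℚ.≤-trans
    (energy-error skew step E (λ k a → ℚ.≤-trans (z≤ k a) (ℚ.≤-trans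
      (ℚ.*-monoˡ-≤-nonNeg (ι B) {{nonNegative (0≤ι B)}} (pow≤ k))
      (ℚ.≤-reflexive (trans (sym (ℚ.*-assoc (ι B) (ι D) (⅛^ k))) (cong (_* ⅛^ k) (sym (ι-* B D))))))) m)
    (ℚ.≤-trans (ℚ.*-monoˡ-≤-nonNeg (ι κ) {{nonNegative (0≤ι κ)}} (small m N≤m)) κδ≤ε)

-- Rational approximations of exp (iτA)

seq-re-∑ : ∀ {n} (v : Vector ℂ n) i → seq (re (∑ v)) i ≡ sum (λ a → seq (re (v a)) i)
seq-re-∑ {zero}  v i = refl
seq-re-∑ {suc n} v i = cong (seq (re (v zero)) i +_) (seq-re-∑ (v ∘ suc) i)

seq-im-∑ : ∀ {n} (v : Vector ℂ n) i → seq (im (∑ v)) i ≡ sum (λ a → seq (im (v a)) i)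
seq-im-∑ {zero}  v i = refl
seq-im-∑ {suc n} v i = cong (seq (im (v zero)) i +_) (seq-im-∑ (v ∘ suc) i)

seq-re-scale : ∀ r z i → seq (re (fromℝ (fromℚ r) *ᶜ z)) i ≡ r * seq (re z) i
seq-re-scale r z i = solve 3 (λ r x y → r :* x :- con 0ℚ :* y := r :* x) refl r (seq (re z) i) (seq (im z) i)

seq-im-scale : ∀ r z i → seq (im (fromℝ (fromℚ r) *ᶜ z)) i ≡ r * seq (im z) i
seq-im-scale r z i = solve 3 (λ r x y → r :* y :+ con 0ℚ :* x := r :* y) refl r (seq (re z) i) (seq (im z) i)

sum-single : ∀ {n} (f : Vector ℚ n) u → (∀ c → c ≢ u → f c ≡ 0ℚ) → sum f ≡ f u
sum-single f zero h = trans (cong (f zero +_) (sum-zero (f ∘ suc) λ c → h (suc c) λ ())) (ℚ.+-identityʳ (f zero))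
sum-single f (suc u) h = trans (cong₂ _+_ (h zero λ ()) (sum-single (f ∘ suc) u λ c c≢u → h (suc c) λ eq → c≢u (Fin.suc-injective eq)))
  (ℚ.+-identityˡ (f (suc u)))

indicator : ∀ {P : Set} → Dec P → ℚ
indicator d = if does d then 1ℚ else 0ℚ

sum-indicator : ∀ {A : Set} {P : Pred A 0ℓ} (P? : Decidable P) {n} (f : Fin n → A) →
                sum (λ a → indicator (P? (f a))) ≡ ι (length (filter P? (tabulate f)))
sum-indicator P? {zero}  f = refl
sum-indicator P? {suc n} f with does (P? (f zero)) | sum-indicator P? (f ∘ suc)
... | true  | eq = trans (cong (1ℚ +_) eq) (sym (ι-+ 1 (length (filter P? (tabulate (f ∘ suc))))))
... | false | eq = trans (ℚ.+-identityˡ _) eq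

-- Real and imaginary parts of iᵇ p.
Re Im : Bool → ℚ → ℚ
Re b p = if b then 0ℚ else p
Im b p = if b then p else 0ℚ

Re²+Im² : ∀ b p → Re b p * Re b p + Im b p * Im b p ≡ p * p
Re²+Im² false p = ℚ.+-identityʳ (p * p)
Re²+Im² true  p = ℚ.+-identityˡ (p * p)

∣Re∣+∣Im∣ : ∀ b p → ∣ Re b p ∣ + ∣ Im b p ∣ ≡ ∣ p ∣
∣Re∣+∣Im∣ false p = ℚ.+-identityʳ ∣ p ∣
∣Re∣+∣Im∣ true  p = ℚ.+-identityˡ ∣ p ∣

Re-* : ∀ b r p → r * Re b p ≡ Re b (r * p)
Re-* true  r p = ℚ.*-zeroʳ r
Re-* false r p = refl

Im-* : ∀ b r p → r * Im b p ≡ Im b (r * p)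
Im-* true  r p = refl
Im-* false r p = ℚ.*-zeroʳ r

Re-+ : ∀ b r p → Re b r + Re b p ≡ Re b (r + p)
Re-+ true  r p = refl
Re-+ false r p = refl

Im-+ : ∀ b r p → Im b r + Im b p ≡ Im b (r + p)
Im-+ true  r p = refl
Im-+ false r p = refl

-- The skew-symmetric matrix K and the column of the exponential at u

module _ {n} (X : Graph n) where

  open Graph X

  adj : Fin n → Fin n → ℚ
  adj a b = indicator (a ∼? b)

  seq-re-adjacency : ∀ a b i → seq (re (adjacency X a b)) i ≡ adj a b
  seq-re-adjacency a b i with does (a ∼? b)
  ... | true  = refl
  ... | false = refl

  seq-im-adjacency : ∀ a b i → seq (im (adjacency X a b)) i ≡ 0ℚ
  seq-im-adjacency a b i with does (a ∼? b)
  ... | true  = refl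
  ... | false = refl

  adj-1 : ∀ {a b} → a ∼ b → adj a b ≡ 1ℚ
  adj-1 {a} {b} a∼b = cong (λ d → if d then 1ℚ else 0ℚ) (dec-true (a ∼? b) a∼b)

  adj-0 : ∀ {a b} → ¬ a ∼ b → adj a b ≡ 0ℚ
  adj-0 {a} {b} a≁b = cong (λ d → if d then 1ℚ else 0ℚ) (dec-false (a ∼? b) a≁b)

  adj-sym : ∀ a b → adj a b ≡ adj b a
  adj-sym a b with a ∼? b
  ... | yes a∼b = sym (adj-1 (∼-sym a∼b))
  ... | no a≁b  = sym (adj-0 (λ b∼a → a≁b (∼-sym b∼a)))

  adj*adj : ∀ a b → adj a b * adj a b ≡ adj a b
  adj*adj a b with does (a ∼? b)
  ... | true  = refl
  ... | false = refl

  0≤adj : ∀ a b → 0ℚ ≤ adj a b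
  0≤adj a b = subst (0ℚ ≤_) (adj*adj a b) (0≤p*p (adj a b))

  adj≤1 : ∀ a b → adj a b ≤ 1ℚ
  adj≤1 a b with does (a ∼? b)
  ... | true  = ℚ.≤-refl
  ... | false = ι-mono {0} {1} ℕ.z≤n

  module _ (phase : Fin n → Bool) where

    sgn : Fin n → ℚ
    sgn a = if phase a then 1ℚ else - 1ℚ

    sgn*sgn : ∀ a → sgn a * sgn a ≡ 1ℚ
    sgn*sgn a with phase a
    ... | true  = refl
    ... | false = refl

    ∣sgn∣ : ∀ a → ∣ sgn a ∣ ≡ 1ℚ
    ∣sgn∣ a with phase a
    ... | true  = refl
    ... | false = refl

    -- D⁻¹ (iA) D for D the diagonal matrix with entries 1 (phase false) and i (phase true).
    K : Fin n → Fin n → ℚ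
    K a b = sgn a * adj a b

    -- `K` differs from the adjacency matrix by a sign on each row, which squaring removes.
    K·-square : ∀ y → ⟨ K · y , K · y ⟩ ≡ ⟨ adj · y , adj · y ⟩
    K·-square y = sum-cong-≗ λ a → begin
      (K · y) a * (K · y) a                                  ≡⟨ cong (λ p → p * p) (pull a) ⟩
      (sgn a * (adj · y) a) * (sgn a * (adj · y) a)          ≡⟨ solve 2 (λ s x → (s :* x) :* (s :* x) := (s :* s) :* (x :* x)) refl (sgn a) ((adj · y) a) ⟩
      (sgn a * sgn a) * ((adj · y) a * (adj · y) a)          ≡⟨ cong (_* ((adj · y) a * (adj · y) a)) (sgn*sgn a) ⟩
      1ℚ * ((adj · y) a * (adj · y) a)                       ≡⟨ ℚ.*-identityˡ _ ⟩
      (adj · y) a * (adj · y) a                              ∎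
      where
      open ≡-Reasoning
      pull : ∀ a → (K · y) a ≡ sgn a * (adj · y) a
      pull a = trans (sum-cong-≗ λ c → ℚ.*-assoc (sgn a) (adj a c) (y c)) (sym (*-distribˡ-sum (sgn a) (λ c → adj a c * y c)))

    module _ (flip : ∀ {a b} → a ∼ b → phase a ≡ not (phase b)) where

      -- On an edge the phase of `c` is determined by that of `a`; off the edges the factor
      -- `adj a c` is 0. This lets a sum over `c` depend on the phase of `a` only.
      adj-flip : ∀ a c (F : Bool → ℚ) → adj a c * F (phase c) ≡ adj a c * F (not (phase a))
      adj-flip a c F with a ∼? c
      ... | yes a∼c = cong (λ b → 1ℚ * F b) (trans (sym (Bool.not-involutive (phase c))) (cong not (sym (flip a∼c))))
      ... | no a≁c  = trans (ℚ.*-zeroˡ (F (phase c))) (sym (ℚ.*-zeroˡ (F (not (phase a)))))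

      K-skew : Skew K
      K-skew a b = begin
        sgn a * adj a b                                     ≡⟨ cong (sgn a *_) (adj-sym a b) ⟩
        sgn a * adj b a                                     ≡⟨ ℚ.*-comm (sgn a) (adj b a) ⟩
        adj b a * sgn a                                     ≡⟨ adj-flip b a (λ p → if p then 1ℚ else - 1ℚ) ⟩
        adj b a * (if not (phase b) then 1ℚ else - 1ℚ)      ≡⟨ cong (adj b a *_) (negate (phase b)) ⟩
        adj b a * - sgn b                                   ≡⟨ solve 2 (λ x s → x :* (:- s) := :- (s :* x)) refl (adj b a) (sgn b) ⟩
        - (sgn b * adj b a)                                 ∎
        where
        open ≡-Reasoning
        negate : ∀ p → (if not p then 1ℚ else - 1ℚ) ≡ - (if p then 1ℚ else - 1ℚ)
        negate true  = refl
        negate false = refl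

      module _ (u : Fin n) (phase-u : phase u ≡ false) where

        power : ℚ → ℕ → Vector ℚ n
        power q zero    a = indicator (a Fin.≟ u)
        power q (suc k) a = q * (K · power q k) a

        term : ℚ → ℕ → Vector ℚ n
        term q k a = 1/ k ! * power q k a

        ι*term : ∀ q k a → ι (suc k) * term q (suc k) a ≡ q * (K · term q k) a
        ι*term q k a = begin
          ι (suc k) * (1/ suc k ! * (q * s))             ≡⟨ cong (λ x → ι (suc k) * (x * (q * s))) (1/suc! k) ⟩
          ι (suc k) * ((1/1+ k * 1/ k !) * (q * s))      ≡⟨ solve 5 (λ i r f q s → i :* ((r :* f) :* (q :* s)) := (i :* r) :* (q :* (f :* s))) refl
                                                              (ι (suc k)) (1/1+ k) (1/ k !) q s ⟩
          (ι (suc k) * 1/1+ k) * (q * (1/ k ! * s))      ≡⟨ cong (_* (q * (1/ k ! * s))) (ι*1/1+ k) ⟩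
          1ℚ * (q * (1/ k ! * s))                        ≡⟨ ℚ.*-identityˡ _ ⟩
          q * (1/ k ! * s)                               ≡⟨ cong (q *_) (trans (*-distribˡ-sum (1/ k !) (λ c → K a c * power q k c))
                                                              (sum-cong-≗ λ c → solve 3 (λ f x w → f :* (x :* w) := x :* (f :* w)) refl (1/ k !) (K a c) (power q k c))) ⟩
          q * (K · term q k) a                           ∎
          where
          open ≡-Reasoning
          s : ℚ
          s = (K · power q k) a

        qK : ℚ → Fin n → Fin n → ℚ
        qK q a b = q * K a b

        qK-skew : ∀ q → Skew (qK q)
        qK-skew q a b = trans (cong (q *_) (K-skew a b)) (sym (ℚ.neg-distribʳ-* q (K b a)))

        K·term : ℚ → ℕ → Vector ℚ n
        K·term q k = K · term q k

        -- Since K commutes with exp(qK), the vector K exp(qK) e_u is itself an exponential series,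
        -- started at K e_u. Conservation of its squared norm is what controls ∥Ky∥².
        K·term-expTerms : ∀ q → ExpTerms (qK q) (K·term q)
        K·term-expTerms q k a = begin
          ι (suc k) * sum (λ c → K a c * term q (suc k) c)     ≡⟨ *-distribˡ-sum (ι (suc k)) (λ c → K a c * term q (suc k) c) ⟩
          sum (λ c → ι (suc k) * (K a c * term q (suc k) c))   ≡⟨ sum-cong-≗ (λ c → trans
                                                                    (solve 3 (λ i x t → i :* (x :* t) := x :* (i :* t)) refl (ι (suc k)) (K a c) (term q (suc k) c))
                                                                    (trans (cong (K a c *_) (ι*term q k c))
                                                                      (solve 3 (λ x q t → x :* (q :* t) := (q :* x) :* t) refl (K a c) q (K·term q k c)))) ⟩
          sum (λ c → (q * K a c) * K·term q k c)               ∎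
          where open ≡-Reasoning

        partialSum-K·term : ∀ q m a → partialSum (K·term q) m a ≡ (K · partialSum (term q) m) a
        partialSum-K·term q zero a = sym (sum-zero _ λ c → ℚ.*-zeroʳ (K a c))
        partialSum-K·term q (suc m) a = trans (cong (_+ K·term q m a) (partialSum-K·term q m a))
          (sym (trans (sum-cong-≗ λ c → ℚ.*-distribˡ-+ (K a c) (partialSum (term q) m c) (term q m c))
            (∑-distrib-+ (λ c → K a c * partialSum (term q) m c) (λ c → K a c * term q m c))))

        K·term-0 : ∀ q a → K·term q 0 a ≡ K a u
        K·term-0 q a = trans (sum-single (λ c → K a c * term q 0 c) u off) (trans (cong (K a u *_) on) (ℚ.*-identityʳ (K a u)))
          where
          off : ∀ c → c ≢ u → K a c * term q 0 c ≡ 0ℚ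
          off c c≢u = trans (cong (K a c *_) (trans
            (cong (λ d → 1/ 0 ! * (if d then 1ℚ else 0ℚ)) (dec-false (c Fin.≟ u) c≢u)) (ℚ.*-zeroʳ (1/ 0 !)))) (ℚ.*-zeroʳ (K a c))
          on : term q 0 u ≡ 1ℚ
          on = trans (cong (λ d → 1/ 0 ! * (if d then 1ℚ else 0ℚ)) (dec-true (u Fin.≟ u) refl)) (ℚ.*-identityʳ (1/ 0 !))

        K·term-0-square : ∀ q → ⟨ K·term q 0 , K·term q 0 ⟩ ≡ ι (degree X u)
        K·term-0-square q = trans (sum-cong-≗ entry) (sum-indicator (u ∼?_) (λ a → a))
          where
          open ≡-Reasoning
          entry : ∀ a → K·term q 0 a * K·term q 0 a ≡ adj u a
          entry a = begin
            K·term q 0 a * K·term q 0 a                  ≡⟨ cong (λ p → p * p) (K·term-0 q a) ⟩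
            (sgn a * adj a u) * (sgn a * adj a u)        ≡⟨ solve 2 (λ s x → (s :* x) :* (s :* x) := (s :* s) :* (x :* x)) refl (sgn a) (adj a u) ⟩
            (sgn a * sgn a) * (adj a u * adj a u)        ≡⟨ cong₂ _*_ (sgn*sgn a) (adj*adj a u) ⟩
            1ℚ * adj a u                                 ≡⟨ ℚ.*-identityˡ (adj a u) ⟩
            adj a u                                      ≡⟨ adj-sym a u ⟩
            adj u a                                      ∎

        ∣K∣≤1 : ∀ a b → ∣ K a b ∣ ≤ 1ℚ
        ∣K∣≤1 a b = ℚ.≤-trans (ℚ.≤-reflexive (trans (ℚ.∣p*q∣≡∣p∣*∣q∣ (sgn a) (adj a b))
          (trans (cong₂ _*_ (∣sgn∣ a) (ℚ.0≤p⇒∣p∣≡p (0≤adj a b))) (ℚ.*-identityˡ (adj a b))))) (adj≤1 a b)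

        module _ (M : Matrix n) (q : ℚ) (i : ℕ)
                 (seq-re-M : ∀ a b → seq (re (M a b)) i ≡ 0ℚ) (seq-im-M : ∀ a b → seq (im (M a b)) i ≡ q * adj a b) where

          -- The column at `u` of the k-th power is D (qK)^k e_u, exactly and at the fixed index
          -- `i`. Multiplication by the purely imaginary `M` exchanges real and imaginary parts, so
          -- the two identities are proved together, each step using the other one.
          seq-re-power : ∀ k a → seq (re ((M ^^ k) a u)) i ≡ Re (phase a) (power q k a)
          seq-im-power : ∀ k a → seq (im ((M ^^ k) a u)) i ≡ Im (phase a) (power q k a)

          seq-re-power zero a with a Fin.≟ u
          ... | yes refl rewrite phase-u = refl
          ... | no _ with phase a
          ...   | true  = refl
          ...   | false = refl
          seq-re-power (suc k) a = begin
            seq (re (∑ λ c → M a c *ᶜ (M ^^ k) c u)) i                     ≡⟨ seq-re-∑ (λ c → M a c *ᶜ (M ^^ k) c u) i ⟩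
            sum (λ c → seq (re (M a c)) i * seq (re ((M ^^ k) c u)) i - seq (im (M a c)) i * seq (im ((M ^^ k) c u)) i)
              ≡⟨ sum-cong-≗ (λ c → cong₂ _-_ (cong (_* seq (re ((M ^^ k) c u)) i) (seq-re-M a c)) (cong₂ _*_ (seq-im-M a c) (seq-im-power k c))) ⟩
            sum (λ c → 0ℚ * seq (re ((M ^^ k) c u)) i - q * adj a c * Im (phase c) (power q k c))
              ≡⟨ sum-cong-≗ (λ c → trans (solve 4 (λ r q x y → con 0ℚ :* r :- q :* x :* y := :- (q :* (x :* y))) refl (seq (re ((M ^^ k) c u)) i) q (adj a c) (Im (phase c) (power q k c)))
                   (cong (λ x → - (q * x)) (adj-flip a c (λ p → Im p (power q k c))))) ⟩
            sum (λ c → - (q * (adj a c * Im (not (phase a)) (power q k c))))   ≡⟨ collect (phase a) ⟩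
            Re (phase a) (q * sum (λ c → sgn a * adj a c * power q k c))       ∎
            where
            open ≡-Reasoning
            collect : ∀ p → sum (λ c → - (q * (adj a c * Im (not p) (power q k c)))) ≡
                      Re p (q * sum (λ c → (if p then 1ℚ else - 1ℚ) * adj a c * power q k c))
            collect true  = sum-zero _ λ c → solve 2 (λ q x → :- (q :* (x :* con 0ℚ)) := con 0ℚ) refl q (adj a c)
            collect false = trans (sum-cong-≗ λ c → solve 3 (λ q x w → :- (q :* (x :* w)) := q :* (con (- 1ℚ) :* x :* w)) refl q (adj a c) (power q k c))
              (sym (*-distribˡ-sum q (λ c → - 1ℚ * adj a c * power q k c)))

          seq-im-power zero a with a Fin.≟ u
          ... | yes refl rewrite phase-u = refl
          ... | no _ with phase a
          ...   | true  = refl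
          ...   | false = refl
          seq-im-power (suc k) a = begin
            seq (im (∑ λ c → M a c *ᶜ (M ^^ k) c u)) i                     ≡⟨ seq-im-∑ (λ c → M a c *ᶜ (M ^^ k) c u) i ⟩
            sum (λ c → seq (re (M a c)) i * seq (im ((M ^^ k) c u)) i + seq (im (M a c)) i * seq (re ((M ^^ k) c u)) i)
              ≡⟨ sum-cong-≗ (λ c → cong₂ _+_ (cong (_* seq (im ((M ^^ k) c u)) i) (seq-re-M a c)) (cong₂ _*_ (seq-im-M a c) (seq-re-power k c))) ⟩
            sum (λ c → 0ℚ * seq (im ((M ^^ k) c u)) i + q * adj a c * Re (phase c) (power q k c))
              ≡⟨ sum-cong-≗ (λ c → trans (solve 4 (λ r q x y → con 0ℚ :* r :+ q :* x :* y := q :* (x :* y)) refl (seq (im ((M ^^ k) c u)) i) q (adj a c) (Re (phase c) (power q k c)))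
                   (cong (q *_) (adj-flip a c (λ p → Re p (power q k c))))) ⟩
            sum (λ c → q * (adj a c * Re (not (phase a)) (power q k c)))       ≡⟨ collect (phase a) ⟩
            Im (phase a) (q * sum (λ c → sgn a * adj a c * power q k c))       ∎
            where
            open ≡-Reasoning
            collect : ∀ p → sum (λ c → q * (adj a c * Re (not p) (power q k c))) ≡
                      Im p (q * sum (λ c → (if p then 1ℚ else - 1ℚ) * adj a c * power q k c))
            collect false = sum-zero _ λ c → solve 2 (λ q x → q :* (x :* con 0ℚ) := con 0ℚ) refl q (adj a c)
            collect true  = trans (sum-cong-≗ λ c → solve 3 (λ q x w → q :* (x :* w) := q :* (con 1ℚ :* x :* w)) refl q (adj a c) (power q k c))
              (sym (*-distribˡ-sum q (λ c → 1ℚ * adj a c * power q k c)))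

          seq-re-expTerm : ∀ k a → seq (re (expTerm M k a u)) i ≡ Re (phase a) (term q k a)
          seq-re-expTerm k a = trans (seq-re-scale (1/ k !) ((M ^^ k) a u) i)
            (trans (cong (1/ k ! *_) (seq-re-power k a)) (Re-* (phase a) (1/ k !) (power q k a)))

          seq-im-expTerm : ∀ k a → seq (im (expTerm M k a u)) i ≡ Im (phase a) (term q k a)
          seq-im-expTerm k a = trans (seq-im-scale (1/ k !) ((M ^^ k) a u) i)
            (trans (cong (1/ k ! *_) (seq-im-power k a)) (Im-* (phase a) (1/ k !) (power q k a)))

          seq-re-expSum : ∀ m a → seq (re (expSum M m a u)) i ≡ Re (phase a) (partialSum (term q) m a)
          seq-re-expSum zero a with phase a
          ... | true  = refl
          ... | false = refl
          seq-re-expSum (suc m) a = trans (cong₂ _+_ (seq-re-expSum m a) (seq-re-expTerm m a)) (Re-+ (phase a) _ _)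

          seq-im-expSum : ∀ m a → seq (im (expSum M m a u)) i ≡ Im (phase a) (partialSum (term q) m a)
          seq-im-expSum zero a with phase a
          ... | true  = refl
          ... | false = refl
          seq-im-expSum (suc m) a = trans (cong₂ _+_ (seq-im-expSum m a) (seq-im-expTerm m a)) (Im-+ (phase a) _ _)

          -- One of the two parts of the entry is 0 and the other is `term q k a`, so its `size` is
          -- the absolute value and the estimate behind the convergence of `exp` applies.
          ∣term∣≤ : ∀ B → Bounded M B i → ∀ k a → ∣ term q k a ∣ ≤ pow/! (n ℕ.* B) k
          ∣term∣≤ B h k a = subst (_≤ pow/! (n ℕ.* B) k)
            (trans (cong₂ (λ x y → ∣ x ∣ + ∣ y ∣) (seq-re-expTerm k a) (seq-im-expTerm k a)) (∣Re∣+∣Im∣ (phase a) (term q k a)))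
            (size-expTerm M B i h k a u)

          ∣K·term∣≤ : ∀ B → Bounded M B i → ∀ k a → ∣ K·term q k a ∣ ≤ ι n * pow/! (n ℕ.* B) k
          ∣K·term∣≤ B h k a = ∣sum∣≤ (λ c → K a c * term q k c) (pow/! (n ℕ.* B) k) λ c → begin
            ∣ K a c * term q k c ∣           ≡⟨ ℚ.∣p*q∣≡∣p∣*∣q∣ (K a c) (term q k c) ⟩
            ∣ K a c ∣ * ∣ term q k c ∣       ≤⟨ *-mono (ℚ.0≤∣p∣ (term q k c)) (ι-mono {0} {1} ℕ.z≤n) (∣K∣≤1 a c) (∣term∣≤ B h k c) ⟩
            1ℚ * pow/! (n ℕ.* B) k           ≡⟨ ℚ.*-identityˡ _ ⟩
            pow/! (n ℕ.* B) k                ∎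
            where open ℚ.≤-Reasoning

-- From the norm of the deviation to the moduli of the entries

seq-re-*1ᶜ : ∀ z i → seq (re (z *ᶜ 1ᶜ)) i ≡ seq (re z) i
seq-re-*1ᶜ z i = solve 2 (λ x y → x :* con 1ℚ :- y :* con 0ℚ := x) refl (seq (re z) i) (seq (im z) i)

seq-im-*1ᶜ : ∀ z i → seq (im (z *ᶜ 1ᶜ)) i ≡ seq (im z) i
seq-im-*1ᶜ z i = solve 2 (λ x y → x :* con 0ℚ :+ y :* con 1ℚ := y) refl (seq (re z) i) (seq (im z) i)

seq-re-*0ᶜ : ∀ z i → seq (re (z *ᶜ 0ᶜ)) i ≡ 0ℚ
seq-re-*0ᶜ z i = solve 2 (λ x y → x :* con 0ℚ :- y :* con 0ℚ := con 0ℚ) refl (seq (re z) i) (seq (im z) i)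

seq-im-*0ᶜ : ∀ z i → seq (im (z *ᶜ 0ᶜ)) i ≡ 0ℚ
seq-im-*0ᶜ z i = solve 2 (λ x y → x :* con 0ℚ :+ y :* con 0ℚ := con 0ℚ) refl (seq (re z) i) (seq (im z) i)

module _ {n} (V : Matrix n) (u a : Fin n) (i : ℕ) where

  𝐞-diag : 𝐞 u u ≡ 1ᶜ
  𝐞-diag = cong (λ d → if d then 1ᶜ else 0ᶜ) (dec-true (u Fin.≟ u) refl)

  𝐞-off : ∀ c → c ≢ u → 𝐞 u c ≡ 0ᶜ
  𝐞-off c c≢u = cong (λ d → if d then 1ᶜ else 0ᶜ) (dec-false (u Fin.≟ c) (λ u≡c → c≢u (sym u≡c)))

  seq-re-column : seq (re ((V ⊠ᵛ 𝐞 u) a)) i ≡ seq (re (V a u)) i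
  seq-re-column = trans (seq-re-∑ (λ c → V a c *ᶜ 𝐞 u c) i) (trans
    (sum-single (λ c → seq (re (V a c *ᶜ 𝐞 u c)) i) u
      λ c c≢u → trans (cong (λ e → seq (re (V a c *ᶜ e)) i) (𝐞-off c c≢u)) (seq-re-*0ᶜ (V a c) i))
    (trans (cong (λ e → seq (re (V a u *ᶜ e)) i) 𝐞-diag) (seq-re-*1ᶜ (V a u) i)))

  seq-im-column : seq (im ((V ⊠ᵛ 𝐞 u) a)) i ≡ seq (im (V a u)) i
  seq-im-column = trans (seq-im-∑ (λ c → V a c *ᶜ 𝐞 u c) i) (trans
    (sum-single (λ c → seq (im (V a c *ᶜ 𝐞 u c)) i) u
      λ c c≢u → trans (cong (λ e → seq (im (V a c *ᶜ e)) i) (𝐞-off c c≢u)) (seq-im-*0ᶜ (V a c) i))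
    (trans (cong (λ e → seq (im (V a u *ᶜ e)) i) 𝐞-diag) (seq-im-*1ᶜ (V a u) i)))

seq-re-deviation : ∀ x y t i → seq (re (x *ᶜ y -ᶜ fromℝ (fromℚ t) *ᶜ 1ᶜ)) i ≡
                   seq (re x) i * seq (re y) i - seq (im x) i * seq (im y) i - t
seq-re-deviation x y t i = solve 5 (λ a b c d t → (a :* b :- c :* d) :- (t :* con 1ℚ :- con 0ℚ :* con 0ℚ) := a :* b :- c :* d :- t) refl
  (seq (re x) i) (seq (re y) i) (seq (im x) i) (seq (im y) i) t

-- Unfolds to the entries of the vector inside the norm of `LocalεUniformMixing`. The real part is
-- the squared modulus of `V a u` minus `t`.
deviation : ∀ {n} → Matrix n → Fin n → ℚ → Vector ℂ n
deviation V u t a = (V ⊠ᵛ 𝐞 u) a *ᶜ (conjᴹ V ⊠ᵛ 𝐞 u) a -ᶜ fromℝ (fromℚ t) *ᶜ 1ᶜ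

seq-deviation : ∀ {n} (V : Matrix n) u t a i → seq (re (deviation V u t a)) i ≡
                seq (re (V a u)) i * seq (re (V a u)) i + seq (im (V a u)) i * seq (im (V a u)) i - t
seq-deviation V u t a i = begin
  seq (re (deviation V u t a)) i
    ≡⟨ seq-re-deviation ((V ⊠ᵛ 𝐞 u) a) ((conjᴹ V ⊠ᵛ 𝐞 u) a) t i ⟩
  seq (re ((V ⊠ᵛ 𝐞 u) a)) i * seq (re ((conjᴹ V ⊠ᵛ 𝐞 u) a)) i - seq (im ((V ⊠ᵛ 𝐞 u) a)) i * seq (im ((conjᴹ V ⊠ᵛ 𝐞 u) a)) i - t
    ≡⟨ cong (_- t) (cong₂ _-_ (cong₂ _*_ (seq-re-column V u a i) (seq-re-column (conjᴹ V) u a i))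
                              (cong₂ _*_ (seq-im-column V u a i) (seq-im-column (conjᴹ V) u a i))) ⟩
  p * p - r * (- r) - t
    ≡⟨ solve 3 (λ p r t → p :* p :- r :* (:- r) :- t := p :* p :+ r :* r :- t) refl p r t ⟩
  p * p + r * r - t ∎
  where
  open ≡-Reasoning
  p r : ℚ
  p = seq (re (V a u)) i
  r = seq (im (V a u)) i

seq-∑ʳ : ∀ {n} (v : Vector ℝ n) i → seq (∑ʳ v) i ≡ sum (λ a → seq (v a) i)
seq-∑ʳ {zero}  v i = refl
seq-∑ʳ {suc n} v i = cong (seq (v zero) i +_) (seq-∑ʳ (v ∘ suc) i)

∣p∣*∣p∣≡p*p : ∀ p → ∣ p ∣ * ∣ p ∣ ≡ p * p
∣p∣*∣p∣≡p*p p = trans (sym (ℚ.∣p*q∣≡∣p∣*∣q∣ p p)) (ℚ.0≤p⇒∣p∣≡p (0≤p*p p))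

-- `approxRoot` stays on a grid of width `1/1+ m` and can miss the true root by that much; one `e`
-- covers the computed root and the other the grid width.
approxRoot≤⇒≤ : ∀ s m e → approxRoot s m ≤ e → 1/1+ m ≤ e → s ≤ (e + e) * (e + e)
approxRoot≤⇒≤ s m e r≤e η≤e =
  let 0≤r , _ , s< = approxRoot-isRoot s m
      0≤η = ℚ.<⇒≤ (0<1/1+ m)
      0≤e = ℚ.≤-trans 0≤η η≤e
      r+η≤ = ℚ.+-mono-≤ r≤e η≤e
  in ℚ.≤-trans (ℚ.<⇒≤ s<) (*-mono (+-nonNeg 0≤r 0≤η) (+-nonNeg 0≤e 0≤e) r+η≤ r+η≤)

norm<⇒entries≤ : ∀ {n} {f : Vector ℝ n} {e} → 0ℚ < e → √ (∑ʳ f) <ʳ fromℚ e →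
                 ∀∞ λ m → (∀ a → 0ℚ ≤ seq (f a) m) → ∀ a → seq (f a) m ≤ (e + e) * (e + e)
norm<⇒entries≤ {f = f} {e} 0<e (δ , 0<δ , close) = ∀∞-zip
  (λ m r+δ≤e η≤e 0≤f a → begin
    seq (f a) m                       ≤⟨ ≤sum (λ b → seq (f b) m) 0≤f a ⟩
    sum (λ b → seq (f b) m)           ≡⟨ seq-∑ʳ f m ⟨
    seq (∑ʳ f) m                      ≤⟨ approxRoot≤⇒≤ (seq (∑ʳ f) m) m e (ℚ.≤-trans (p≤p+q (ℚ.<⇒≤ 0<δ)) r+δ≤e) η≤e ⟩
    (e + e) * (e + e)                 ∎)
  close (1/1+-small e 0<e)
  where open ℚ.≤-Reasoning

0≤∣∣² : ∀ z m → 0ℚ ≤ seq ∣ z ∣² m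
0≤∣∣² z m = +-nonNeg (0≤p*p (seq (re z) m)) (0≤p*p (seq (im z) m))

∣∣²≤⇒∣re∣≤ : ∀ z m {b} → 0ℚ ≤ b → seq ∣ z ∣² m ≤ b * b → ∣ seq (re z) m ∣ ≤ b
∣∣²≤⇒∣re∣≤ z m {b} 0≤b h = sq-cancel-≤ 0≤b (begin
  ∣ x ∣ * ∣ x ∣       ≡⟨ ∣p∣*∣p∣≡p*p x ⟩
  x * x               ≤⟨ p≤p+q (0≤p*p (seq (im z) m)) ⟩
  seq ∣ z ∣² m        ≤⟨ h ⟩
  b * b               ∎)
  where
  open ℚ.≤-Reasoning
  x : ℚ
  x = seq (re z) m

modulus-deviation : ∀ {n} (V : Matrix n) u t a m {b} → 0ℚ ≤ b → seq ∣ deviation V u t a ∣² m ≤ b * b →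
  ∣ seq (re (V a u)) m * seq (re (V a u)) m + seq (im (V a u)) m * seq (im (V a u)) m - t ∣ ≤ b
modulus-deviation V u t a m {b} 0≤b h = subst (λ x → ∣ x ∣ ≤ b) (seq-deviation V u t a m) (∣∣²≤⇒∣re∣≤ (deviation V u t a) m 0≤b h)

-- Keeping n variable makes ∑ʳ neutral, so that the vector f in norm<⇒entries≤ is
-- found by unification, without comparing proofs of the Cauchy property.
mixing⇒deviation-small : ∀ {n} (X : Graph n) u → LocalεUniformMixing X u → ∀ e → 0ℚ < e →
  ∃ λ τ → ∀∞ λ m → ∀ a → seq ∣ deviation (U X τ) u ((ℤ.+ 1 / n) {{Fin.nonZeroIndex u}}) a ∣² m ≤ (e + e) * (e + e)
mixing⇒deviation-small {n} X u mixing e 0<e =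
  let τ , norm< = mixing (fromℚ e) (e , 0<e , 0 , λ _ _ → ℚ.≤-reflexive (ℚ.+-identityˡ e))
      N , entries = norm<⇒entries≤ 0<e norm<
  in τ , N , λ m N≤m → entries m N≤m λ a → 0≤∣∣² (deviation (U X τ) u ((ℤ.+ 1 / n) {{Fin.nonZeroIndex u}}) a) m

mixing⇒moduli-close : ∀ {n} (X : Graph n) u → LocalεUniformMixing X u → ∀ e → 0ℚ < e →
  ∃ λ τ → ∀∞ λ m → ∀ a →
  ∣ seq (re (U X τ a u)) m * seq (re (U X τ a u)) m + seq (im (U X τ a u)) m * seq (im (U X τ a u)) m -
    (ℤ.+ 1 / n) {{Fin.nonZeroIndex u}} ∣ ≤ e + e
mixing⇒moduli-close {n} X u mixing e 0<e =
  let τ , N , small = mixing⇒deviation-small X u mixing e 0<e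
  in τ , N , λ m N≤m a → modulus-deviation (U X τ) u ((ℤ.+ 1 / n) {{Fin.nonZeroIndex u}}) a m
       (+-nonNeg (ℚ.<⇒≤ 0<e) (ℚ.<⇒≤ 0<e)) (small m N≤m a)

-- Rounding

∣p∣≤2 : ∀ p r t e → ∣ p * p + r * r - t ∣ ≤ e + e → t ≤ 1ℚ → e ≤ 1ℚ → ∣ p ∣ ≤ ι 2
∣p∣≤2 p r t e h t≤1 e≤1 = sq-cancel-≤ (0≤ι 2) (begin
  ∣ p ∣ * ∣ p ∣       ≡⟨ ∣p∣*∣p∣≡p*p p ⟩
  p * p               ≤⟨ p≤p+q (0≤p*p r) ⟩
  p * p + r * r       ≤⟨ ∣p-q∣≤r⇒p≤q+r h ⟩
  t + (e + e)         ≤⟨ ℚ.+-mono-≤ t≤1 (ℚ.+-mono-≤ e≤1 e≤1) ⟩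
  1ℚ + (1ℚ + 1ℚ)      ≤⟨ ι-mono {3} {4} (ℕ.n≤1+n 3) ⟩
  ι 2 * ι 2           ∎)
  where open ℚ.≤-Reasoning

-- The difference of squares factors, and 5 bounds `∣ p ∣ + ∣ c ∣`: 2 for the first and 2 + 1 for
-- the second.
squares-close : ∀ p c η → ∣ p - c ∣ ≤ η → η ≤ 1ℚ → ∣ p ∣ ≤ ι 2 → ∣ c * c - p * p ∣ ≤ ι 5 * η
squares-close p c η h η≤1 p≤2 = begin
  ∣ c * c - p * p ∣                           ≡⟨ ∣p-q∣≡∣q-p∣ (c * c) (p * p) ⟩
  ∣ p * p - c * c ∣                           ≤⟨ ∣pq-rs∣≤ p p c c ⟩
  ∣ p ∣ * ∣ p - c ∣ + ∣ c ∣ * ∣ p - c ∣       ≡⟨ ℚ.*-distribʳ-+ (∣ p - c ∣) (∣ p ∣) (∣ c ∣) ⟨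
  (∣ p ∣ + ∣ c ∣) * ∣ p - c ∣                 ≤⟨ *-mono {s = η} (ℚ.0≤∣p∣ (p - c)) (0≤ι 5) (ℚ.+-mono-≤ p≤2 c≤3) h ⟩
  ι 5 * η                                     ∎
  where
  open ℚ.≤-Reasoning
  c≤3 : ∣ c ∣ ≤ ι 3
  c≤3 = begin
    ∣ c ∣                   ≡⟨ cong ∣_∣ (solve 2 (λ c p → c := p :- (p :- c)) refl c p) ⟩
    ∣ p - (p - c) ∣         ≤⟨ ℚ.∣p-q∣≤∣p∣+∣q∣ p (p - c) ⟩
    ∣ p ∣ + ∣ p - c ∣       ≤⟨ ℚ.+-mono-≤ p≤2 (ℚ.≤-trans h η≤1) ⟩
    ι 2 + 1ℚ                ≡⟨⟩
    ι 3                     ∎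

-- Of the `3e`, two come from the hypothesis on `p` and `r`. Replacing them by `c` and `d` costs
-- `5η` for each square, and `10η ≤ e`.
modulus-close : ∀ p r c d t e η → ∣ p * p + r * r - t ∣ ≤ e + e → ∣ p - c ∣ ≤ η → ∣ r - d ∣ ≤ η →
                t ≤ 1ℚ → e ≤ 1ℚ → η ≤ 1ℚ → ι 10 * η ≤ e → ∣ c * c + d * d - t ∣ ≤ ι 3 * e
modulus-close p r c d t e η h pc rd t≤1 e≤1 η≤1 10η≤e = begin
  ∣ c * c + d * d - t ∣
    ≡⟨ cong ∣_∣ (solve 5 (λ p r c d t → c :* c :+ d :* d :- t := (p :* p :+ r :* r :- t) :+ ((c :* c :- p :* p) :+ (d :* d :- r :* r))) refl p r c d t) ⟩
  ∣ (p * p + r * r - t) + ((c * c - p * p) + (d * d - r * r)) ∣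
    ≤⟨ ℚ.∣p+q∣≤∣p∣+∣q∣ (p * p + r * r - t) ((c * c - p * p) + (d * d - r * r)) ⟩
  ∣ p * p + r * r - t ∣ + ∣ (c * c - p * p) + (d * d - r * r) ∣
    ≤⟨ ℚ.+-mono-≤ h (ℚ.≤-trans (ℚ.∣p+q∣≤∣p∣+∣q∣ (c * c - p * p) (d * d - r * r))
         (ℚ.+-mono-≤ (squares-close p c η pc η≤1 (∣p∣≤2 p r t e h t≤1 e≤1))
                     (squares-close r d η rd η≤1 (∣p∣≤2 r p t e (subst (λ x → ∣ x - t ∣ ≤ e + e) (ℚ.+-comm (p * p) (r * r)) h) t≤1 e≤1)))) ⟩
  (e + e) + (ι 5 * η + ι 5 * η)
    ≡⟨ cong ((e + e) +_) (ℚ.*-distribʳ-+ η (ι 5) (ι 5)) ⟨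
  (e + e) + ι 10 * η
    ≤⟨ ℚ.+-monoʳ-≤ (e + e) 10η≤e ⟩
  (e + e) + e
    ≡⟨ solve 1 (λ e → (e :+ e) :+ e := con (ι 3) :* e) refl e ⟩
  ι 3 * e ∎
  where open ℚ.≤-Reasoning

-- Zero counts as positive, so that every sign squares to 1.
signOf : ∀ {p} → Dec (0ℚ ≤ p) → ℤ
signOf d = if does d then ℤ.1ℤ else ℤ.-1ℤ

signOf*signOf : ∀ {p} (d : Dec (0ℚ ≤ p)) → signOf d ℤ.* signOf d ≡ ℤ.1ℤ
signOf*signOf (yes _) = refl
signOf*signOf (no _)  = refl

signOf*∣∣ : ∀ {p} (d : Dec (0ℚ ≤ p)) → fromℤ (signOf d) * ∣ p ∣ ≡ p
signOf*∣∣ {p} (yes 0≤p) = trans (ℚ.*-identityˡ ∣ p ∣) (ℚ.0≤p⇒∣p∣≡p 0≤p)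
signOf*∣∣ {p} (no 0≰p)  = trans
  (cong (- 1ℚ *_) (trans (sym (ℚ.∣-p∣≡∣p∣ p)) (ℚ.0≤p⇒∣p∣≡p (ℚ.neg-antimono-≤ (ℚ.<⇒≤ (ℚ.≰⇒> 0≰p))))))
  (solve 1 (λ p → con (- 1ℚ) :* (:- p) := p) refl p)

∣signOf∣ : ∀ {p} (d : Dec (0ℚ ≤ p)) → ∣ fromℤ (signOf d) ∣ ≡ 1ℚ
∣signOf∣ (yes _) = refl
∣signOf∣ (no _)  = refl

sign : ℚ → ℤ
sign p = signOf (0ℚ ℚ.≤? p)

-- A product of nonnegative numbers lies between their squares.
product-close-1 : ∀ t δ → 0ℚ ≤ t → ∀ x y → 0ℚ ≤ x → 0ℚ ≤ y → x ≤ y →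
                  ∣ t * (x * x) - 1ℚ ∣ ≤ δ → ∣ t * (y * y) - 1ℚ ∣ ≤ δ → ∣ t * (x * y) - 1ℚ ∣ ≤ δ
product-close-1 t δ 0≤t x y 0≤x 0≤y x≤y hx hy = ∣p-q∣≤r {t * (x * y)} {1ℚ} {δ}
  (ℚ.≤-trans (scale (*-mono 0≤y 0≤y x≤y ℚ.≤-refl)) (∣p-q∣≤r⇒p≤q+r {t * (y * y)} {1ℚ} hy))
  (ℚ.≤-trans (∣p-q∣≤r⇒p≤q+r {1ℚ} {t * (x * x)} (subst (_≤ δ) (∣p-q∣≡∣q-p∣ (t * (x * x)) 1ℚ) hx))
    (ℚ.+-monoˡ-≤ δ (scale (*-mono 0≤x 0≤x ℚ.≤-refl x≤y))))
  where
  scale : ∀ {p q} → p ≤ q → t * p ≤ t * q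
  scale = ℚ.*-monoˡ-≤-nonNeg t {{nonNegative 0≤t}}

-- Writing `x` and `y` as sign times absolute value, the product of the signs factors out with
-- absolute value 1 and leaves the case of nonnegative numbers.
product-close-sign : ∀ t δ → 0ℚ ≤ t → ∀ x y → ∣ t * (x * x) - 1ℚ ∣ ≤ δ → ∣ t * (y * y) - 1ℚ ∣ ≤ δ →
                     ∣ t * (x * y) - fromℤ (sign x) * fromℤ (sign y) ∣ ≤ δ
product-close-sign t δ 0≤t x y hx hy = begin
  ∣ t * (x * y) - s * r ∣                                 ≡⟨ cong₂ (λ x y → ∣ t * (x * y) - s * r ∣) (signOf*∣∣ (0ℚ ℚ.≤? x)) (signOf*∣∣ (0ℚ ℚ.≤? y)) ⟨
  ∣ t * ((s * ∣ x ∣) * (r * ∣ y ∣)) - s * r ∣             ≡⟨ cong ∣_∣ (solve 5 (λ t s r x y → t :* ((s :* x) :* (r :* y)) :- s :* r :=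
                                                               s :* r :* (t :* (x :* y) :- con 1ℚ)) refl t s r (∣ x ∣) (∣ y ∣)) ⟩
  ∣ s * r * (t * (∣ x ∣ * ∣ y ∣) - 1ℚ) ∣                  ≡⟨ ℚ.∣p*q∣≡∣p∣*∣q∣ (s * r) (t * (∣ x ∣ * ∣ y ∣) - 1ℚ) ⟩
  ∣ s * r ∣ * ∣ t * (∣ x ∣ * ∣ y ∣) - 1ℚ ∣                ≡⟨ cong (_* ∣ t * (∣ x ∣ * ∣ y ∣) - 1ℚ ∣)
                                                               (trans (ℚ.∣p*q∣≡∣p∣*∣q∣ s r) (cong₂ _*_ (∣signOf∣ (0ℚ ℚ.≤? x)) (∣signOf∣ (0ℚ ℚ.≤? y)))) ⟩
  1ℚ * ∣ t * (∣ x ∣ * ∣ y ∣) - 1ℚ ∣                       ≡⟨ ℚ.*-identityˡ ∣ t * (∣ x ∣ * ∣ y ∣) - 1ℚ ∣ ⟩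
  ∣ t * (∣ x ∣ * ∣ y ∣) - 1ℚ ∣                            ≤⟨ either (ℚ.≤-total (∣ x ∣) (∣ y ∣)) ⟩
  δ                                                       ∎
  where
  open ℚ.≤-Reasoning
  s r : ℚ
  s = fromℤ (sign x)
  r = fromℤ (sign y)
  abs : ∀ z → ∣ t * (z * z) - 1ℚ ∣ ≤ δ → ∣ t * (∣ z ∣ * ∣ z ∣) - 1ℚ ∣ ≤ δ
  abs z = subst (λ w → ∣ t * w - 1ℚ ∣ ≤ δ) (sym (∣p∣*∣p∣≡p*p z))
  either : ∣ x ∣ ≤ ∣ y ∣ ⊎ ∣ y ∣ ≤ ∣ x ∣ → ∣ t * (∣ x ∣ * ∣ y ∣) - 1ℚ ∣ ≤ δ
  either (inj₁ x≤y) = product-close-1 t δ 0≤t (∣ x ∣) (∣ y ∣) (ℚ.0≤∣p∣ x) (ℚ.0≤∣p∣ y) x≤y (abs x hx) (abs y hy)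
  either (inj₂ y≤x) = subst (λ w → ∣ t * w - 1ℚ ∣ ≤ δ) (ℚ.*-comm (∣ y ∣) (∣ x ∣))
    (product-close-1 t δ 0≤t (∣ y ∣) (∣ x ∣) (ℚ.0≤∣p∣ y) (ℚ.0≤∣p∣ x) y≤x (abs y hy) (abs x hx))

-- The integer ∥Aσ∥² and its distance from n∥Ay∥²

module _ {n} (X : Graph n) where

  open Graph X

  adjᶻ : Fin n → Fin n → ℤ
  adjᶻ a b = if does (a ∼? b) then ℤ.1ℤ else ℤ.0ℤ

  fromℤ-adjᶻ : ∀ a b → fromℤ (adjᶻ a b) ≡ adj X a b
  fromℤ-adjᶻ a b with does (a ∼? b)
  ... | true  = refl
  ... | false = refl

  adjᶻ-sym : ∀ a b → adjᶻ a b ≡ adjᶻ b a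
  adjᶻ-sym a b with a ∼? b
  ... | yes a∼b = sym (cong (λ d → if d then ℤ.1ℤ else ℤ.0ℤ) (dec-true (b ∼? a) (∼-sym a∼b)))
  ... | no a≁b  = sym (cong (λ d → if d then ℤ.1ℤ else ℤ.0ℤ) (dec-false (b ∼? a) (λ b∼a → a≁b (∼-sym b∼a))))

  adjᶻ-diag : ∀ a → adjᶻ a a ≡ ℤ.0ℤ
  adjᶻ-diag a = cong (λ d → if d then ℤ.1ℤ else ℤ.0ℤ) (dec-false (a ∼? a) ∼-irrefl)

  adjᶻ*adjᶻ : ∀ a b → adjᶻ a b ℤ.* adjᶻ a b ≡ adjᶻ a b
  adjᶻ*adjᶻ a b with does (a ∼? b)
  ... | true  = refl
  ... | false = refl

  ∥A_∥² : Vector ℤ n → ℤ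
  ∥A σ ∥² = Σᶻ.sum λ v → Σᶻ.sum (λ a → adjᶻ v a ℤ.* σ a) ℤ.* Σᶻ.sum (λ a → adjᶻ v a ℤ.* σ a)

  -- Modulo 2 the square of each row sum is the sum of the squares, and these lose the signs. What
  -- remains is the sum of all entries of a symmetric matrix with zero diagonal.
  ∥Aσ∥²-even : ∀ σ → (∀ a → σ a ℤ.* σ a ≡ ℤ.1ℤ) → ∥A σ ∥² ≡₂ ℤ.0ℤ
  ∥Aσ∥²-even σ σ²≡1 = ≡₂-trans
    (≡₂-sum _ _ λ v → subst (λ s → Σᶻ.sum (b v) ℤ.* Σᶻ.sum (b v) ≡₂ s) (Σᶻ.sum-cong-≗ (square v)) (sum²≡₂sum-of-squares (b v)))
    (subst (Σᶻ.sum (λ v → Σᶻ.sum (adjᶻ v)) ≡₂_) (trans (Σᶻ.sum-cong-≗ adjᶻ-diag) (Σᶻ.sum-replicate-zero n))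
      (symmetric-sum≡₂trace adjᶻ adjᶻ-sym))
    where
    b : Fin n → Fin n → ℤ
    b v a = adjᶻ v a ℤ.* σ a
    square : ∀ v a → b v a ℤ.* b v a ≡ adjᶻ v a
    square v a = trans (solveᶻ 2 (λ x s → (x ⊗ s) ⊗ (x ⊗ s) ≜ (x ⊗ x) ⊗ (s ⊗ s)) refl (adjᶻ v a) (σ a))
      (trans (cong₂ ℤ._*_ (adjᶻ*adjᶻ v a) (σ²≡1 a)) (ℤ.*-identityʳ (adjᶻ v a)))

  fromℤ-∥A_∥² : ∀ σ → fromℤ ∥A σ ∥² ≡ ⟨ adj X · (fromℤ ∘ σ) , adj X · (fromℤ ∘ σ) ⟩
  fromℤ-∥A σ ∥² = trans (fromℤ-sum (λ v → row v ℤ.* row v)) (sum-cong-≗ λ v →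
    trans (fromℤ-* (row v) (row v)) (cong₂ _*_ (entry v) (entry v)))
    where
    row : Fin n → ℤ
    row v = Σᶻ.sum λ a → adjᶻ v a ℤ.* σ a
    entry : ∀ v → fromℤ (row v) ≡ (adj X · (fromℤ ∘ σ)) v
    entry v = trans (fromℤ-sum (λ a → adjᶻ v a ℤ.* σ a)) (sum-cong-≗ λ a →
      trans (fromℤ-* (adjᶻ v a) (σ a)) (cong (_* fromℤ (σ a)) (fromℤ-adjᶻ v a)))

  -- Expanded, ∥Ay∥² has n³ terms A_va A_vb y_a y_b. The coefficients lie between 0 and 1, so each
  -- term contributes at most `δ`.
  ∥Ay∥²-close : ∀ t y s δ → 0ℚ ≤ δ → (∀ a b → ∣ t * (y a * y b) - s a * s b ∣ ≤ δ) →
                ∣ t * ⟨ adj X · y , adj X · y ⟩ - ⟨ adj X · s , adj X · s ⟩ ∣ ≤ ι n * (ι n * (ι n * δ))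
  ∥Ay∥²-close t y s δ 0≤δ close = subst (λ x → ∣ x - ⟨ adj X · s , adj X · s ⟩ ∣ ≤ ι n * (ι n * (ι n * δ)))
    (sym (*-distribˡ-sum t (λ v → (adj X · y) v * (adj X · y) v)))
    (∣sum-sum∣≤ (λ v → t * ((adj X · y) v * (adj X · y) v)) (λ v → (adj X · s) v * (adj X · s) v) (ι n * (ι n * δ)) row)
    where
    entry : ∀ v a b → ∣ t * ((adj X v a * y a) * (adj X v b * y b)) - (adj X v a * s a) * (adj X v b * s b) ∣ ≤ δ
    entry v a b = begin
      ∣ t * ((p * y a) * (r * y b)) - (p * s a) * (r * s b) ∣
        ≡⟨ cong ∣_∣ (solve 7 (λ t p r y z s w → t :* ((p :* y) :* (r :* z)) :- (p :* s) :* (r :* w) := (p :* r) :* (t :* (y :* z) :- s :* w))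
             refl t p r (y a) (y b) (s a) (s b)) ⟩
      ∣ (p * r) * (t * (y a * y b) - s a * s b) ∣
        ≡⟨ ℚ.∣p*q∣≡∣p∣*∣q∣ (p * r) (t * (y a * y b) - s a * s b) ⟩
      ∣ p * r ∣ * ∣ t * (y a * y b) - s a * s b ∣
        ≤⟨ *-mono {q = 1ℚ} (ℚ.0≤∣p∣ (t * (y a * y b) - s a * s b)) (ι-mono {0} {1} ℕ.z≤n) pr≤1 (close a b) ⟩
      1ℚ * δ
        ≡⟨ ℚ.*-identityˡ δ ⟩
      δ ∎
      where
      open ℚ.≤-Reasoning
      p r : ℚ
      p = adj X v a
      r = adj X v b
      pr≤1 : ∣ p * r ∣ ≤ 1ℚ
      pr≤1 = ℚ.≤-trans (ℚ.≤-reflexive (ℚ.0≤p⇒∣p∣≡p (*-nonNeg (0≤adj X v a) (0≤adj X v b))))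
        (*-mono {q = 1ℚ} {s = 1ℚ} (0≤adj X v b) (ι-mono {0} {1} ℕ.z≤n) (adj≤1 X v a) (adj≤1 X v b))
    row : ∀ v → ∣ t * ((adj X · y) v * (adj X · y) v) - (adj X · s) v * (adj X · s) v ∣ ≤ ι n * (ι n * δ)
    row v = subst₂ (λ x z → ∣ x - z ∣ ≤ ι n * (ι n * δ))
      (sym (trans (cong (t *_) (sum*sum f f)) (trans (*-distribˡ-sum t (λ a → sum λ b → f a * f b))
        (sum-cong-≗ λ a → *-distribˡ-sum t (λ b → f a * f b)))))
      (sym (sum*sum g g))
      (∣sum-sum∣≤ (λ a → sum λ b → t * (f a * f b)) (λ a → sum λ b → g a * g b) (ι n * δ) λ a →
        ∣sum-sum∣≤ (λ b → t * (f a * f b)) (λ b → g a * g b) δ (entry v a))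
      where
      f g : Vector ℚ n
      f a = adj X v a * y a
      g a = adj X v a * s a

-- Rational approximants of the mixing column and the contradiction

seq-re-iτ* : ∀ τ z i → seq (re (iᶜ *ᶜ fromℝ τ *ᶜ z)) i ≡ - (seq τ i * seq (im z) i)
seq-re-iτ* τ z i = solve 3 (λ q x y → (con 0ℚ :* q :- con 1ℚ :* con 0ℚ) :* x :- (con 0ℚ :* con 0ℚ :+ con 1ℚ :* q) :* y := :- (q :* y)) refl
  (seq τ i) (seq (re z) i) (seq (im z) i)

seq-im-iτ* : ∀ τ z i → seq (im (iᶜ *ᶜ fromℝ τ *ᶜ z)) i ≡ seq τ i * seq (re z) i
seq-im-iτ* τ z i = solve 3 (λ q x y → (con 0ℚ :* q :- con 1ℚ :* con 0ℚ) :* y :+ (con 0ℚ :* con 0ℚ :+ con 1ℚ :* q) :* x := q :* x) refl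
  (seq τ i) (seq (re z) i) (seq (im z) i)

∀∞-all : ∀ {n} {P : Fin n → ℕ → Set} → (∀ a → ∀∞ (P a)) → ∀∞ λ i → ∀ a → P a i
∀∞-all {P = P} h = proj₂ (uniform (λ a _ i → P a i) (λ _ _ p → p) (λ a → 0 , h a))

p≤ι-suc*p : ∀ k {p} → 0ℚ ≤ p → p ≤ ι (suc k) * p
p≤ι-suc*p k {p} 0≤p = ℚ.≤-trans (p≤p+q (*-nonNeg (0≤ι k) 0≤p)) (ℚ.≤-reflexive (sym (ι-suc-* k p)))

1/1+≤1 : ∀ k → 1/1+ k ≤ 1ℚ
1/1+≤1 k = ℚ.≤-trans (p≤ι-suc*p k (ℚ.<⇒≤ (0<1/1+ k))) (ℚ.≤-reflexive (ι*1/1+ k))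

module _ {n} (X : Graph n) (phase : Fin n → Bool) (flip : ∀ {a b} → Graph._∼_ X a b → phase a ≡ not (phase b))
         (u : Fin n) (phase-u : phase u ≡ false) (τ : ℝ) where

  iτA : Matrix n
  iτA = (iᶜ *ᶜ fromℝ τ) • adjacency X

  seq-re-iτA : ∀ i a b → seq (re (iτA a b)) i ≡ 0ℚ
  seq-re-iτA i a b = trans (seq-re-iτ* τ (adjacency X a b) i)
    (trans (cong (λ x → - (seq τ i * x)) (seq-im-adjacency X a b i)) (cong -_ (ℚ.*-zeroʳ (seq τ i))))

  seq-im-iτA : ∀ i a b → seq (im (iτA a b)) i ≡ seq τ i * adj X a b
  seq-im-iτA i a b = trans (seq-im-iτ* τ (adjacency X a b) i) (cong (seq τ i *_) (seq-re-adjacency X a b i))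

  approx : ℕ → ℕ → Vector ℚ n
  approx i m = partialSum (term X phase flip u phase-u (seq τ i)) m

  -- `bounded iτA` gives one entry bound valid at all late `i`, so the truncation length can be
  -- fixed before `i`.
  approx-energy : ∀ ε → 0ℚ < ε → ∃ λ N → ∀ m → N ℕ.≤ m → ∀∞ λ i →
                  ∣ ⟨ adj X · approx i (suc m) , adj X · approx i (suc m) ⟩ - ι (degree X u) ∣ ≤ ε
  approx-energy ε 0<ε =
    let B , J , bnd = bounded iτA
        N , conserved = energy-conserved n (n ℕ.* B) n ε 0<ε
    in N , λ m N≤m → J , λ i J≤i → subst₂ (λ x y → ∣ x - y ∣ ≤ ε)
      (trans (sum-cong-≗ λ a → cong₂ _*_ (partialSum-K·term X phase flip u phase-u (seq τ i) (suc m) a)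
                                          (partialSum-K·term X phase flip u phase-u (seq τ i) (suc m) a))
             (K·-square X phase (approx i (suc m))))
      (K·term-0-square X phase flip u phase-u (seq τ i))
      (conserved m N≤m (qK-skew X phase flip u phase-u (seq τ i)) (K·term-expTerms X phase flip u phase-u (seq τ i))
        (∣K·term∣≤ X phase flip u phase-u iτA (seq τ i) i (seq-re-iτA i) (seq-im-iτA i) B (bnd i J≤i)))

  -- The entries of `U X τ` sample their m-th partial sums at different indices, but each sample is
  -- within `1/1+ m` of the values at all late indices, so one `i` serves all entries.
  approx-close : ∀ m → ∀∞ λ i → ∀ a →
    ∣ seq (re (U X τ a u)) m - Re (phase a) (approx i m a) ∣ ≤ 1/1+ m ×
    ∣ seq (im (U X τ a u)) m - Im (phase a) (approx i m a) ∣ ≤ 1/1+ m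
  approx-close m = ∀∞-all λ a → ∀∞-zip
    (λ i hre him →
      subst (λ x → ∣ seq (re (U X τ a u)) m - x ∣ ≤ 1/1+ m)
        (seq-re-expSum X phase flip u phase-u iτA (seq τ i) i (seq-re-iτA i) (seq-im-iτA i) m a) hre ,
      subst (λ x → ∣ seq (im (U X τ a u)) m - x ∣ ≤ 1/1+ m)
        (seq-im-expSum X phase flip u phase-u iτA (seq τ i) i (seq-re-iτA i) (seq-im-iτA i) m a) him)
    (limSeq-close (λ m → re (expSum iτA m a u)) m)
    (limSeq-close (λ m → im (expSum iτA m a u)) m)

  mixing-approx : ∀ t e → t ≤ 1ℚ → 0ℚ < e → e ≤ 1ℚ →
    (∀∞ λ m → ∀ a → ∣ seq (re (U X τ a u)) m * seq (re (U X τ a u)) m + seq (im (U X τ a u)) m * seq (im (U X τ a u)) m - t ∣ ≤ e + e) →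
    ∀ ε → 0ℚ < ε →
    ∃ λ y → (∀ a → ∣ y a * y a - t ∣ ≤ ι 3 * e) × ∣ ⟨ adj X · y , adj X · y ⟩ - ι (degree X u) ∣ ≤ ε
  mixing-approx t e t≤1 0<e e≤1 (N₁ , moduli) ε 0<ε =
    let N₂ , energy = approx-energy ε 0<ε
        -- The factor 10 is the one required by `modulus-close`.
        δ , 0<δ , 10δ≤e = shrink 10 e 0<e
        N₃ , small = 1/1+-small δ 0<δ
        m = N₁ ℕ.⊔ (N₂ ℕ.⊔ N₃)
        N₂₃≤m = ℕ.m≤n⊔m N₁ (N₂ ℕ.⊔ N₃)
        -- The sample is taken at `suc m`, since `energy m` concerns the partial sum with `suc m`
        -- terms.
        η≤δ = small (suc m) (ℕ.m≤n⇒m≤1+n (ℕ.m⊔n≤o⇒n≤o N₂ N₃ N₂₃≤m))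
        I , close-energy = energy m (ℕ.m⊔n≤o⇒m≤o N₂ N₃ N₂₃≤m)
        J , close = approx-close (suc m)
        i = I ℕ.⊔ J
        close-i = close i (ℕ.m≤n⊔m I J)
    in approx i (suc m) ,
       (λ a → subst (λ x → ∣ x - t ∣ ≤ ι 3 * e) (Re²+Im² (phase a) (approx i (suc m) a))
         (modulus-close (seq (re (U X τ a u)) (suc m)) (seq (im (U X τ a u)) (suc m))
           (Re (phase a) (approx i (suc m) a)) (Im (phase a) (approx i (suc m) a)) t e (1/1+ (suc m))
           (moduli (suc m) (ℕ.m≤n⇒m≤1+n (ℕ.m≤m⊔n N₁ (N₂ ℕ.⊔ N₃))) a)
           (proj₁ (close-i a)) (proj₂ (close-i a)) t≤1 e≤1 (1/1+≤1 (suc m))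
           (ℚ.≤-trans (ℚ.*-monoˡ-≤-nonNeg (ι 10) η≤δ) 10δ≤e))) ,
       close-energy i (ℕ.m≤m⊔n I J)

-- Two errors of at most 1/4 separate the integers: one from replacing the degree by ∥Ay∥², scaled
-- by n, and one from replacing n y_a y_b by products of signs. Integers less than 1 apart are
-- equal.
∥Ay∥²-rounding : ∀ {n} (X : Graph n) (y : Vector ℚ n) d δ ε → 0ℚ ≤ δ →
  (∀ a → ∣ ι n * (y a * y a) - 1ℚ ∣ ≤ δ) → ι n * (ι n * (ι n * δ)) ≤ ½ * ½ →
  ∣ ⟨ adj X · y , adj X · y ⟩ - ι d ∣ ≤ ε → ι n * ε ≤ ½ * ½ →
  ℤ.+ (n ℕ.* d) ≡ ∥A_∥² X (sign ∘ y)
∥Ay∥²-rounding {n} X y d δ ε 0≤δ y²≈ n³δ≤¼ energy nε≤¼ = fromℤ-discrete (ℤ.+ (n ℕ.* d)) (∥A_∥² X (sign ∘ y)) (begin-strict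
  ∣ ι (n ℕ.* d) - N ∣                    ≡⟨ cong (λ x → ∣ x - N ∣) (ι-* n d) ⟩
  ∣ ι n * ι d - N ∣                      ≤⟨ ∣p-r∣≤∣p-q∣+∣q-r∣ (ι n * ι d) (ι n * E) N ⟩
  ∣ ι n * ι d - ι n * E ∣ + ∣ ι n * E - N ∣
                                         ≤⟨ ℚ.+-mono-≤ first second ⟩
  ½ * ½ + ½ * ½                          ≡⟨ ½p+½p≡p ½ ⟩
  ½                                      <⟨ subst (½ <_) (½p+½p≡p 1ℚ) (subst (_< ½ * 1ℚ + ½ * 1ℚ) (ℚ.+-identityʳ ½) (ℚ.+-monoʳ-< ½ (ℚ.positive⁻¹ ½))) ⟩
  1ℚ                                     ∎)
  where
  open ℚ.≤-Reasoning
  N E : ℚ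
  N = fromℤ (∥A_∥² X (sign ∘ y))
  E = ⟨ adj X · y , adj X · y ⟩
  first : ∣ ι n * ι d - ι n * E ∣ ≤ ½ * ½
  first = begin
    ∣ ι n * ι d - ι n * E ∣      ≡⟨ cong ∣_∣ (solve 3 (λ n d e → n :* d :- n :* e := n :* (d :- e)) refl (ι n) (ι d) E) ⟩
    ∣ ι n * (ι d - E) ∣          ≡⟨ ℚ.∣p*q∣≡∣p∣*∣q∣ (ι n) (ι d - E) ⟩
    ∣ ι n ∣ * ∣ ι d - E ∣        ≡⟨ cong₂ _*_ (ℚ.0≤p⇒∣p∣≡p (0≤ι n)) (∣p-q∣≡∣q-p∣ (ι d) E) ⟩
    ι n * ∣ E - ι d ∣            ≤⟨ ℚ.*-monoˡ-≤-nonNeg (ι n) {{nonNegative (0≤ι n)}} energy ⟩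
    ι n * ε                      ≤⟨ nε≤¼ ⟩
    ½ * ½                        ∎
  second : ∣ ι n * E - N ∣ ≤ ½ * ½
  second = ℚ.≤-trans (subst (λ x → ∣ ι n * E - x ∣ ≤ ι n * (ι n * (ι n * δ))) (sym (fromℤ-∥A_∥² X (sign ∘ y)))
    (∥Ay∥²-close X (ι n) y (fromℤ ∘ sign ∘ y) δ 0≤δ λ a b → product-close-sign (ι n) δ (0≤ι n) (y a) (y b) (y²≈ a) (y²≈ b))) n³δ≤¼

≡₂0⇒even : ∀ n → ℤ.+ n ≡₂ ℤ.0ℤ → ¬ 2 ∤ n
≡₂0⇒even n (k , eq) 2∤n = 2∤n (divides ℤ.∣ k ∣ (trans (cong ℤ.∣_∣ (trans eq k+k≡k*2)) (ℤ.abs-* k (ℤ.+ 2))))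
  where
  k+k≡k*2 : ℤ.0ℤ ℤ.+ (k ℤ.+ k) ≡ k ℤ.* ℤ.+ 2
  k+k≡k*2 = solveᶻ 1 (λ k → conᶻ ℤ.0ℤ ⊕ (k ⊕ k) ≜ k ⊗ conᶻ (ℤ.+ 2)) refl k

bipartite⇒¬mixing : ∀ {n} (X : Graph n) → Bipartite X → ∀ u → 2 ∤ n ℕ.* degree X u → ¬ LocalεUniformMixing X u
-- With the order of the graph in the form `suc n′`, the target value in the mixing condition is
-- `1/1+ n′` by computation.
bipartite⇒¬mixing {suc n′} X (side , bip) u odd mixing =
  let e , 0<e , Be≤¼ = shrink (suc B) (½ * ½) (ℚ.positive⁻¹ (½ * ½))
      ε , 0<ε , nε≤¼ = shrink n (½ * ½) (ℚ.positive⁻¹ (½ * ½))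
  in impossible e ε 0<e Be≤¼ 0<ε nε≤¼
  where
  open Graph X
  open ℚ.≤-Reasoning
  phase : Fin (suc n′) → Bool
  -- Normalised so that `u` has phase false, which makes e_u = D e_u.
  phase a = side a xor side u
  flip : ∀ {a b} → a ∼ b → phase a ≡ not (phase b)
  flip {a} {b} a∼b = trans (cong (_xor side u) (Bool.¬-not (bip a∼b))) (sym (Bool.not-distribˡ-xor (side b) (side u)))
  ¼≤1 : ½ * ½ ≤ 1ℚ
  ¼≤1 = ℚ.≤-trans (½p≤p 0≤½) (½^-≤1 1)
  scale : ∀ p b → ∣ p - 1/1+ n′ ∣ ≤ b → ∣ ι (suc n′) * p - 1ℚ ∣ ≤ ι (suc n′) * b
  scale p b h = begin
    ∣ ι (suc n′) * p - 1ℚ ∣                          ≡⟨ cong (λ x → ∣ ι (suc n′) * p - x ∣) (ι*1/1+ n′) ⟨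
    ∣ ι (suc n′) * p - ι (suc n′) * 1/1+ n′ ∣        ≡⟨ cong ∣_∣ (solve 3 (λ n p r → n :* p :- n :* r := n :* (p :- r)) refl (ι (suc n′)) p (1/1+ n′)) ⟩
    ∣ ι (suc n′) * (p - 1/1+ n′) ∣                   ≡⟨ ℚ.∣p*q∣≡∣p∣*∣q∣ (ι (suc n′)) (p - 1/1+ n′) ⟩
    ∣ ι (suc n′) ∣ * ∣ p - 1/1+ n′ ∣                 ≡⟨ cong (_* ∣ p - 1/1+ n′ ∣) (ℚ.0≤p⇒∣p∣≡p (0≤ι (suc n′))) ⟩
    ι (suc n′) * ∣ p - 1/1+ n′ ∣                     ≤⟨ ℚ.*-monoˡ-≤-nonNeg (ι (suc n′)) {{nonNegative (0≤ι (suc n′))}} h ⟩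
    ι (suc n′) * b                                   ∎
  n B : ℕ
  n = suc n′
  -- The 3 comes from `modulus-close`, one n from scaling the target 1/n to 1, and n³ from
  -- `∥Ay∥²-close`. Shrinking by `suc B` instead of `B` also yields `e ≤ 1` directly.
  B = n ℕ.* (n ℕ.* (n ℕ.* (n ℕ.* 3)))
  collect : ∀ e → 0ℚ ≤ e → ι n * (ι n * (ι n * (ι n * (ι 3 * e)))) ≤ ι (suc B) * e
  collect e 0≤e = begin
    ι n * (ι n * (ι n * (ι n * (ι 3 * e))))          ≡⟨ solve 3 (λ n t e → n :* (n :* (n :* (n :* (t :* e)))) := n :* (n :* (n :* (n :* t))) :* e) refl (ι n) (ι 3) e ⟩
    ι n * (ι n * (ι n * (ι n * ι 3))) * e            ≡⟨ cong (_* e) (trans (ι-* n (n ℕ.* (n ℕ.* (n ℕ.* 3)))) (cong (ι n *_)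
                                                          (trans (ι-* n (n ℕ.* (n ℕ.* 3))) (cong (ι n *_)
                                                            (trans (ι-* n (n ℕ.* 3)) (cong (ι n *_) (ι-* n 3))))))) ⟨
    ι B * e                                          ≤⟨ q≤p+q 0≤e ⟩
    e + ι B * e                                      ≡⟨ ι-suc-* B e ⟨
    ι (suc B) * e                                    ∎
  module _ (e ε : ℚ) (0<e : 0ℚ < e) (Be≤¼ : ι (suc B) * e ≤ ½ * ½) (0<ε : 0ℚ < ε) (nε≤¼ : ι n * ε ≤ ½ * ½) where
    0≤e : 0ℚ ≤ e
    0≤e = ℚ.<⇒≤ 0<e
    e≤1 : e ≤ 1ℚ
    e≤1 = ℚ.≤-trans (p≤ι-suc*p B 0≤e) (ℚ.≤-trans Be≤¼ ¼≤1)
    round : (∃ λ y → (∀ a → ∣ y a * y a - 1/1+ n′ ∣ ≤ ι 3 * e) × ∣ ⟨ adj X · y , adj X · y ⟩ - ι (degree X u) ∣ ≤ ε) →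
            ∃ λ y → ℤ.+ (n ℕ.* degree X u) ≡ ∥A_∥² X (sign ∘ y)
    round (y , y²≈ , energy) = y , ∥Ay∥²-rounding X y (degree X u) (ι n * (ι 3 * e)) ε (*-nonNeg (0≤ι n) (*-nonNeg (0≤ι 3) 0≤e))
      (λ a → scale (y a * y a) (ι 3 * e) (y²≈ a)) (ℚ.≤-trans (collect e 0≤e) Be≤¼) energy nε≤¼
    impossible : ⊥
    impossible =
      let τ , moduli = mixing⇒moduli-close X u mixing e 0<e
          y , eq = round (mixing-approx X phase flip u (Bool.xor-same (side u)) τ (1/1+ n′) e (1/1+≤1 n′) 0<e e≤1 moduli ε 0<ε)
      in ≡₂0⇒even (n ℕ.* degree X u) (subst (_≡₂ ℤ.0ℤ) (sym eq) (∥Aσ∥²-even X (sign ∘ y) λ a → signOf*signOf (0ℚ ℚ.≤? y a))) odd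

-- Acyclic connected graphs are bipartite

odd : ℕ → Bool
odd zero    = false
odd (suc n) = not (odd n)

odd-+ : ∀ m n → odd (m ℕ.+ n) ≡ odd m xor odd n
odd-+ zero    n = refl
odd-+ (suc m) n = trans (cong not (odd-+ m n)) (Bool.not-distribˡ-xor (odd m) (odd n))

module _ {n} (X : Graph n) where

  open Graph X

  -- Vertices are indexed by all of ℕ, with arbitrary values beyond `L`, so that shifting and
  -- cutting a walk need no bounds on indices.
  record ClosedWalk (L : ℕ) : Set where
    field
      vertex : ℕ → Fin n
      edge   : ∀ i → i ℕ.< L → vertex i ∼ vertex (suc i)
      closed : vertex L ≡ vertex 0

  open ClosedWalk

  inner : ∀ i d r (W : ClosedWalk (i ℕ.+ (d ℕ.+ r))) → vertex W (i ℕ.+ d) ≡ vertex W i → ClosedWalk d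
  inner i d r W eq = record
    { vertex = λ t → vertex W (i ℕ.+ t)
    ; edge   = λ t t<d → subst (λ s → vertex W (i ℕ.+ t) ∼ vertex W s) (sym (ℕ.+-suc i t))
                 (edge W (i ℕ.+ t) (ℕ.+-monoʳ-< i (ℕ.<-≤-trans t<d (ℕ.m≤m+n d r))))
    ; closed = trans eq (cong (vertex W) (sym (ℕ.+-identityʳ i)))
    }

  -- Follows `f` up to index i and then jumps ahead by d. The two pieces fit together when
  -- `f (i + d) ≡ f i`.
  skip : ℕ → ℕ → (ℕ → Fin n) → ℕ → Fin n
  skip zero    d f t       = f (d ℕ.+ t)
  skip (suc i) d f zero    = f 0
  skip (suc i) d f (suc t) = skip i d (f ∘ suc) t

  skip-start : ∀ i d f → f (i ℕ.+ d) ≡ f i → skip i d f 0 ≡ f 0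
  skip-start zero    d f eq = trans (cong f (ℕ.+-identityʳ d)) eq
  skip-start (suc i) d f eq = refl

  skip-end : ∀ i d r f → skip i d f (i ℕ.+ r) ≡ f (i ℕ.+ (d ℕ.+ r))
  skip-end zero    d r f = refl
  skip-end (suc i) d r f = skip-end i d r (f ∘ suc)

  skip-edge : ∀ i d r f → f (i ℕ.+ d) ≡ f i → (∀ t → t ℕ.< i ℕ.+ (d ℕ.+ r) → f t ∼ f (suc t)) →
              ∀ t → t ℕ.< i ℕ.+ r → skip i d f t ∼ skip i d f (suc t)
  skip-edge zero d r f eq e t t<r = subst (λ s → f (d ℕ.+ t) ∼ f s) (sym (ℕ.+-suc d t)) (e (d ℕ.+ t) (ℕ.+-monoʳ-< d t<r))
  skip-edge (suc i) d r f eq e zero    _          = subst (f 0 ∼_) (sym (skip-start i d (f ∘ suc) eq)) (e 0 ℕ.z<s)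
  skip-edge (suc i) d r f eq e (suc t) (ℕ.s≤s t<) = skip-edge i d r (f ∘ suc) eq (λ s s< → e (suc s) (ℕ.s≤s s<)) t t<

  outer : ∀ i d r (W : ClosedWalk (i ℕ.+ (d ℕ.+ r))) → vertex W (i ℕ.+ d) ≡ vertex W i → ClosedWalk (i ℕ.+ r)
  outer i d r W eq = record
    { vertex = skip i d (vertex W)
    ; edge   = skip-edge i d r (vertex W) eq (edge W)
    ; closed = trans (skip-end i d r (vertex W)) (trans (closed W) (sym (skip-start i d (vertex W) eq)))
    }

  Repeats : ∀ {L} → ClosedWalk L → Set
  Repeats {L} W = ∃ λ (i : Fin L) → ∃ λ (j : Fin L) → i Fin.< j × vertex W (toℕ i) ≡ vertex W (toℕ j)

  repeats? : ∀ {L} (W : ClosedWalk L) → Dec (Repeats W)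
  repeats? W = Fin.any? λ i → Fin.any? λ j → (i Fin.<? j) ×-dec (vertex W (toℕ i) Fin.≟ vertex W (toℕ j))

  simple⇒cycle : ∀ {L} (W : ClosedWalk L) → odd L ≡ true → ¬ Repeats W → ∃ λ k → cycle k ⊆ᴳ X
  -- Parity excludes lengths 0 and 2, and a closed walk of length 1 would be a loop.
  simple⇒cycle {1} W _ _ = contradiction (subst (vertex W 0 ∼_) (closed W) (edge W 0 ℕ.z<s)) ∼-irrefl
  simple⇒cycle {suc (suc (suc k))} W _ simple = k , vertex W ∘ toℕ , injective , adjacent
    where
    injective : ∀ {i j : Fin (3 ℕ.+ k)} → vertex W (toℕ i) ≡ vertex W (toℕ j) → i ≡ j
    injective {i} {j} eq with Fin.<-cmp i j
    ... | tri< i<j _ _ = contradiction (i , j , i<j , eq) simple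
    ... | tri≈ _ i≡j _ = i≡j
    ... | tri> _ _ j<i = contradiction (j , i , j<i , sym eq) simple
    next : ∀ {i j} → Next k i j → vertex W (toℕ i) ∼ vertex W (toℕ j)
    next {i} {j} (inj₁ j≡1+i) = subst (λ t → vertex W (toℕ i) ∼ vertex W t) (sym j≡1+i) (edge W (toℕ i) (Fin.toℕ<n i))
    next {i} {j} (inj₂ (i≡ , j≡0)) = subst₂ (λ s t → vertex W s ∼ t) (sym i≡)
      (trans (closed W) (cong (vertex W) (sym j≡0))) (edge W (2 ℕ.+ k) ℕ.≤-refl)
    adjacent : ∀ {i j} → Graph._∼_ (cycle k) i j → vertex W (toℕ i) ∼ vertex W (toℕ j)
    adjacent (inj₁ h) = next h
    adjacent (inj₂ h) = ∼-sym (next h)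

  xor-true : ∀ p q → p xor q ≡ true → p ≡ true ⊎ q ≡ true
  xor-true true  q _ = inj₁ refl
  xor-true false q h = inj₂ h

  oddClosedWalk⇒cycle : ∀ L → ClosedWalk L → odd L ≡ true → ∃ λ k → cycle k ⊆ᴳ X
  oddClosedWalk⇒cycle = <-rec _ λ L rec W odd-L → cases L rec W odd-L (repeats? W)
    where
    -- The inner and outer lengths add up to `L`, so exactly one of them is odd. The successors
    -- record that the repeated positions are distinct and both before the end, which makes both
    -- walks shorter than `L`.
    split : ∀ {L} i d r → i ℕ.+ (suc d ℕ.+ suc r) ≡ L →
            (∀ {M} → M ℕ.< L → ClosedWalk M → odd M ≡ true → ∃ λ k → cycle k ⊆ᴳ X) →
            (W : ClosedWalk L) → odd L ≡ true → vertex W (i ℕ.+ suc d) ≡ vertex W i → ∃ λ k → cycle k ⊆ᴳ X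
    split i d r refl rec W odd-L eq with xor-true (odd (suc d)) (odd (i ℕ.+ suc r)) (trans (sym parity) odd-L)
      where
      parity : odd (i ℕ.+ (suc d ℕ.+ suc r)) ≡ odd (suc d) xor odd (i ℕ.+ suc r)
      parity = trans (cong odd (x∙yz≈y∙xz i (suc d) (suc r))) (odd-+ (suc d) (i ℕ.+ suc r))
    ... | inj₁ odd-d = rec (ℕ.<-≤-trans (ℕ.m<m+n (suc d) ℕ.z<s) (ℕ.m≤n+m (suc d ℕ.+ suc r) i)) (inner i (suc d) (suc r) W eq) odd-d
    ... | inj₂ odd-r = rec (ℕ.+-monoʳ-< i (ℕ.m<n+m (suc r) ℕ.z<s)) (outer i (suc d) (suc r) W eq) odd-r

    cases : ∀ L → (∀ {M} → M ℕ.< L → ClosedWalk M → odd M ≡ true → ∃ λ k → cycle k ⊆ᴳ X) →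
            (W : ClosedWalk L) → odd L ≡ true → Dec (Repeats W) → ∃ λ k → cycle k ⊆ᴳ X
    cases L rec W odd-L (no simple) = simple⇒cycle W odd-L simple
    cases L rec W odd-L (yes (i , j , i<j , eq)) =
      let d , i+d≡j = ℕ.m≤n⇒∃[o]m+o≡n i<j
          r , j+r≡L = ℕ.m≤n⇒∃[o]m+o≡n (Fin.toℕ<n j)
          j≡ = trans (ℕ.+-suc (toℕ i) d) i+d≡j
      in split (toℕ i) d r
           (trans (sym (ℕ.+-assoc (toℕ i) (suc d) (suc r))) (trans (cong (ℕ._+ suc r) j≡) (trans (ℕ.+-suc (toℕ j) r) j+r≡L)))
           rec W odd-L (trans (cong (vertex W) j≡) (sym eq))

  vertexAt : ∀ {a b} → Star _∼_ a b → ℕ → Fin n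
  vertexAt {a} Star.ε  _       = a
  vertexAt {a} (e ◅ p) zero    = a
  vertexAt     (e ◅ p) (suc t) = vertexAt p t

  len : ∀ {a b} → Star _∼_ a b → ℕ
  len Star.ε  = 0
  len (e ◅ p) = suc (len p)

  vertexAt-0 : ∀ {a b} (p : Star _∼_ a b) → vertexAt p 0 ≡ a
  vertexAt-0 Star.ε  = refl
  vertexAt-0 (e ◅ p) = refl

  vertexAt-len : ∀ {a b} (p : Star _∼_ a b) → vertexAt p (len p) ≡ b
  vertexAt-len Star.ε  = refl
  vertexAt-len (e ◅ p) = vertexAt-len p

  vertexAt-edge : ∀ {a b} (p : Star _∼_ a b) t → t ℕ.< len p → vertexAt p t ∼ vertexAt p (suc t)
  vertexAt-edge {a} (e ◅ p) zero    _          = subst (a ∼_) (sym (vertexAt-0 p)) e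
  vertexAt-edge     (e ◅ p) (suc t) (ℕ.s≤s t<) = vertexAt-edge p t t<

  closedWalk : ∀ {a} (p : Star _∼_ a a) → ClosedWalk (len p)
  closedWalk p = record
    { vertex = vertexAt p
    ; edge   = vertexAt-edge p
    ; closed = trans (vertexAt-len p) (sym (vertexAt-0 p))
    }

  len-◅◅ : ∀ {a b c} (p : Star _∼_ a b) (q : Star _∼_ b c) → len (p ◅◅ q) ≡ len p ℕ.+ len q
  len-◅◅ Star.ε  q = refl
  len-◅◅ (e ◅ p) q = cong suc (len-◅◅ p q)

  len-revApp : ∀ {a b c} (p : Star _∼_ b a) (q : Star _∼_ b c) → len (revApp ∼-sym p q) ≡ len p ℕ.+ len q
  len-revApp Star.ε  q = refl
  len-revApp (e ◅ p) q = trans (len-revApp p (∼-sym e ◅ q)) (ℕ.+-suc (len p) (len q))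

  -- The side of a vertex is the parity of the path from the root that `connected` happens to
  -- supply, which need not be a shortest one. An edge within one side closes up two such paths to a
  -- walk of odd length.
  acyclic⇒bipartite : ∀ (root : Fin n) → Tree X → Bipartite X
  acyclic⇒bipartite root (connected , acyclic) = side , λ {v} {w} v∼w side-eq → acyclic
    (oddClosedWalk⇒cycle _ (closedWalk (loop v∼w)) (trans (cong odd (len-loop v∼w))
      (trans (odd-+ (len (path v)) (suc (len (path w)))) (trans (cong (λ s → side v xor not s) (sym side-eq)) (xor-not (side v))))))
    where
    path : ∀ v → Star _∼_ root v
    path = connected root
    side : Fin n → Bool
    side v = odd (len (path v))
    loop : ∀ {v w} → v ∼ w → Star _∼_ root root
    loop {v} {w} v∼w = path v ◅◅ (v∼w ◅ revApp ∼-sym (path w) Star.ε)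
    len-loop : ∀ {v w} (v∼w : v ∼ w) → len (loop v∼w) ≡ len (path v) ℕ.+ suc (len (path w))
    len-loop {v} {w} v∼w = trans (len-◅◅ (path v) (v∼w ◅ revApp ∼-sym (path w) Star.ε))
      (cong (λ l → len (path v) ℕ.+ suc l) (trans (len-revApp (path w) Star.ε) (ℕ.+-identityʳ (len (path w)))))
    xor-not : ∀ p → p xor not p ≡ true
    xor-not true  = refl
    xor-not false = refl

tree⇒bipartite : ∀ {n} (X : Graph n) → Tree X → Bipartite X
tree⇒bipartite {zero}  X tree = (λ ()) , λ { {()} }
tree⇒bipartite {suc n} X tree = acyclic⇒bipartite X zero tree

corollary24 : (∀ {n} (X : Graph n) → Connected X → 2 ∤ n → Bipartite X →
    ∀ u → Pendent X u → ¬ LocalεUniformMixing X u)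
    ×
    (∀ {n} (X : Graph n) → Connected X → 2 ∤ n →
    Tree X ⊎ (Bipartite X × Unicyclic X × ¬ IsCycle X) →
    ∀ u → Pendent X u → ¬ LocalεUniformMixing X u)
corollary24 = (λ X _ → pendent⇒¬mixing X) , λ where
    X _ 2∤n (inj₁ tree)            → pendent⇒¬mixing X 2∤n (tree⇒bipartite X tree)
    X _ 2∤n (inj₂ (bipartite , _)) → pendent⇒¬mixing X 2∤n bipartite
  where
  pendent⇒¬mixing : ∀ {n} (X : Graph n) → 2 ∤ n → Bipartite X → ∀ u → Pendent X u → ¬ LocalεUniformMixing X u
  pendent⇒¬mixing {n} X 2∤n bipartite u pendent = bipartite⇒¬mixing X bipartite u
    (subst (2 ∤_) (sym (trans (cong (n ℕ.*_) pendent) (ℕ.*-identityʳ n))) 2∤n)
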